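{- Let $n\ge3$ and let $\lambda=(\lambda_1,\lambda_2)$ be a partition of $n$ with $\lambda_1>\lambda_2\ge1$. Let $\Gamma,\Gamma'$ be (reduced) nb-admissible $\overline{\mathcal S_n}$-graphs such that $U(\Gamma)\simeq U(\Gamma')\simeq\overline{\mathcal D}_\lambda$. Then $\Gamma\simeq\Gamma'$ as $\overline{\mathcal S_n}$-graphs. As a result, they are also isomorphic to $\overline\Gamma_\lambda$.
   Context: **Residues and cyclic intervals.** For $k\in\mathbb Z$, $\overline{k}$ is the unique element of $\{1,\dots,n\}$ congruent to $k$ modulo $n$; $[a,b]=\{x\in\mathbb Z\mid a\le x\le b\}$. For $a,b\in\{1,\dots,n\}$, $\langle a,b\rangle\subset\{1,\dots,n\}$ is $\emptyset$ if $a=\overline{b+1}$, and otherwise is the cyclic interval $\{a,\overline{a+1},\dots,b\}$. **Groups.** $\overline{\mathcal S_n}$ is the affine symmetric group, a Coxeter group with simple reflections $s_0=s_n,s_1,\dots,s_{n-1}$ whose Dynkin diagram is the cycle of type $\widetilde A_{n-1}$. Simple reflections are identified with $[1,n]$ via $s_i\leftrightarrow i$. **Tableaux.** $\mathrm{RSYT}(\lambda)$ is the set of fillings of the Young diagram of $\lambda$ (English convention) by $1,\dots,n$, each used once, with rows increasing; $T^1$ (top row) and $T^2$ are the rows of $T$, regarded as sets. Whenever entries are interchanged, rows are re-sorted. $\overline{\mathrm{des}}(T)=\{i\in[1,n]\mid i\text{ lies in a strictly higher row of }T\text{ than }\overline{i+1}\}$. $T,T'\in\mathrm{RSYT}(\lambda)$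 are connected by a Knuth move if $\overline{\mathrm{des}}(T),\overline{\mathrm{des}}(T')$ are incomparable under inclusion and $T'$ is obtained from $T$ by interchanging $\overline i$ and $\overline{i+1}$ for some $i$. **Labeled graphs and $W$-graphs.** For a Coxeter group $W$ with simple reflections $I$, an $I$-labeled graph $(V,m,\tau)$ consists of a set $V$, maps $m:V\times V\to\mathbb Z[q^{\pm1/2}]$ (written $m(u\triangleright v)$) and $\tau:V\to\{\text{subsets of }I\}$, such that for each $v$ only finitely many $w$ have $m(v\triangleright w)\ne0$ or $m(w\triangleright v)\neq0$. It is reduced if $m(u\triangleright v)=0$ whenever $\tau(u)\subset\tau(v)$. It is nb-admissible if all $m(u\triangleright v)\in\mathbb N=\{0,1,2,\dots\}$ and $m(u\triangleright v)=m(v\triangleright u)$ whenever $\tau(u),\tau(v)$ are incomparable. Isomorphisms are bijections of vertices preserving $m$ and $\tau$. Let $\mathcal H_W$ be the Iwahori–Hecke algebra over $\mathbb Z[q^{\pm1/2}]$ with generators $T_i$ ($i\in I$) satisfying the braid relations and $(T_i-q)(T_i+1)=0$. The graph is a $W$-graph if the formulas $T_i(u)=qu$ if $i\notin\tau(u)$, and $T_i(u)=-u+q^{1/2}\sum_{v:\,i\notin\tau(v)}m(u\triangleright v)\,v$ if $i\in\tau(u)$, define an $\mathcal H_W$-module structure on $\bigoplus_{v\in V}\mathbb Z[q^{\pm1/2}]v$. The simple underlying graph $U(\Gamma)$ has the same $V,\tau$, and weight $m'$ with $m'(u\triangleright v)=m'(v\triangleright u)=1$ if $m(u\triangleright v)=m(v\triangleright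 u)=1$, and $m'(u\triangleright v)=m'(v\triangleright u)=0$ otherwise. **The graph $\overline{\mathcal D}_\lambda$.** It is the $[1,n]$-labeled graph with vertex set $\mathrm{RSYT}(\lambda)$, $\tau=\overline{\mathrm{des}}$, and $m(u\triangleright v)=m(v\triangleright u)=1$ if $u,v$ are connected by a Knuth move, $0$ otherwise. **The graph $\overline\Gamma_\lambda$.** Its vertex set is $\mathrm{RSYT}(\lambda)$, $\tau=\overline{\mathrm{des}}$, and $m(s\triangleright t)\in\{0,1\}$ with $m(s\triangleright t)=1$ iff there is a move from $s$ to $t$ of one of the following kinds. 1. (First kind) $t$ is obtained from $s$ by interchanging $\overline i$ and $\overline{i+1}$, where $\overline i\in s^1$ and $\overline{i+1}\in s^2$. 2. (Second kind) $t$ is obtained from $s$ by interchanging $\overline i$ and $\overline j$, where $\overline i\in s^2$, $\overline j\in s^1$, $\overline i\ne\overline{j+1}$, and: (a) $\overline{j-i}$ is odd; (b) $\overline{i+1}\in s^1$ and $\overline{j-1}\in s^2$; (c) $\overline{i-1}\in s^1$ or $\overline{j+1}\in s^2$; (d) $\#(s^2\cap\langle\overline{j-1-2k},\overline{j-2}\rangle)\ge k$ for all $k\in\{1,\dots,\frac{\overline{j-i}-3}{2}\}$; (e) $\#(s^2\cap\langle\overline{i+2},\overline{j-2}\rangle)=\frac{\overline{j-i}-3}{2}$ when $\overline j\ne\overline{i+1}$. -}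

module Defs where

open import Algebra.Bundles using (CommutativeRing; Ring)
open import Algebra.Module.Structures using (IsLeftModule)
open import Data.Bool.Base using (Bool; if_then_else_)
import Data.Bool.Properties as Bool
open import Data.Empty using (⊥-elim-irr)
open import Data.Fin.Base as Fin using (Fin; toℕ; fromℕ<)
open import Data.Fin.Permutation.Components using (transpose)
import Data.Fin.Properties as Fin
open import Data.Fin.Subset as Subset using (Subset; _∈_; _∉_; _⊆_; _⊈_; _∩_; ∣_∣)
open import Data.Fin.Subset.Properties using (_∈?_; _⊆?_)
open import Data.Integer.Base as ℤ using (ℤ; +_)
import Data.Integer.DivMod as ℤ
import Data.Integer.Properties as ℤ
open import Data.List.Base as List using (List; []; _∷_; _++_; [_])
import Data.List.Membership.DecPropositional as DecMembership
open import Data.List.Membership.Propositional using () renaming (_∈_ to _∈ᴸ_; _∉_ to _∉ᴸ_)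
open import Data.List.Membership.Propositional.Properties
  using (∈-++⁺ˡ; ∈-++⁺ʳ; ∈-allFin; ∈-cartesianProductWith⁺; ∈-cartesianProduct⁺; ∈-concatMap⁺)
import Data.List.Properties as List
open import Data.List.Relation.Unary.All as All using (All)
open import Data.List.Relation.Unary.Any as Any using (here; there)
open import Data.Nat.Base as ℕ using (ℕ; zero; suc; NonZero)
import Data.Nat.DivMod as ℕ
import Data.Nat.Properties as ℕ
open import Data.Product.Base using (Σ-syntax; ∃-syntax; _×_; _,_; proj₁; proj₂; uncurry)
open import Data.Sum.Base using (_⊎_; [_,_]′)
open import Data.Vec.Base as Vec using (Vec; []; _∷_; count)
import Data.Vec.Membership.DecPropositional as DecVecMembership
import Data.Vec.Properties as Vec
import Data.Vec.Relation.Unary.Linked as Linked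
open Linked using (Linked)
open import Function.Base using (_∘_; case_of_)
open import Function.Bundles using (_↔_; Inverse)
open import Relation.Binary.Definitions using (DecidableEquality)
open import Relation.Binary.PropositionalEquality
  using (_≡_; _≢_; refl; sym; trans; cong; cong₂; subst; module ≡-Reasoning)
open import Relation.Nullary.Decidable
  using (Dec; yes; no; does; map′; ¬?; _×-dec_; _⊎-dec_; _→-dec_; dec-true; dec-false)
open import Relation.Nullary.Negation using (¬_; contradiction)

------------------------------------------------------------------------
-- ℤ[q^{±1/2}]

module Laurent where

  open import Data.Integer.Solver using (module +-*-Solver)

  -- A finite formal sum of monomials; the pair (e , c) stands for c·q^{e/2}.
  -- Exponents may repeat, so polynomials are compared by coefficients.
  Laurent : Set
  Laurent = List (ℤ × ℤ)

  coeff : Laurent → ℤ → ℤ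
  coeff []            k = ℤ.0ℤ
  coeff ((e , c) ∷ p) k = (if does (e ℤ.≟ k) then c else ℤ.0ℤ) ℤ.+ coeff p k

  infix 4 _≈_ _≟_
  record _≈_ (p p′ : Laurent) : Set where
    constructor mk≈
    field coeff-≡ : ∀ k → coeff p k ≡ coeff p′ k
  open _≈_ public

  infixl 6 _+_
  infixl 7 _*_ _·ₘ_
  infix  8 -_

  _+_ : Laurent → Laurent → Laurent
  _+_ = _++_

  -_ : Laurent → Laurent
  -_ = List.map λ (e , c) → e , ℤ.- c

  _·ₘ_ : ℤ × ℤ → Laurent → Laurent
  (e , c) ·ₘ p = List.map (λ (e′ , c′) → e ℤ.+ e′ , c ℤ.* c′) p

  _*_ : Laurent → Laurent → Laurent
  []      * p′ = []
  (x ∷ p) * p′ = x ·ₘ p′ + p * p′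

  constant : ℤ → Laurent
  constant c = [ ℤ.0ℤ , c ]

  0# 1# q q^½ : Laurent
  0#  = []
  1#  = constant ℤ.1ℤ
  q   = [ + 2 , ℤ.1ℤ ]
  q^½ = [ + 1 , ℤ.1ℤ ]

  fromℕ : ℕ → Laurent
  fromℕ k = constant (+ k)

  open ≡-Reasoning

  δ : ℤ → ℤ → ℤ → ℤ
  δ e k c = if does (e ℤ.≟ k) then c else ℤ.0ℤ

  addˡ : ∀ a {b c} → b ≡ c → a ℤ.+ b ≡ a ℤ.+ c
  addˡ a = cong (λ x → a ℤ.+ x)

  coeff-+ : ∀ p p′ k → coeff (p + p′) k ≡ coeff p k ℤ.+ coeff p′ k
  coeff-+ []            p′ k = sym (ℤ.+-identityˡ _)
  coeff-+ ((e , c) ∷ p) p′ k =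
    trans (addˡ (δ e k c) (coeff-+ p p′ k)) (sym (ℤ.+-assoc (δ e k c) (coeff p k) (coeff p′ k)))

  coeff-neg : ∀ p k → coeff (- p) k ≡ ℤ.- coeff p k
  coeff-neg []            k = refl
  coeff-neg ((e , c) ∷ p) k with does (e ℤ.≟ k)
  ... | Bool.true  = trans (addˡ (ℤ.- c) (coeff-neg p k)) (sym (ℤ.neg-distrib-+ c (coeff p k)))
  ... | Bool.false = trans (addˡ ℤ.0ℤ (coeff-neg p k)) (sym (ℤ.neg-distrib-+ ℤ.0ℤ (coeff p k)))

  shift : ∀ e e′ k → does (e ℤ.+ e′ ℤ.≟ k) ≡ does (e′ ℤ.≟ k ℤ.- e)
  shift e e′ k with e′ ℤ.≟ k ℤ.- e
  ... | yes refl = dec-true (e ℤ.+ (k ℤ.- e) ℤ.≟ k) (solve 2 (λ e k → e :+ (k :- e) := k) refl e k)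
    where open +-*-Solver
  ... | no ¬p = dec-false (e ℤ.+ e′ ℤ.≟ k) λ { refl →
    ¬p (solve 2 (λ e e′ → e′ := e :+ e′ :- e) refl e e′) }
    where open +-*-Solver

  coeff-·ₘ : ∀ e c p k → coeff ((e , c) ·ₘ p) k ≡ c ℤ.* coeff p (k ℤ.- e)
  coeff-·ₘ e c []              k = sym (ℤ.*-zeroʳ c)
  coeff-·ₘ e c ((e′ , c′) ∷ p) k
    rewrite shift e e′ k | coeff-·ₘ e c p k with does (e′ ℤ.≟ k ℤ.- e)
  ... | Bool.true  = sym (ℤ.*-distribˡ-+ c c′ _)
  ... | Bool.false = trans (ℤ.+-identityˡ _) (cong (c ℤ.*_) (sym (ℤ.+-identityˡ _)))

  coeff-∷* : ∀ e c p p′ k →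
    coeff (((e , c) ∷ p) * p′) k ≡ c ℤ.* coeff p′ (k ℤ.- e) ℤ.+ coeff (p * p′) k
  coeff-∷* e c p p′ k = trans (coeff-+ ((e , c) ·ₘ p′) (p * p′) k)
    (cong (ℤ._+ coeff (p * p′) k) (coeff-·ₘ e c p′ k))

  coeff-*∷ : ∀ e c p p′ k →
    coeff (p′ * ((e , c) ∷ p)) k ≡ c ℤ.* coeff p′ (k ℤ.- e) ℤ.+ coeff (p′ * p) k
  coeff-*∷ e c p []               k = sym (trans (ℤ.+-identityʳ _) (ℤ.*-zeroʳ c))
  coeff-*∷ e c p ((e′ , c′) ∷ p′) k = begin
    coeff (((e′ , c′) ∷ p′) * ((e , c) ∷ p)) k
      ≡⟨ coeff-∷* e′ c′ p′ ((e , c) ∷ p) k ⟩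
    c′ ℤ.* (δ e (k ℤ.- e′) c ℤ.+ P) ℤ.+ coeff (p′ * ((e , c) ∷ p)) k
      ≡⟨ addˡ (c′ ℤ.* (δ e (k ℤ.- e′) c ℤ.+ P)) (coeff-*∷ e c p p′ k) ⟩
    c′ ℤ.* (δ e (k ℤ.- e′) c ℤ.+ P) ℤ.+ (c ℤ.* P′ ℤ.+ coeff (p′ * p) k)
      ≡⟨ solve 6 (λ c′ d P c P′ r → c′ :* (d :+ P) :+ (c :* P′ :+ r)
                    := c′ :* d :+ (c :* P′ :+ (c′ :* P :+ r)))
           refl c′ (δ e (k ℤ.- e′) c) P c P′ (coeff (p′ * p) k) ⟩
    c′ ℤ.* δ e (k ℤ.- e′) c ℤ.+ (c ℤ.* P′ ℤ.+ (c′ ℤ.* P ℤ.+ coeff (p′ * p) k))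
      ≡⟨ cong₂ (λ x y → x ℤ.+ (c ℤ.* P′ ℤ.+ y)) swap-δ (sym (coeff-∷* e′ c′ p′ p k)) ⟩
    c ℤ.* δ e′ (k ℤ.- e) c′ ℤ.+ (c ℤ.* P′ ℤ.+ coeff (((e′ , c′) ∷ p′) * p) k)
      ≡⟨ solve 4 (λ c d P′ r → c :* d :+ (c :* P′ :+ r) := c :* (d :+ P′) :+ r)
           refl c (δ e′ (k ℤ.- e) c′) P′ (coeff (((e′ , c′) ∷ p′) * p) k) ⟩
    c ℤ.* (δ e′ (k ℤ.- e) c′ ℤ.+ P′) ℤ.+ coeff (((e′ , c′) ∷ p′) * p) k ∎
    where
    open +-*-Solver
    P  = coeff p (k ℤ.- e′)
    P′ = coeff p′ (k ℤ.- e)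
    swap-δ : c′ ℤ.* δ e (k ℤ.- e′) c ≡ c ℤ.* δ e′ (k ℤ.- e) c′
    swap-δ rewrite sym (shift e′ e k) | sym (shift e e′ k) | ℤ.+-comm e′ e
      with does (e ℤ.+ e′ ℤ.≟ k)
    ... | Bool.true  = ℤ.*-comm c′ c
    ... | Bool.false = trans (ℤ.*-zeroʳ c′) (sym (ℤ.*-zeroʳ c))

  *-comm : ∀ p p′ → p * p′ ≈ p′ * p
  *-comm []            p′ = mk≈ λ k → zeroʳ p′ k
    where
    zeroʳ : ∀ p k → ℤ.0ℤ ≡ coeff (p * []) k
    zeroʳ []      k = refl
    zeroʳ (_ ∷ p) k = zeroʳ p k
  *-comm ((e , c) ∷ p) p′ = mk≈ λ k → trans (coeff-∷* e c p p′ k)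
    (trans (addˡ (c ℤ.* coeff p′ (k ℤ.- e)) (coeff-≡ (*-comm p p′) k))
           (sym (coeff-*∷ e c p p′ k)))

  ≈-trans : ∀ {x y z} → x ≈ y → y ≈ z → x ≈ z
  ≈-trans x≈y y≈z = mk≈ λ k → trans (coeff-≡ x≈y k) (coeff-≡ y≈z k)

  ≈-reflexive : ∀ {x y} → x ≡ y → x ≈ y
  ≈-reflexive refl = mk≈ λ _ → refl

  *-congˡ : ∀ p {x y} → x ≈ y → p * x ≈ p * y
  *-congˡ []            x≈y = mk≈ λ _ → refl
  *-congˡ ((e , c) ∷ p) {x} {y} x≈y = mk≈ λ k → trans (coeff-∷* e c p x k)
    (trans (cong₂ (λ a b → c ℤ.* a ℤ.+ b) (coeff-≡ x≈y _) (coeff-≡ (*-congˡ p x≈y) k))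
           (sym (coeff-∷* e c p y k)))

  *-cong : ∀ {x y u v} → x ≈ y → u ≈ v → x * u ≈ y * v
  *-cong {x} {y} {u} {v} x≈y u≈v = ≈-trans (*-congˡ x u≈v)
    (≈-trans (*-comm x v) (≈-trans (*-congˡ v x≈y) (*-comm v y)))

  +-cong : ∀ {x y u v} → x ≈ y → u ≈ v → x + u ≈ y + v
  +-cong {x} {y} {u} {v} x≈y u≈v = mk≈ λ k → trans (coeff-+ x u k)
    (trans (cong₂ ℤ._+_ (coeff-≡ x≈y k) (coeff-≡ u≈v k)) (sym (coeff-+ y v k)))

  neg-cong : ∀ {x y} → x ≈ y → - x ≈ - y
  neg-cong {x} {y} x≈y = mk≈ λ k → trans (coeff-neg x k)
    (trans (cong ℤ.-_ (coeff-≡ x≈y k)) (sym (coeff-neg y k)))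

  +-comm : ∀ x y → x + y ≈ y + x
  +-comm x y = mk≈ λ k →
    trans (coeff-+ x y k) (trans (ℤ.+-comm _ (coeff y k)) (sym (coeff-+ y x k)))

  inverseʳ : ∀ x → x + - x ≈ 0#
  inverseʳ x = mk≈ λ k → trans (coeff-+ x (- x) k)
    (trans (addˡ (coeff x k) (coeff-neg x k)) (ℤ.+-inverseʳ (coeff x k)))

  distribʳ : ∀ x y z → (y + z) * x ≡ y * x + z * x
  distribʳ x []      z = refl
  distribʳ x (m ∷ y) z =
    trans (cong₂ _+_ refl (distribʳ x y z)) (sym (List.++-assoc (m ·ₘ x) (y * x) (z * x)))

  distribˡ : ∀ x y z → x * (y + z) ≈ x * y + x * z
  distribˡ x y z = ≈-trans (*-comm x (y + z))
    (≈-trans (≈-reflexive (distribʳ x y z)) (+-cong (*-comm y x) (*-comm z x)))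

  ·ₘ-assoc : ∀ m y z → (m ·ₘ y) * z ≡ m ·ₘ (y * z)
  ·ₘ-assoc m       []              z = refl
  ·ₘ-assoc (e , c) ((e′ , c′) ∷ y) z = begin
    (e ℤ.+ e′ , c ℤ.* c′) ·ₘ z + ((e , c) ·ₘ y) * z
      ≡⟨ cong₂ _+_
           (trans (List.map-cong (λ (a , b) → cong₂ _,_ (ℤ.+-assoc e e′ a) (ℤ.*-assoc c c′ b)) z)
                  (List.map-∘ z))
           (·ₘ-assoc (e , c) y z) ⟩
    (e , c) ·ₘ ((e′ , c′) ·ₘ z) + (e , c) ·ₘ (y * z)
      ≡⟨ List.map-++ _ ((e′ , c′) ·ₘ z) (y * z) ⟨
    (e , c) ·ₘ ((e′ , c′) ·ₘ z + y * z) ∎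

  *-assoc : ∀ x y z → (x * y) * z ≡ x * (y * z)
  *-assoc []      y z = refl
  *-assoc (m ∷ x) y z = trans (distribʳ z (m ·ₘ y) (x * y)) (cong₂ _+_ (·ₘ-assoc m y z) (*-assoc x y z))

  *-identityˡ : ∀ x → 1# * x ≡ x
  *-identityˡ x = trans (List.++-identityʳ _)
    (trans (List.map-cong (λ (a , b) → cong₂ _,_ (ℤ.+-identityˡ a) (ℤ.*-identityˡ b)) x) (List.map-id x))

  commutativeRing : CommutativeRing _ _
  commutativeRing = record
    { Carrier = Laurent ; _≈_ = _≈_ ; _+_ = _+_ ; _*_ = _*_ ; -_ = -_ ; 0# = 0# ; 1# = 1#
    ; isCommutativeRing = record
      { isRing = record
        { +-isAbelianGroup = record
          { isGroup = record
            { isMonoid = record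
              { isSemigroup = record
                { isMagma = record
                  { isEquivalence = record
                    { refl = mk≈ λ _ → refl
                    ; sym = λ x≈y → mk≈ λ k → sym (coeff-≡ x≈y k)
                    ; trans = ≈-trans }
                  ; ∙-cong = +-cong }
                ; assoc = λ x y z → ≈-reflexive (List.++-assoc x y z) }
              ; identity = (λ _ → mk≈ λ _ → refl) , λ x → ≈-reflexive (List.++-identityʳ x) }
            ; inverse = (λ x → ≈-trans (+-comm (- x) x) (inverseʳ x)) , inverseʳ
            ; ⁻¹-cong = neg-cong }
          ; comm = +-comm }
        ; *-cong = *-cong
        ; *-assoc = λ x y z → ≈-reflexive (*-assoc x y z)
        ; *-identity = (λ x → ≈-reflexive (*-identityˡ x))
                     , λ x → ≈-trans (*-comm x 1#) (≈-reflexive (*-identityˡ x))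
        ; distrib = distribˡ , λ x y z → ≈-reflexive (distribʳ x y z) }
      ; *-comm = *-comm } }

  0≉1 : ¬ 0# ≈ 1#
  0≉1 0≈1 = case coeff-≡ 0≈1 ℤ.0ℤ of λ ()

  exponents : Laurent → List ℤ
  exponents = List.map proj₁

  coeff-∉ : ∀ p {k} → k ∉ᴸ exponents p → coeff p k ≡ ℤ.0ℤ
  coeff-∉ []            _  = refl
  coeff-∉ ((e , c) ∷ p) {k} k∉
    rewrite dec-false (e ℤ.≟ k) (λ e≡k → k∉ (here (sym e≡k))) | coeff-∉ p (k∉ ∘ there) = refl

  _≟_ : ∀ p p′ → Dec (p ≈ p′)
  p ≟ p′ = map′ to (λ p≈p′ → All.universal (coeff-≡ p≈p′) es) (All.all? agree? es)
    where
    open DecMembership ℤ._≟_ using () renaming (_∈?_ to _∈ᴸ?_)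
    es = exponents p ++ exponents p′
    agree? : ∀ k → Dec (coeff p k ≡ coeff p′ k)
    agree? k = coeff p k ℤ.≟ coeff p′ k
    to : All (λ k → coeff p k ≡ coeff p′ k) es → p ≈ p′
    to agree = mk≈ λ k → case k ∈ᴸ? es of λ where
      (yes k∈) → All.lookup agree k∈
      (no  k∉) → trans (coeff-∉ p (k∉ ∘ ∈-++⁺ˡ)) (sym (coeff-∉ p′ (k∉ ∘ ∈-++⁺ʳ _)))

open Laurent using (Laurent; 0#; 1#; q; q^½; fromℕ)
open CommutativeRing Laurent.commutativeRing using (_≈_)

private module R = CommutativeRing Laurent.commutativeRing

------------------------------------------------------------------------
-- The direct sum ⊕_{v ∈ V} ℤ[q^{±1/2}] v

module DirectSum {V : Set} (_≟_ : DecidableEquality V) where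

  record ⊕ : Set where
    field
      coeff    : V → Laurent
      support  : List V
      vanishes : ∀ {v} → v ∉ᴸ support → coeff v ≈ 0#
  open ⊕ public

  infix 4 _≈ᴹ_
  record _≈ᴹ_ (x y : ⊕) : Set where
    constructor mk≈ᴹ
    field coeff-≈ : ∀ v → coeff x v ≈ coeff y v
  open _≈ᴹ_ public

  infixl 6 _+ᴹ_
  infixr 7 _·_
  infix  8 -ᴹ_

  _+ᴹ_ : ⊕ → ⊕ → ⊕
  x +ᴹ y = record
    { coeff    = λ v → coeff x v R.+ coeff y v
    ; support  = support x ++ support y
    ; vanishes = λ v∉ → R.trans
        (R.+-cong (vanishes x (v∉ ∘ ∈-++⁺ˡ)) (vanishes y (v∉ ∘ ∈-++⁺ʳ (support x)))) (R.+-identityˡ 0#)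
    }

  0ᴹ : ⊕
  0ᴹ = record { coeff = λ _ → 0# ; support = [] ; vanishes = λ _ → R.refl }

  -ᴹ_ : ⊕ → ⊕
  -ᴹ x = record
    { coeff    = λ v → R.- coeff x v
    ; support  = support x
    ; vanishes = λ v∉ → R.-‿cong (vanishes x v∉)
    }

  _·_ : Laurent → ⊕ → ⊕
  c · x = record
    { coeff    = λ v → c R.* coeff x v
    ; support  = support x
    ; vanishes = λ v∉ → R.trans (R.*-congˡ {c} (vanishes x v∉)) (R.zeroʳ c)
    }

  basis : V → ⊕
  basis u = record
    { coeff    = λ v → if does (u ≟ v) then 1# else 0#
    ; support  = [ u ]
    ; vanishes = λ {v} v∉ → R.reflexive
        (cong (if_then 1# else 0#) (dec-false (u ≟ v) λ u≡v → v∉ (here (sym u≡v))))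
    }

------------------------------------------------------------------------
-- Coxeter matrices and Iwahori–Hecke algebras

-- The entry 0 encodes ∞.
record CoxeterMatrix (r : ℕ) : Set where
  field
    M           : Fin r → Fin r → ℕ
    symmetric   : ∀ i j → M i j ≡ M j i
    diagonal    : ∀ i → M i i ≡ 1
    offDiagonal : ∀ {i j} → i ≢ j → M i j ≢ 1

-- The algebra is presented: terms modulo the least congruence containing the
-- ring axioms, the axioms making ι : ℤ[q^{±1/2}] → ℋ a central ring
-- homomorphism, the quadratic relations and the braid relations (which are
-- vacuous when M i j = 0).
module Hecke {r : ℕ} (C : CoxeterMatrix r) where
  open CoxeterMatrix C

  infixl 6 _+_
  infixl 7 _*_
  infix  8 -_

  data ℋ : Set where
    ι       : Laurent → ℋ
    T       : Fin r → ℋ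
    _+_ _*_ : ℋ → ℋ → ℋ
    -_      : ℋ → ℋ

  -- T i * T j * T i * ⋯ with k factors
  alternating : ℕ → Fin r → Fin r → ℋ
  alternating zero    i j = ι 1#
  alternating (suc k) i j = T i * alternating k j i

  infix 4 _≈ᴴ_
  data _≈ᴴ_ : ℋ → ℋ → Set where
    ≈-refl     : ∀ {x} → x ≈ᴴ x
    ≈-sym      : ∀ {x y} → x ≈ᴴ y → y ≈ᴴ x
    ≈-trans    : ∀ {x y z} → x ≈ᴴ y → y ≈ᴴ z → x ≈ᴴ z
    +-cong     : ∀ {x y u v} → x ≈ᴴ y → u ≈ᴴ v → x + u ≈ᴴ y + v
    *-cong     : ∀ {x y u v} → x ≈ᴴ y → u ≈ᴴ v → x * u ≈ᴴ y * v
    -‿cong     : ∀ {x y} → x ≈ᴴ y → - x ≈ᴴ - y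
    +-assoc    : ∀ x y z → (x + y) + z ≈ᴴ x + (y + z)
    +-comm     : ∀ x y → x + y ≈ᴴ y + x
    +-identity : ∀ x → ι 0# + x ≈ᴴ x
    +-inverse  : ∀ x → - x + x ≈ᴴ ι 0#
    *-assoc    : ∀ x y z → (x * y) * z ≈ᴴ x * (y * z)
    *-identity : ∀ x → ι 1# * x ≈ᴴ x
    distribˡ   : ∀ x y z → x * (y + z) ≈ᴴ x * y + x * z
    distribʳ   : ∀ x y z → (y + z) * x ≈ᴴ y * x + z * x
    ι-cong     : ∀ {a b} → a ≈ b → ι a ≈ᴴ ι b
    ι-+        : ∀ a b → ι (a R.+ b) ≈ᴴ ι a + ι b
    ι-*        : ∀ a b → ι (a R.* b) ≈ᴴ ι a * ι b
    ι-central  : ∀ a x → ι a * x ≈ᴴ x * ι a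
    quadratic  : ∀ i → (T i + - ι q) * (T i + ι 1#) ≈ᴴ ι 0#
    braid      : ∀ i j → alternating (M i j) i j ≈ᴴ alternating (M i j) j i

  ring : Ring _ _
  ring = record
    { Carrier = ℋ ; _≈_ = _≈ᴴ_ ; _+_ = _+_ ; _*_ = _*_ ; -_ = -_ ; 0# = ι 0# ; 1# = ι 1#
    ; isRing = record
      { +-isAbelianGroup = record
        { isGroup = record
          { isMonoid = record
            { isSemigroup = record
              { isMagma = record
                { isEquivalence = record { refl = ≈-refl ; sym = ≈-sym ; trans = ≈-trans }
                ; ∙-cong = +-cong }
              ; assoc = +-assoc }
            ; identity = +-identity , λ x → ≈-trans (+-comm x (ι 0#)) (+-identity x) }
          ; inverse = +-inverse , λ x → ≈-trans (+-comm x (- x)) (+-inverse x)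
          ; ⁻¹-cong = -‿cong }
        ; comm = +-comm }
      ; *-cong = *-cong
      ; *-assoc = *-assoc
      ; *-identity = *-identity , λ x → ≈-trans (≈-sym (ι-central 1# x)) (*-identity x)
      ; distrib = distribˡ , distribʳ } }

------------------------------------------------------------------------
-- Labeled graphs and W-graphs

Incomparable : ∀ {r} → Subset r → Subset r → Set
Incomparable A B = A ⊈ B × B ⊈ A

-- Local finiteness is given by lists outside of which m vanishes.
-- Decidable equality of vertices is what makes the basis vectors of
-- ⊕_{v ∈ V} ℤ[q^{±1/2}] v definable constructively.
record LabeledGraph (r : ℕ) : Set₁ where
  infix 4 _≟_
  field
    V             : Set
    _≟_           : DecidableEquality V
    m             : V → V → Laurent
    τ             : V → Subset r
    locallyFinite : ∀ v → Σ[ ws ∈ List V ] (∀ {w} → w ∉ᴸ ws → m v w ≈ 0# × m w v ≈ 0#)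

IsReduced : ∀ {r} → LabeledGraph r → Set
IsReduced Γ = ∀ u v → τ u ⊆ τ v → m u v ≈ 0#
  where open LabeledGraph Γ

record IsNbAdmissible {r} (Γ : LabeledGraph r) : Set where
  open LabeledGraph Γ
  field
    natural   : ∀ u v → ∃[ k ] m u v ≈ fromℕ k
    symmetric : ∀ u v → Incomparable (τ u) (τ v) → m u v ≈ m v u

infix 4 _≅_
record _≅_ {r} (Γ Γ′ : LabeledGraph r) : Set where
  private
    module Γ  = LabeledGraph Γ
    module Γ′ = LabeledGraph Γ′
  field
    bijection : Γ.V ↔ Γ′.V
  open Inverse bijection using (to)
  field
    m-preserved : ∀ u v → Γ.m u v ≈ Γ′.m (to u) (to v)
    τ-preserved : ∀ u → Γ.τ u ≡ Γ′.τ (to u)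

module _ {r} (Γ : LabeledGraph r) where
  open LabeledGraph Γ
  open DirectSum _≟_

  -- Σ_{v : i ∉ τ(v)} m(u ▷ v) v
  neighbours : Fin r → V → ⊕
  neighbours i u = record
    { coeff    = λ v → if does (i ∈? τ v) then 0# else m u v
    ; support  = proj₁ (locallyFinite u)
    ; vanishes = λ {v} v∉ → vanish (does (i ∈? τ v)) (proj₁ (proj₂ (locallyFinite u) v∉))
    }
    where
    vanish : ∀ b {x} → x ≈ 0# → (if b then 0# else x) ≈ 0#
    vanish Bool.true  _   = R.refl
    vanish Bool.false x≈0 = x≈0

record IsWGraph {r} (C : CoxeterMatrix r) (Γ : LabeledGraph r) : Set where
  open LabeledGraph Γ
  open DirectSum _≟_
  open Hecke C using (ℋ; T; ι; ring)
  infixr 7 _∗_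
  field
    _∗_          : ℋ → ⊕ → ⊕
    isLeftModule : IsLeftModule ring _≈ᴹ_ _+ᴹ_ 0ᴹ -ᴹ_ _∗_
    ι-∗          : ∀ c x → ι c ∗ x ≈ᴹ c · x
    T-∉          : ∀ {i u} → i ∉ τ u → T i ∗ basis u ≈ᴹ q · basis u
    T-∈          : ∀ {i u} → i ∈ τ u → T i ∗ basis u ≈ᴹ -ᴹ basis u +ᴹ q^½ · neighbours Γ i u

indicator : ∀ {a} {A : Set a} → Dec A → Laurent
indicator A? = if does A? then 1# else 0#

indicator-0 : ∀ {a} {A : Set a} (A? : Dec A) → ¬ A → indicator A? ≈ 0#
indicator-0 A? ¬A = R.reflexive (cong (if_then 1# else 0#) (dec-false A? ¬A))

-- The simple underlying graph.
U : ∀ {r} → LabeledGraph r → LabeledGraph r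
U Γ = record
  { V             = V
  ; _≟_           = _≟_
  ; m             = λ u v → indicator (edge? u v)
  ; τ             = τ
  ; locallyFinite = λ v → proj₁ (locallyFinite v) , λ {w} w∉ →
      let m≈0 , m≈0′ = proj₂ (locallyFinite v) w∉ in
      indicator-0 (edge? v w) (λ (m≈1 , _) → Laurent.0≉1 (R.trans (R.sym m≈0) m≈1)) ,
      indicator-0 (edge? w v) (λ (m≈1 , _) → Laurent.0≉1 (R.trans (R.sym m≈0′) m≈1))
  }
  where
  open LabeledGraph Γ
  edge? : ∀ u v → Dec (m u v ≈ 1# × m v u ≈ 1#)
  edge? u v = (m u v Laurent.≟ 1#) ×-dec (m v u Laurent.≟ 1#)

------------------------------------------------------------------------
-- Residues, cyclic intervals and the affine symmetric group

-- The element x of Fin n stands for the number toℕ x + 1 of {1,…,n}.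
value : ∀ {n} → Fin n → ℕ
value x = suc (toℕ x)

⟦_⟧ : ∀ {n} → Fin n → ℤ
⟦ x ⟧ = + value x

module _ {n : ℕ} .{{_ : NonZero n}} where

  -- The residue of k in {1,…,n}, i.e. value (bar k) ≡ k modulo n.
  bar : ℤ → Fin n
  bar k = fromℕ< (ℤ.n%ℕd<d (k ℤ.- ℤ.1ℤ) n)

  next : Fin n → Fin n
  next x = bar (⟦ x ⟧ ℤ.+ ℤ.1ℤ)

  prev : Fin n → Fin n
  prev x = bar (⟦ x ⟧ ℤ.- ℤ.1ℤ)

  -- x is reached from a no later than b is when stepping cyclically upwards.
  ⟨_,_⟩ : Fin n → Fin n → Subset n
  ⟨ a , b ⟩ = if does (a Fin.≟ next b)
    then Subset.⊥
    else Vec.tabulate λ x →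
      does ((⟦ x ⟧ ℤ.- ⟦ a ⟧) ℤ.%ℕ n ℕ.≤? (⟦ b ⟧ ℤ.- ⟦ a ⟧) ℤ.%ℕ n)

-- Type Ã_{n-1} (for n ≥ 3): the Dynkin diagram is the n-cycle.
affineSymmetric : ∀ n → .{{_ : NonZero n}} → CoxeterMatrix n
affineSymmetric n = record
  { M           = M
  ; symmetric   = symmetric
  ; diagonal    = diagonal
  ; offDiagonal = offDiagonal
  }
  where
  adjacent? : ∀ i j → Dec (j ≡ next i ⊎ i ≡ next j)
  adjacent? i j = (j Fin.≟ next i) ⊎-dec (i Fin.≟ next j)
  M : Fin n → Fin n → ℕ
  M i j = if does (i Fin.≟ j) then 1 else if does (adjacent? i j) then 3 else 2
  symmetric : ∀ i j → M i j ≡ M j i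
  symmetric i j = cong₂ (if_then 1 else_)
    (does-sym (i Fin.≟ j) (j Fin.≟ i))
    (cong (if_then 3 else 2) (Bool.∨-comm (does (j Fin.≟ next i)) (does (i Fin.≟ next j))))
    where
    does-sym : ∀ {i j : Fin n} (p : Dec (i ≡ j)) (p′ : Dec (j ≡ i)) → does p ≡ does p′
    does-sym (yes p) p′ = sym (dec-true p′ (sym p))
    does-sym (no ¬p) p′ = sym (dec-false p′ (¬p ∘ sym))
  diagonal : ∀ i → M i i ≡ 1
  diagonal i rewrite dec-true (i Fin.≟ i) refl = refl
  offDiagonal : ∀ {i j} → i ≢ j → M i j ≢ 1
  offDiagonal {i} {j} i≢j rewrite dec-false (i Fin.≟ j) i≢j with does (adjacent? i j)
  ... | Bool.true  = λ ()
  ... | Bool.false = λ ()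

------------------------------------------------------------------------
-- Row-standard tableaux with two rows

-- The conditions are irrelevant fields, so tableaux with the same rows are
-- propositionally equal.
record RSYT (n λ₁ λ₂ : ℕ) : Set where
  constructor rsyt
  field
    row₁ : Vec (Fin n) λ₁
    row₂ : Vec (Fin n) λ₂
    .increasing₁ : Linked Fin._<_ row₁
    .increasing₂ : Linked Fin._<_ row₂
    .eachOnce    : ∀ x → count (x Fin.≟_) (row₁ Vec.++ row₂) ≡ 1

  private open module ∈ᵛ = DecVecMembership (Fin._≟_ {n}) using () renaming (_∈?_ to _∈ᵛ?_)

  T¹ T² : Subset n
  T¹ = Vec.tabulate λ x → does (x ∈ᵛ? row₁)
  T² = Vec.tabulate λ x → does (x ∈ᵛ? row₂)

open RSYT public using (T¹; T²)

infix 4 _≟ᵀ_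
_≟ᵀ_ : ∀ {n λ₁ λ₂} → DecidableEquality (RSYT n λ₁ λ₂)
s ≟ᵀ t = map′ (λ { (refl , refl) → refl }) (λ { refl → refl , refl })
  (Vec.≡-dec Fin._≟_ (RSYT.row₁ s) (RSYT.row₁ t) ×-dec Vec.≡-dec Fin._≟_ (RSYT.row₂ s) (RSYT.row₂ t))

vectors : ∀ n k → List (Vec (Fin n) k)
vectors n zero    = [ [] ]
vectors n (suc k) = List.cartesianProductWith _∷_ (List.allFin n) (vectors n k)

∈-vectors : ∀ {n k} (xs : Vec (Fin n) k) → xs ∈ᴸ vectors n k
∈-vectors []       = here refl
∈-vectors (x ∷ xs) = ∈-cartesianProductWith⁺ _∷_ (∈-allFin x) (∈-vectors xs)

module _ {n λ₁ λ₂ : ℕ} where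

  RowStandard : Vec (Fin n) λ₁ → Vec (Fin n) λ₂ → Set
  RowStandard r₁ r₂ = Linked Fin._<_ r₁ × Linked Fin._<_ r₂ ×
    (∀ x → count (x Fin.≟_) (r₁ Vec.++ r₂) ≡ 1)

  rowStandard? : ∀ r₁ r₂ → Dec (RowStandard r₁ r₂)
  rowStandard? r₁ r₂ = Linked.linked? Fin._<?_ r₁ ×-dec Linked.linked? Fin._<?_ r₂ ×-dec
    Fin.all? (λ x → count (x Fin.≟_) (r₁ Vec.++ r₂) ℕ.≟ 1)

  fromRows : Vec (Fin n) λ₁ × Vec (Fin n) λ₂ → List (RSYT n λ₁ λ₂)
  fromRows (r₁ , r₂) with rowStandard? r₁ r₂
  ... | yes (inc₁ , inc₂ , once) = [ rsyt r₁ r₂ inc₁ inc₂ once ]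
  ... | no  _                    = []

  ∈-fromRows : ∀ t → t ∈ᴸ fromRows (RSYT.row₁ t , RSYT.row₂ t)
  ∈-fromRows (rsyt r₁ r₂ inc₁ inc₂ once) with rowStandard? r₁ r₂
  ... | yes _ = here refl
  ... | no ¬p = ⊥-elim-irr (¬p (inc₁ , inc₂ , once))

tableaux : ∀ n λ₁ λ₂ → List (RSYT n λ₁ λ₂)
tableaux n λ₁ λ₂ = List.concatMap fromRows (List.cartesianProduct (vectors n λ₁) (vectors n λ₂))

∈-tableaux : ∀ {n λ₁ λ₂} (t : RSYT n λ₁ λ₂) → t ∈ᴸ tableaux n λ₁ λ₂
∈-tableaux t = ∈-concatMap⁺ fromRows
  (Any.map (λ { refl → ∈-fromRows t }) (∈-cartesianProduct⁺ (∈-vectors (RSYT.row₁ t)) (∈-vectors (RSYT.row₂ t))))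

module _ {n : ℕ} where

  -- The preimage of A under a transposition, which is also its image.
  exchange : Fin n → Fin n → Subset n → Subset n
  exchange x y A = Vec.tabulate λ z → Vec.lookup A (transpose x y z)

  infix 4 _≟ˢ_
  _≟ˢ_ : DecidableEquality (Subset n)
  _≟ˢ_ = Vec.≡-dec Bool._≟_

module _ {n λ₁ λ₂ : ℕ} where

  -- t is obtained from s by interchanging x and y and re-sorting the rows.
  Interchange : Fin n → Fin n → (s t : RSYT n λ₁ λ₂) → Set
  Interchange x y s t = T¹ t ≡ exchange x y (T¹ s) × T² t ≡ exchange x y (T² s)

  interchange? : ∀ x y s t → Dec (Interchange x y s t)
  interchange? x y s t = (T¹ t ≟ˢ exchange x y (T¹ s)) ×-dec (T² t ≟ˢ exchange x y (T² s))

module _ {n λ₁ λ₂ : ℕ} .{{_ : NonZero n}} where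

  des : RSYT n λ₁ λ₂ → Subset n
  des t = Vec.tabulate λ i → does ((i ∈? T¹ t) ×-dec (next i ∈? T² t))

  KnuthMove : (s t : RSYT n λ₁ λ₂) → Set
  KnuthMove s t = Incomparable (des s) (des t) × ∃[ i ] Interchange i (next i) s t

  knuthMove? : ∀ s t → Dec (KnuthMove s t)
  knuthMove? s t = (¬? (des s ⊆? des t) ×-dec ¬? (des t ⊆? des s)) ×-dec
    Fin.any? λ i → interchange? i (next i) s t

  FirstKind : (s t : RSYT n λ₁ λ₂) → Set
  FirstKind s t = ∃[ i ] (i ∈ T¹ s × next i ∈ T² s) × Interchange i (next i) s t

  firstKind? : ∀ s t → Dec (FirstKind s t)
  firstKind? s t = Fin.any? λ i →
    ((i ∈? T¹ s) ×-dec (next i ∈? T² s)) ×-dec interchange? i (next i) s t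

  -- Here i and j stand for the residues of the integers called i and j.
  module _ (s : RSYT n λ₁ λ₂) (i j : Fin n) where

    distance : ℕ
    distance = value (bar {n} (⟦ j ⟧ ℤ.- ⟦ i ⟧))

    -- (distance − 3) / 2.  When distance ≡ 1 the truncated value is 0 rather
    -- than −1: D has no instances either way and E does not apply.
    half : ℕ
    half = (distance ℕ.∸ 3) ℕ./ 2

    upTo-j-2 : Fin n → Subset n
    upTo-j-2 a = ⟨ a , bar (⟦ j ⟧ ℤ.- + 2) ⟩

    ConditionA ConditionB ConditionC ConditionD ConditionE SecondKindConditions : Set
    ConditionA = distance ℕ.% 2 ≡ 1
    ConditionB = next i ∈ T¹ s × prev j ∈ T² s
    ConditionC = prev i ∈ T¹ s ⊎ next j ∈ T² s
    ConditionD = ∀ k → 1 ℕ.≤ k → k ℕ.≤ half →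
      ∣ T² s ∩ upTo-j-2 (bar (⟦ j ⟧ ℤ.- ℤ.1ℤ ℤ.- + (2 ℕ.* k))) ∣ ℕ.≥ k
    ConditionE = j ≢ next i → ∣ T² s ∩ upTo-j-2 (bar (⟦ i ⟧ ℤ.+ + 2)) ∣ ≡ half
    SecondKindConditions = (i ∈ T² s × j ∈ T¹ s × i ≢ next j)
      × ConditionA × ConditionB × ConditionC × ConditionD × ConditionE

    conditionD? : Dec ConditionD
    conditionD? = map′ (λ f k 1≤k k≤h → f (ℕ.s≤s k≤h) 1≤k) (λ f {k} k<h 1≤k → f k 1≤k (ℕ.s≤s⁻¹ k<h))
      (ℕ.allUpTo? (λ k → (1 ℕ.≤? k) →-dec (k ℕ.≤? _)) (suc half))

    secondKindConditions? : Dec SecondKindConditions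
    secondKindConditions? =
      ((i ∈? T² s) ×-dec (j ∈? T¹ s) ×-dec ¬? (i Fin.≟ next j)) ×-dec
      (distance ℕ.% 2 ℕ.≟ 1) ×-dec
      ((next i ∈? T¹ s) ×-dec (prev j ∈? T² s)) ×-dec
      ((prev i ∈? T¹ s) ⊎-dec (next j ∈? T² s)) ×-dec
      conditionD? ×-dec
      (¬? (j Fin.≟ next i) →-dec (_ ℕ.≟ half))

  SecondKind : (s t : RSYT n λ₁ λ₂) → Set
  SecondKind s t = ∃[ i ] ∃[ j ] SecondKindConditions s i j × Interchange i j s t

  secondKind? : ∀ s t → Dec (SecondKind s t)
  secondKind? s t = Fin.any? λ i → Fin.any? λ j →
    secondKindConditions? s i j ×-dec interchange? i j s t

tableauGraph : ∀ n λ₁ λ₂ → .{{_ : NonZero n}} →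
  (RSYT n λ₁ λ₂ → RSYT n λ₁ λ₂ → Laurent) → LabeledGraph n
tableauGraph n λ₁ λ₂ m = record
  { V             = RSYT n λ₁ λ₂
  ; _≟_           = _≟ᵀ_
  ; m             = m
  ; τ             = des
  ; locallyFinite = λ _ → tableaux n λ₁ λ₂ , λ w∉ → contradiction (∈-tableaux _) w∉
  }

D̄ : ∀ n λ₁ λ₂ → .{{_ : NonZero n}} → LabeledGraph n
D̄ n λ₁ λ₂ = tableauGraph n λ₁ λ₂ λ s t → indicator (knuthMove? s t)

Γ̄ : ∀ n λ₁ λ₂ → .{{_ : NonZero n}} → LabeledGraph n
Γ̄ n λ₁ λ₂ = tableauGraph n λ₁ λ₂ λ s t → indicator (firstKind? s t ⊎-dec secondKind? s t)

-- At q^½ = 1 the commutation and braid relations of a W-graph become identities between sums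
-- of products of edge weights. As the weights are natural numbers, the braid relations say that
-- the neighbour of u with descent j, where j ± 1 is a descent of u, is unique and given by a
-- Knuth move.
--
-- Read a tableau cyclically as a word of parentheses, top entries opening and bottom entries
-- closing: descents are the cups (), and Knuth moves slide a cup past one letter. Let i be a
-- descent of u but not of v. Then m(u ▷ v) does not change when a cup away from i and i + 1
-- slides at the same place of u and of v, and it vanishes when u lacks this cup. Cut at i, the
-- rest of v slides to )…)()…()(…(, where u is either the unique Knuth neighbour of v or would
-- need more cups than the bottom row allows. The outcome is the Temperley–Lieb rule: u arises
-- from v by forming a cup at i, i + 1 and joining the former partners of i and i + 1. The same
-- slides preserve this rule, which is what the two kinds of moves of Γ̄ describe.

module Submission where

open import Algebra.Bundles using (CommutativeMonoid; CommutativeRing)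
open import Algebra.Module.Structures using (IsLeftModule)
open import Data.Bool.Base using (Bool; true; false; if_then_else_; not; _∧_; _∨_)
import Data.Bool.Properties as Bool
open import Data.Fin.Base as Fin using (Fin; toℕ)
open import Data.Fin.Permutation.Components using (transpose)
import Data.Fin.Properties as Fin
open import Data.Fin.Subset using (Subset; _∈_; _∉_; _⊆_; _⊈_; _∩_; ∣_∣; ∁)
open import Data.Fin.Subset.Properties using (_∈?_; ∩-zeroʳ; ∣⊥∣≡0; ∣∁p∣≡n∸∣p∣)
open import Data.Integer.Base as ℤ using (ℤ; +_)
import Data.Integer.DivMod as ℤ
import Data.Integer.Properties as ℤ
open import Data.Integer.Tactic.RingSolver using (solve-∀)
open import Data.List.Base as List
  using (List; []; _∷_; _++_; [_]; length; _∷ʳ_; replicate; _ʳ++_; reverse; applyUpTo; initLast; _∷ʳ′_)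
open import Data.List.Membership.Propositional using () renaming (_∈_ to _∈ᴸ_; _∉_ to _∉ᴸ_)
open import Data.List.Membership.Propositional.Properties using (∈-++⁺ˡ; ∈-++⁺ʳ; ∈-map⁺; ∈-deduplicate⁺)
import Data.List.Properties as List
open import Data.List.Relation.Unary.All as All using (All; []; _∷_)
open import Data.List.Relation.Unary.Any using (here; there)
open import Data.List.Relation.Unary.Unique.DecPropositional.Properties using (deduplicate-!)
open import Data.List.Relation.Unary.Unique.Propositional using (Unique; []; _∷_)
open import Data.Nat using (_+_)
open import Data.Nat.Base as ℕ using (ℕ; zero; suc; NonZero; _<_; _≤_; s≤s; z≤n)
import Data.Nat.Divisibility as ℕ
import Data.Nat.DivMod as ℕ
open import Data.Nat.ListAction using (sum)
import Data.Nat.Properties as ℕ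
open import Data.Product.Base using (_,_; proj₁; proj₂; _×_; ∃-syntax)
open import Data.Sum.Base using (_⊎_; inj₁; inj₂)
open import Data.Vec.Base as Vec using (Vec; lookup; []; _∷_; count)
import Data.Vec.Membership.DecPropositional as DecVecMembership
import Data.Vec.Properties as Vec
import Data.Vec.Relation.Unary.All as VecAll
import Data.Vec.Relation.Unary.All.Properties as VecAll
import Data.Vec.Relation.Unary.Any as VecAny
import Data.Vec.Relation.Unary.Linked as Linked
open Linked using (Linked; []; [-]; _∷_)
import Data.Vec.Relation.Unary.Linked.Properties as Linked
open import Function.Base using (_∘_)
open import Function.Bundles using (mk⇔; _↔_; Inverse)
open import Function.Construct.Composition using (_↔-∘_)
open import Function.Construct.Symmetry using (↔-sym)
open import Relation.Binary.Definitions using (tri<; tri≈; tri>)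
open import Relation.Binary.PropositionalEquality
  using (_≡_; _≢_; refl; sym; trans; cong; cong₂; subst; subst₂; module ≡-Reasoning)
open import Relation.Nullary.Decidable
  using (Dec; does; yes; no; dec-true; dec-false; does-⇔; recompute; decidable-stable; _×-dec_; _⊎-dec_; ¬?)
open import Relation.Nullary.Negation using (¬_; contradiction)

open import Algebra.Properties.CommutativeSemigroup
  (CommutativeMonoid.commutativeSemigroup ℤ.+-0-commutativeMonoid) using (interchange)

open import Defs

-- Finite sums

-- Setting q^½ = 1 loses nothing, because admissible weights are constants in ℕ. Each identity
-- between weights is then one coefficient of a Hecke relation.
--
-- A cup can slide in v only together with u, so the induction runs on the word of v while u stays
-- arbitrary, and it carries both answers: weight 1 where the rule holds, weight 0 where it fails.
-- The tableaux in between must exist. They do, because a slide preserves the number of letters ↓,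
-- and any word with the right length and number of ↓ belongs to a tableau of the shape.
--
-- The hypothesis λ₂ < λ₁ enters at the normal form. If v has ↓ at i and no cup starts at i + 1, its
-- Knuth neighbour comes from a cup that straddles the cut, so a letter ↑ must stand just before i
-- on the cycle. A normal form that does not provide this ↑ consists of ↓ for at least one half.
--
-- The rule is stated relative to a cut i, the moves of Γ̄ are not: any descent of u that v lacks
-- may serve. If there is none, the weight vanishes since Γ is reduced, and condition (c) keeps such
-- pairs out of the moves of the second kind.

private variable
  A : Set

∑ : List A → (A → ℤ) → ℤ
∑ []       f = ℤ.0ℤ
∑ (x ∷ xs) f = f x ℤ.+ ∑ xs f

∑-cong : ∀ {f g : A → ℤ} → (∀ x → f x ≡ g x) → ∀ xs → ∑ xs f ≡ ∑ xs g
∑-cong f≗g []       = refl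
∑-cong f≗g (x ∷ xs) = cong₂ ℤ._+_ (f≗g x) (∑-cong f≗g xs)

∑-zero : ∀ {f : A → ℤ} xs → (∀ {x} → x ∈ᴸ xs → f x ≡ ℤ.0ℤ) → ∑ xs f ≡ ℤ.0ℤ
∑-zero []       f≡0 = refl
∑-zero (x ∷ xs) f≡0 = cong₂ ℤ._+_ (f≡0 (here refl)) (∑-zero xs (f≡0 ∘ there))

∑-+ : ∀ (f g : A → ℤ) xs → ∑ xs (λ x → f x ℤ.+ g x) ≡ ∑ xs f ℤ.+ ∑ xs g
∑-+ f g []       = refl
∑-+ f g (x ∷ xs) = trans (cong (λ s → f x ℤ.+ g x ℤ.+ s) (∑-+ f g xs))
                         (interchange (f x) (g x) (∑ xs f) (∑ xs g))

∑-single : ∀ {f : A → ℤ} {y xs} → Unique xs → y ∈ᴸ xs → (∀ {x} → x ≢ y → f x ≡ ℤ.0ℤ) →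
  ∑ xs f ≡ f y
∑-single {f = f} {y} {_ ∷ xs} (y∉ ∷ _) (here refl) f≡0 =
  trans (cong (λ s → f y ℤ.+ s) (∑-zero xs λ x∈ → f≡0 λ { refl → All.lookup y∉ x∈ refl }))
        (ℤ.+-identityʳ _)
∑-single (x∉ ∷ xs!) (there y∈) f≡0 =
  trans (cong₂ ℤ._+_ (f≡0 (All.lookup x∉ y∈)) (∑-single xs! y∈ f≡0)) (ℤ.+-identityˡ _)

∑-fromℕ : ∀ (g : A → ℕ) xs → ∑ xs (λ x → + g x) ≡ + sum (List.map g xs)
∑-fromℕ g []       = refl
∑-fromℕ g (x ∷ xs) = cong (λ s → + g x ℤ.+ s) (∑-fromℕ g xs)

term≤sum : ∀ (g : A → ℕ) {x xs} → x ∈ᴸ xs → g x ℕ.≤ sum (List.map g xs)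
term≤sum g (here refl) = ℕ.m≤m+n _ _
term≤sum g (there x∈)  = ℕ.≤-trans (term≤sum g x∈) (ℕ.m≤n+m _ _)

two-terms≤sum : ∀ (g : A → ℕ) {x y xs} → x ≢ y → x ∈ᴸ xs → y ∈ᴸ xs →
  g x ℕ.+ g y ℕ.≤ sum (List.map g xs)
two-terms≤sum g x≢y (here refl) (here refl) = contradiction refl x≢y
two-terms≤sum g x≢y (here refl) (there y∈)  = ℕ.+-monoʳ-≤ _ (term≤sum g y∈)
two-terms≤sum g {x} {y} x≢y (there x∈) (here refl) rewrite ℕ.+-comm (g x) (g y) =
  ℕ.+-monoʳ-≤ _ (term≤sum g x∈)
two-terms≤sum g x≢y (there x∈) (there y∈)   = ℕ.≤-trans (two-terms≤sum g x≢y x∈ y∈) (ℕ.m≤n+m _ _)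

-- A term 1 already exhausts the total; as the terms are natural numbers, the others cannot cancel.
∑≡1⇒zero-elsewhere : ∀ (g : A → ℕ) {x y xs} → ∑ xs (λ x → + g x) ≡ ℤ.1ℤ → x ∈ᴸ xs → g x ≡ 1 →
  y ∈ᴸ xs → x ≢ y → g y ≡ 0
∑≡1⇒zero-elsewhere g {x} {y} {xs} eq x∈ gx≡1 y∈ x≢y = ℕ.n≤0⇒n≡0 (ℕ.s≤s⁻¹ (begin
  1 ℕ.+ g y                    ≡⟨ cong (ℕ._+ g y) gx≡1 ⟨
  g x ℕ.+ g y                  ≤⟨ two-terms≤sum g x≢y x∈ y∈ ⟩
  sum (List.map g xs)     ≡⟨ ℤ.+-injective (trans (sym (∑-fromℕ g xs)) eq) ⟩
  1                            ∎))
  where open ℕ.≤-Reasoning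

-- Specialisation at q^½ = 1

module Evaluation where

  open Laurent using (Laurent; coeff; coeff-≡; exponents; δ) renaming (_≈_ to _≈ₗ_)

  ε : Laurent → ℤ
  ε p = ∑ p proj₂

  -- `ε` is computed from the representing list, so invariance under `_≈_` needs proof. Grouping the
  -- list by exponent expresses it through coefficients, and since any `es` containing the exponents
  -- will do, two polynomials can be compared over a common one.
  ε≡∑coeff : ∀ p {es} → Unique es → (∀ {k} → k ∈ᴸ exponents p → k ∈ᴸ es) → ε p ≡ ∑ es (coeff p)
  ε≡∑coeff []            {es} es! ⊆es = sym (∑-zero es λ _ → refl)
  ε≡∑coeff ((e , c) ∷ p) {es} es! ⊆es = begin
    c ℤ.+ ε p                               ≡⟨ cong₂ ℤ._+_ (sym ∑δ≡c) (ε≡∑coeff p es! (⊆es ∘ there)) ⟩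
    ∑ es (λ k → δ e k c) ℤ.+ ∑ es (coeff p) ≡⟨ ∑-+ (λ k → δ e k c) (coeff p) es ⟨
    ∑ es (coeff ((e , c) ∷ p))              ∎
    where
    open ≡-Reasoning
    ∑δ≡c : ∑ es (λ k → δ e k c) ≡ c
    ∑δ≡c = trans
      (∑-single es! (⊆es (here refl)) λ {k} k≢e → cong (if_then c else ℤ.0ℤ) (dec-false (e ℤ.≟ k) (k≢e ∘ sym)))
      (cong (if_then c else ℤ.0ℤ) (dec-true (e ℤ.≟ e) refl))

  ε-cong : ∀ {p p′} → p ≈ₗ p′ → ε p ≡ ε p′
  ε-cong {p} {p′} p≈p′ = trans (ε≡∑coeff p es! (∈-deduplicate⁺ ℤ._≟_ ∘ ∈-++⁺ˡ))
    (trans (∑-cong (coeff-≡ p≈p′) es) (sym (ε≡∑coeff p′ es! (∈-deduplicate⁺ ℤ._≟_ ∘ ∈-++⁺ʳ _))))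
    where
    es  = List.deduplicate ℤ._≟_ (exponents p ++ exponents p′)
    es! : Unique es
    es! = deduplicate-! ℤ._≟_ (exponents p ++ exponents p′)

  ε-+ : ∀ p p′ → ε (p Laurent.+ p′) ≡ ε p ℤ.+ ε p′
  ε-+ []            p′ = sym (ℤ.+-identityˡ _)
  ε-+ ((e , c) ∷ p) p′ = trans (cong (λ s → c ℤ.+ s) (ε-+ p p′)) (sym (ℤ.+-assoc c _ _))

  ε-neg : ∀ p → ε (Laurent.- p) ≡ ℤ.- ε p
  ε-neg []            = refl
  ε-neg ((e , c) ∷ p) = trans (cong (λ s → ℤ.- c ℤ.+ s) (ε-neg p)) (sym (ℤ.neg-distrib-+ c _))

  ε-* : ∀ p p′ → ε (p Laurent.* p′) ≡ ε p ℤ.* ε p′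
  ε-* []      p′ = refl
  ε-* ((e , c) ∷ p) p′ = begin
    ε ((e , c) ·ₘ p′ Laurent.+ p Laurent.* p′)       ≡⟨ ε-+ ((e , c) ·ₘ p′) (p Laurent.* p′) ⟩
    ε ((e , c) ·ₘ p′) ℤ.+ ε (p Laurent.* p′)         ≡⟨ cong₂ ℤ._+_ (ε-·ₘ p′) (ε-* p p′) ⟩
    c ℤ.* ε p′ ℤ.+ ε p ℤ.* ε p′                      ≡⟨ ℤ.*-distribʳ-+ (ε p′) c (ε p) ⟨
    (c ℤ.+ ε p) ℤ.* ε p′                             ∎
    where
    open ≡-Reasoning
    open Laurent using (_·ₘ_)
    ε-·ₘ : ∀ p → ε ((e , c) ·ₘ p) ≡ c ℤ.* ε p
    ε-·ₘ []             = sym (ℤ.*-zeroʳ c)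
    ε-·ₘ ((_ , c′) ∷ p) = trans (cong (λ s → c ℤ.* c′ ℤ.+ s) (ε-·ₘ p)) (sym (ℤ.*-distribˡ-+ c c′ _))

  fromℕ-injective : ∀ {k l} → Laurent.fromℕ k ≈ₗ Laurent.fromℕ l → k ≡ l
  fromℕ-injective k≈l = ℤ.+-injective
    (trans (sym (ℤ.+-identityʳ _)) (trans (ε-cong k≈l) (ℤ.+-identityʳ _)))

open Evaluation

-- W-graph relations at q^½ = 1

module Specialised {r} {C : CoxeterMatrix r} {Γ : LabeledGraph r}
  (admissible : IsNbAdmissible Γ) (isWGraph : IsWGraph C Γ)
  (vs : List (LabeledGraph.V Γ)) (vs! : Unique vs) (∈vs : ∀ v → v ∈ᴸ vs) where

  open LabeledGraph Γ
  open DirectSum _≟_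
  open Hecke C using (T; ι; _≈ᴴ_; braid; alternating; ≈-sym; ι-central)
  open IsWGraph isWGraph
  open IsNbAdmissible admissible
  open IsLeftModule isLeftModule using (*ₗ-congˡ; *ₗ-congʳ; *ₗ-assoc; *ₗ-distribˡ; *ₗ-zeroʳ; *ₗ-identityˡ)
    renaming (≈ᴹ-trans to transᴹ; ≈ᴹ-sym to symᴹ)
  private module L = CommutativeRing Laurent.commutativeRing
  open CoxeterMatrix C renaming (M to bond) using ()
  open Laurent using (0#; q; q^½)

  M : V → V → ℕ
  M u v = proj₁ (natural u v)

  coeff₁ : ⊕ → V → ℤ
  coeff₁ x v = ε (coeff x v)

  unit : V → V → ℤ
  unit u v = if does (u ≟ v) then ℤ.1ℤ else ℤ.0ℤ

  unit-≡ : ∀ v → unit v v ≡ ℤ.1ℤ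
  unit-≡ v rewrite dec-true (v ≟ v) refl = refl

  unit-≢ : ∀ {u v} → u ≢ v → unit u v ≡ ℤ.0ℤ
  unit-≢ {u} {v} u≢v rewrite dec-false (u ≟ v) u≢v = refl

  coeff₁-basis : ∀ u v → coeff₁ (basis u) v ≡ unit u v
  coeff₁-basis u v with does (u ≟ v)
  ... | true  = refl
  ... | false = refl

  -- The module laws give additivity of `T i` on explicit sums only, so an element is rebuilt from
  -- basis vectors. This is where a finite list of all vertices is needed.
  combination : List V → ⊕ → ⊕
  combination []       x = 0ᴹ
  combination (v ∷ ws) x = coeff x v · basis v +ᴹ combination ws x

  coeff-combination-∉ : ∀ {ws} x {w} → w ∉ᴸ ws → coeff (combination ws x) w L.≈ 0#
  coeff-combination-∉ {[]}     x w∉ = L.refl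
  coeff-combination-∉ {v ∷ ws} x {w} w∉
    rewrite dec-false (v ≟ w) (λ v≡w → w∉ (here (sym v≡w))) =
    L.trans (L.+-cong (L.zeroʳ (coeff x v)) (coeff-combination-∉ x (w∉ ∘ there))) (L.+-identityˡ 0#)

  coeff-combination-∈ : ∀ {ws} x {w} → Unique ws → w ∈ᴸ ws → coeff (combination ws x) w L.≈ coeff x w
  coeff-combination-∈ {v ∷ ws} x (v∉ ∷ _) (here refl) rewrite dec-true (v ≟ v) refl =
    L.trans (L.+-cong (L.*-identityʳ (coeff x v))
                      (coeff-combination-∉ {ws} x λ v∈ → All.lookup v∉ v∈ refl))
            (L.+-identityʳ (coeff x v))
  coeff-combination-∈ {v ∷ ws} x {w} (v∉ ∷ ws!) (there w∈)
    rewrite dec-false (v ≟ w) (All.lookup v∉ w∈) =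
    L.trans (L.+-cong (L.zeroʳ (coeff x v)) (coeff-combination-∈ x ws! w∈)) (L.+-identityˡ (coeff x w))

  T-· : ∀ i c x → T i ∗ (c · x) ≈ᴹ c · (T i ∗ x)
  T-· i c x =
    transᴹ (*ₗ-congˡ (symᴹ (ι-∗ c x))) (transᴹ (symᴹ (*ₗ-assoc (T i) (ι c) x))
      (transᴹ (*ₗ-congʳ (≈-sym (ι-central c (T i)))) (transᴹ (*ₗ-assoc (ι c) (T i) x) (ι-∗ c (T i ∗ x)))))

  coeff₁-cong : ∀ {x y} → x ≈ᴹ y → ∀ w → coeff₁ x w ≡ coeff₁ y w
  coeff₁-cong x≈y w = ε-cong (coeff-≈ x≈y w)

  coeff₁-T-combination : ∀ i ws x w → coeff₁ (T i ∗ combination ws x) w ≡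
    ∑ ws (λ v → coeff₁ x v ℤ.* coeff₁ (T i ∗ basis v) w)
  coeff₁-T-combination i []       x w = coeff₁-cong (*ₗ-zeroʳ (T i)) w
  coeff₁-T-combination i (v ∷ ws) x w = begin
    coeff₁ (T i ∗ (coeff x v · basis v +ᴹ combination ws x)) w
      ≡⟨ coeff₁-cong (*ₗ-distribˡ (T i) (coeff x v · basis v) (combination ws x)) w ⟩
    ε (coeff (T i ∗ (coeff x v · basis v)) w Laurent.+ coeff (T i ∗ combination ws x) w)
      ≡⟨ ε-+ (coeff (T i ∗ (coeff x v · basis v)) w) _ ⟩
    coeff₁ (T i ∗ (coeff x v · basis v)) w ℤ.+ coeff₁ (T i ∗ combination ws x) w
      ≡⟨ cong₂ ℤ._+_ (trans (coeff₁-cong (T-· i (coeff x v) (basis v)) w) (ε-* (coeff x v) _))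
                     (coeff₁-T-combination i ws x w) ⟩
    coeff₁ x v ℤ.* coeff₁ (T i ∗ basis v) w ℤ.+
      ∑ ws (λ v → coeff₁ x v ℤ.* coeff₁ (T i ∗ basis v) w) ∎
    where open ≡-Reasoning

  coeff₁-T : ∀ i x w → coeff₁ (T i ∗ x) w ≡ ∑ vs (λ v → coeff₁ x v ℤ.* coeff₁ (T i ∗ basis v) w)
  coeff₁-T i x w = trans
    (coeff₁-cong (*ₗ-congˡ {T i} (mk≈ᴹ λ v → L.sym (coeff-combination-∈ x vs! (∈vs v)))) w)
    (coeff₁-T-combination i vs x w)

  coeff₁-T-∉ : ∀ {i v} w → i ∉ τ v → coeff₁ (T i ∗ basis v) w ≡ unit v w
  coeff₁-T-∉ {i} {v} w i∉ = trans (coeff₁-cong (T-∉ i∉) w)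
    (trans (ε-* q (coeff (basis v) w)) (trans (ℤ.*-identityˡ _) (coeff₁-basis v w)))

  entry : Fin r → V → V → ℤ
  entry i v w = if does (i ∈? τ w) then ℤ.0ℤ else + M v w

  coeff₁-T-∈ : ∀ {i v} w → i ∈ τ v → coeff₁ (T i ∗ basis v) w ≡ ℤ.- unit v w ℤ.+ entry i v w
  coeff₁-T-∈ {i} {v} w i∈ = begin
    coeff₁ (T i ∗ basis v) w
      ≡⟨ coeff₁-cong (T-∈ i∈) w ⟩
    ε (Laurent.- coeff (basis v) w Laurent.+ q^½ Laurent.* coeff (neighbours Γ i v) w)
      ≡⟨ ε-+ (Laurent.- coeff (basis v) w) _ ⟩
    ε (Laurent.- coeff (basis v) w) ℤ.+ ε (q^½ Laurent.* coeff (neighbours Γ i v) w)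
      ≡⟨ cong₂ ℤ._+_ (trans (ε-neg (coeff (basis v) w)) (cong ℤ.-_ (coeff₁-basis v w)))
           (trans (ε-* q^½ (coeff (neighbours Γ i v) w)) (trans (ℤ.*-identityˡ _) ε-neighbours)) ⟩
    ℤ.- unit v w ℤ.+ entry i v w ∎
    where
    open ≡-Reasoning
    ε-neighbours : ε (coeff (neighbours Γ i v) w) ≡ entry i v w
    ε-neighbours with does (i ∈? τ w)
    ... | true  = refl
    ... | false = trans (ε-cong (proj₂ (natural v w))) (ℤ.+-identityʳ _)

  inflow : Fin r → (V → ℤ) → V → ℤ
  inflow i x w = ∑ vs λ v → if does (i ∈? τ v) then x v ℤ.* + M v w else ℤ.0ℤ

  -- The action of T i on families of coefficients at q^½ = 1.
  𝒯 : Fin r → (V → ℤ) → V → ℤ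
  𝒯 i x w = if does (i ∈? τ w) then ℤ.- x w else x w ℤ.+ inflow i x w

  𝒯-∈ : ∀ {i w} x → i ∈ τ w → 𝒯 i x w ≡ ℤ.- x w
  𝒯-∈ {i} {w} x i∈ rewrite dec-true (i ∈? τ w) i∈ = refl

  𝒯-∉ : ∀ {i w} x → i ∉ τ w → 𝒯 i x w ≡ x w ℤ.+ inflow i x w
  𝒯-∉ {i} {w} x i∉ rewrite dec-false (i ∈? τ w) i∉ = refl

  inflow-cong : ∀ i {x y} → (∀ {v} → i ∈ τ v → x v ≡ y v) → ∀ w → inflow i x w ≡ inflow i y w
  inflow-cong i {x} {y} x≗y w = ∑-cong pointwise vs
    where
    pointwise : ∀ v → (if does (i ∈? τ v) then x v ℤ.* + M v w else ℤ.0ℤ) ≡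
                      (if does (i ∈? τ v) then y v ℤ.* + M v w else ℤ.0ℤ)
    pointwise v with i ∈? τ v
    ... | yes i∈ = cong (ℤ._* + M v w) (x≗y i∈)
    ... | no  _  = refl

  𝒯-cong : ∀ i {x y} → (∀ v → x v ≡ y v) → ∀ w → 𝒯 i x w ≡ 𝒯 i y w
  𝒯-cong i {x} {y} x≗y w rewrite x≗y w | inflow-cong i {x} {y} (λ {v} _ → x≗y v) w = refl

  -- The W-graph formulas describe images of basis vectors; read at a fixed target w they transpose.
  -- If i is a descent of w, then `neighbours` omits w and only the eigenvalue -1 remains; otherwise
  -- w keeps its coefficient, as q = 1, and collects the inflow.
  coeff₁-T≡𝒯 : ∀ i x w → coeff₁ (T i ∗ x) w ≡ 𝒯 i (coeff₁ x) w
  coeff₁-T≡𝒯 i x w with i ∈? τ w in eq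
  ... | yes i∈ = trans (coeff₁-T i x w) (trans
      (∑-single vs! (∈vs w) λ {v} v≢w → trans (cong (coeff₁ x v ℤ.*_) (off v v≢w)) (ℤ.*-zeroʳ (coeff₁ x v)))
      (trans (cong (coeff₁ x w ℤ.*_) diagonal) (lemma (coeff₁ x w))))
    where
    lemma : ∀ a → a ℤ.* ℤ.-1ℤ ≡ ℤ.- a
    lemma = solve-∀
    entry≡0 : ∀ v → entry i v w ≡ ℤ.0ℤ
    entry≡0 v rewrite eq = refl
    diagonal : coeff₁ (T i ∗ basis w) w ≡ ℤ.-1ℤ
    diagonal = trans (coeff₁-T-∈ w i∈) (cong₂ (λ a b → ℤ.- a ℤ.+ b) (unit-≡ w) (entry≡0 w))
    off : ∀ v → v ≢ w → coeff₁ (T i ∗ basis v) w ≡ ℤ.0ℤ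
    off v v≢w with i ∈? τ v
    ... | yes i∈v = trans (coeff₁-T-∈ w i∈v) (cong₂ (λ a b → ℤ.- a ℤ.+ b) (unit-≢ v≢w) (entry≡0 v))
    ... | no  i∉v = trans (coeff₁-T-∉ w i∉v) (unit-≢ v≢w)
  ... | no i∉ = trans (coeff₁-T i x w) (trans (∑-cong split vs) (trans
      (∑-+ (λ v → coeff₁ x v ℤ.* unit v w) _ vs) (cong (ℤ._+ inflow i (coeff₁ x) w) (trans
        (∑-single vs! (∈vs w) λ {v} v≢w → trans (cong (coeff₁ x v ℤ.*_) (unit-≢ v≢w)) (ℤ.*-zeroʳ (coeff₁ x v)))
        (trans (cong (coeff₁ x w ℤ.*_) (unit-≡ w)) (ℤ.*-identityʳ (coeff₁ x w)))))))
    where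
    lemma : ∀ a b → a ℤ.* (ℤ.- ℤ.0ℤ ℤ.+ b) ≡ a ℤ.* ℤ.0ℤ ℤ.+ a ℤ.* b
    lemma = solve-∀
    split : ∀ v → coeff₁ x v ℤ.* coeff₁ (T i ∗ basis v) w ≡
      coeff₁ x v ℤ.* unit v w ℤ.+ (if does (i ∈? τ v) then coeff₁ x v ℤ.* + M v w else ℤ.0ℤ)
    split v with i ∈? τ v
    ... | yes i∈v rewrite coeff₁-T-∈ w i∈v | eq | unit-≢ {v} {w} (λ { refl → i∉ i∈v }) =
      lemma (coeff₁ x v) (+ M v w)
    ... | no i∉v rewrite coeff₁-T-∉ w i∉v = sym (ℤ.+-identityʳ (coeff₁ x v ℤ.* unit v w))

  coeff₁-T² : ∀ i j u w → coeff₁ (T i ∗ (T j ∗ basis u)) w ≡ 𝒯 i (𝒯 j (unit u)) w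
  coeff₁-T² i j u w = trans (coeff₁-T≡𝒯 i _ w) (𝒯-cong i (λ v →
    trans (coeff₁-T≡𝒯 j _ v) (𝒯-cong j (coeff₁-basis u) v)) w)

  𝒯-commute : ∀ {i j} → bond i j ≡ 2 → ∀ u w → 𝒯 i (𝒯 j (unit u)) w ≡ 𝒯 j (𝒯 i (unit u)) w
  𝒯-commute {i} {j} m≡2 u w = trans (sym (coeff₁-T² i j u w))
    (trans (coeff₁-cong swap w) (coeff₁-T² j i u w))
    where
    relation : alternating 2 i j ≈ᴴ alternating 2 j i
    relation = subst (λ k → alternating k i j ≈ᴴ alternating k j i) m≡2 (braid i j)
    expand : ∀ i j → alternating 2 i j ∗ basis u ≈ᴹ T i ∗ (T j ∗ basis u)
    expand i j = transᴹ (*ₗ-assoc _ _ _) (*ₗ-congˡ (transᴹ (*ₗ-assoc _ _ _) (*ₗ-congˡ (*ₗ-identityˡ _))))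
    swap : T i ∗ (T j ∗ basis u) ≈ᴹ T j ∗ (T i ∗ basis u)
    swap = transᴹ (symᴹ (expand i j)) (transᴹ (*ₗ-congʳ relation) (expand j i))

  𝒯-braid : ∀ {i j} → bond i j ≡ 3 → ∀ u w →
    𝒯 i (𝒯 j (𝒯 i (unit u))) w ≡ 𝒯 j (𝒯 i (𝒯 j (unit u))) w
  𝒯-braid {i} {j} m≡3 u w = trans (sym (coeff₁-T³ i j))
    (trans (coeff₁-cong swap w) (coeff₁-T³ j i))
    where
    relation : alternating 3 i j ≈ᴴ alternating 3 j i
    relation = subst (λ k → alternating k i j ≈ᴴ alternating k j i) m≡3 (braid i j)
    expand : ∀ i j → alternating 3 i j ∗ basis u ≈ᴹ T i ∗ (T j ∗ (T i ∗ basis u))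
    expand i j = transᴹ (*ₗ-assoc _ _ _) (*ₗ-congˡ (transᴹ (*ₗ-assoc _ _ _) (*ₗ-congˡ
      (transᴹ (*ₗ-assoc _ _ _) (*ₗ-congˡ (*ₗ-identityˡ _))))))
    swap : T i ∗ (T j ∗ (T i ∗ basis u)) ≈ᴹ T j ∗ (T i ∗ (T j ∗ basis u))
    swap = transᴹ (symᴹ (expand i j)) (transᴹ (*ₗ-congʳ relation) (expand j i))
    coeff₁-T³ : ∀ i j → coeff₁ (T i ∗ (T j ∗ (T i ∗ basis u))) w ≡ 𝒯 i (𝒯 j (𝒯 i (unit u))) w
    coeff₁-T³ i j = trans (coeff₁-T≡𝒯 i _ w) (𝒯-cong i (λ v → coeff₁-T² j i u v) w)

  𝒯-unit-∉ : ∀ {i u} → i ∉ τ u → ∀ s → 𝒯 i (unit u) s ≡ unit u s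
  𝒯-unit-∉ {i} {u} i∉ s with i ∈? τ s
  ... | yes i∈s rewrite unit-≢ {u} {s} (λ { refl → i∉ i∈s }) = refl
  ... | no  _   = trans (cong (λ z → unit u s ℤ.+ z) (∑-zero vs λ {v} _ → outside v)) (ℤ.+-identityʳ _)
    where
    outside : ∀ v → (if does (i ∈? τ v) then unit u v ℤ.* + M v s else ℤ.0ℤ) ≡ ℤ.0ℤ
    outside v with i ∈? τ v
    ... | yes i∈v rewrite unit-≢ {u} {v} (λ { refl → i∉ i∈v }) = refl
    ... | no  _   = refl

  inflow-unit : ∀ {i u} → i ∈ τ u → ∀ s → inflow i (unit u) s ≡ + M u s
  inflow-unit {i} {u} i∈ s = trans (∑-single vs! (∈vs u) outside) at-u
    where
    outside : ∀ {v} → v ≢ u → (if does (i ∈? τ v) then unit u v ℤ.* + M v s else ℤ.0ℤ) ≡ ℤ.0ℤ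
    outside {v} v≢u rewrite unit-≢ {u} {v} (v≢u ∘ sym) with does (i ∈? τ v)
    ... | true  = refl
    ... | false = refl
    at-u : (if does (i ∈? τ u) then unit u u ℤ.* + M u s else ℤ.0ℤ) ≡ + M u s
    at-u rewrite dec-true (i ∈? τ u) i∈ | unit-≡ u = ℤ.*-identityˡ (+ M u s)

  𝒯-unit-∈ : ∀ {i u s} → i ∈ τ u → i ∉ τ s → 𝒯 i (unit u) s ≡ + M u s
  𝒯-unit-∈ {i} {u} {s} i∈u i∉s rewrite 𝒯-∉ {i} {s} (unit u) i∉s | unit-≢ {u} {s} (λ { refl → i∉s i∈u }) =
    trans (ℤ.+-identityˡ _) (inflow-unit i∈u s)

  -- Stembridge's Compatibility Rule.
  compatible : ∀ {i j u v} → bond i j ≡ 2 → i ∈ τ u → i ∉ τ v → j ∉ τ u → j ∈ τ v → M u v ≡ 0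
  compatible {i} {j} {u} {v} m≡2 i∈u i∉v j∉u j∈v = ℤ.+-injective (x≡-x (begin
    + M u v                   ≡⟨ inflow-unit i∈u v ⟨
    inflow i (unit u) v       ≡⟨ inflow-cong i (λ {s} _ → 𝒯-unit-∉ j∉u s) v ⟨
    inflow i (𝒯 j (unit u)) v ≡⟨ ℤ.+-identityˡ _ ⟨
    ℤ.0ℤ ℤ.+ inflow i (𝒯 j (unit u)) v
                              ≡⟨ cong (ℤ._+ inflow i (𝒯 j (unit u)) v) (trans (𝒯-unit-∉ j∉u v) (unit-≢ u≢v)) ⟨
    𝒯 j (unit u) v ℤ.+ inflow i (𝒯 j (unit u)) v
                              ≡⟨ 𝒯-∉ (𝒯 j (unit u)) i∉v ⟨
    𝒯 i (𝒯 j (unit u)) v      ≡⟨ 𝒯-commute m≡2 u v ⟩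
    𝒯 j (𝒯 i (unit u)) v      ≡⟨ 𝒯-∈ (𝒯 i (unit u)) j∈v ⟩
    ℤ.- 𝒯 i (unit u) v        ≡⟨ cong ℤ.-_ (𝒯-unit-∈ i∈u i∉v) ⟩
    ℤ.- + M u v               ∎))
    where
    open ≡-Reasoning
    u≢v : u ≢ v
    u≢v refl = i∉v i∈u
    x≡-x : ∀ {k} → + k ≡ ℤ.- + k → + k ≡ + 0
    x≡-x {zero} _ = refl

  Exclusive : Fin r → Fin r → Set
  Exclusive i j = ∀ {v} → i ∈ τ v → j ∉ τ v

  -- `𝒯 j` fixes `unit u`, so the braid relation equates 𝒯 i (𝒯 j (𝒯 i u)) with 𝒯 j (𝒯 i u). At u
  -- the former is minus the latter, because i is a descent of u; hence the common value -1 + S is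
  -- 0.
  bonding-sum : ∀ {i j u} → bond i j ≡ 3 → Exclusive i j → i ∈ τ u →
    ∑ vs (λ s → + (if does (j ∈? τ s) then M u s ℕ.* M s u else 0)) ≡ ℤ.1ℤ
  bonding-sum {i} {j} {u} m≡3 exclusive i∈u = trans (∑-cong (sym ∘ term) vs) (-1+x (begin
    ℤ.- (ℤ.- ℤ.1ℤ ℤ.+ S)         ≡⟨ cong ℤ.-_ 𝒯ⱼ𝒯ᵢ ⟨
    ℤ.- 𝒯 j (𝒯 i (unit u)) u     ≡⟨ 𝒯-∈ (𝒯 j (𝒯 i (unit u))) i∈u ⟨
    𝒯 i (𝒯 j (𝒯 i (unit u))) u   ≡⟨ 𝒯-braid m≡3 u u ⟩
    𝒯 j (𝒯 i (𝒯 j (unit u))) u   ≡⟨ 𝒯-cong j (𝒯-cong i (𝒯-unit-∉ j∉u)) u ⟩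
    𝒯 j (𝒯 i (unit u)) u         ≡⟨ 𝒯ⱼ𝒯ᵢ ⟩
    ℤ.- ℤ.1ℤ ℤ.+ S               ∎))
    where
    open ≡-Reasoning
    j∉u : j ∉ τ u
    j∉u = exclusive i∈u
    S : ℤ
    S = inflow j (𝒯 i (unit u)) u
    𝒯ⱼ𝒯ᵢ : 𝒯 j (𝒯 i (unit u)) u ≡ ℤ.- ℤ.1ℤ ℤ.+ S
    𝒯ⱼ𝒯ᵢ = trans (𝒯-∉ (𝒯 i (unit u)) j∉u)
      (cong (ℤ._+ S) (trans (𝒯-∈ (unit u) i∈u) (cong ℤ.-_ (unit-≡ u))))
    term : ∀ s → (if does (j ∈? τ s) then 𝒯 i (unit u) s ℤ.* + M s u else ℤ.0ℤ) ≡
                 + (if does (j ∈? τ s) then M u s ℕ.* M s u else 0)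
    term s with j ∈? τ s
    ... | yes j∈s = trans (cong (ℤ._* + M s u) (𝒯-unit-∈ i∈u (λ i∈s → exclusive i∈s j∈s)))
                          (sym (ℤ.pos-* (M u s) (M s u)))
    ... | no  _   = refl
    -1+x : ∀ {x} → ℤ.- (ℤ.- ℤ.1ℤ ℤ.+ x) ≡ ℤ.- ℤ.1ℤ ℤ.+ x → x ≡ ℤ.1ℤ
    -1+x {x} eq = ℤ.*-cancelˡ-≡ (+ 2) x ℤ.1ℤ
      (trans (double x) (trans (cong (λ y → y ℤ.+ (x ℤ.+ ℤ.1ℤ)) (sym eq)) (two x)))
      where
      double : ∀ x → + 2 ℤ.* x ≡ (ℤ.- ℤ.1ℤ ℤ.+ x) ℤ.+ (x ℤ.+ ℤ.1ℤ)
      double = solve-∀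
      two : ∀ x → ℤ.- (ℤ.- ℤ.1ℤ ℤ.+ x) ℤ.+ (x ℤ.+ ℤ.1ℤ) ≡ + 2 ℤ.* ℤ.1ℤ
      two = solve-∀

  M-symmetric : ∀ {i j u v} → i ∈ τ u → i ∉ τ v → j ∉ τ u → j ∈ τ v → M u v ≡ M v u
  M-symmetric {u = u} {v} i∈u i∉v j∉u j∈v = fromℕ-injective
    (L.trans (L.sym (proj₂ (natural u v)))
      (L.trans (symmetric u v ((λ u⊆v → i∉v (u⊆v i∈u)) , λ v⊆u → j∉u (v⊆u j∈v))) (proj₂ (natural v u))))

  -- By admissibility the summands of `bonding-sum` are squares of weights, and u₁ alone contributes
  -- the whole sum 1.
  bonded-unique : ∀ {i j u u₁ s} → bond i j ≡ 3 → Exclusive i j → i ∈ τ u → j ∈ τ u₁ →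
    M u u₁ ≡ 1 → M u₁ u ≡ 1 → j ∈ τ s → u₁ ≢ s → M u s ≡ 0 × M s u ≡ 0
  bonded-unique {i} {j} {u} {u₁} {s} m≡3 exclusive i∈u j∈u₁ Muu₁ Mu₁u j∈s u₁≢s =
    Mus≡0 , trans (sym Mus≡Msu) Mus≡0
    where
    g : V → ℕ
    g s = if does (j ∈? τ s) then M u s ℕ.* M s u else 0
    Mus≡Msu : M u s ≡ M s u
    Mus≡Msu = M-symmetric i∈u (λ i∈s → exclusive i∈s j∈s) (exclusive i∈u) j∈s
    gu₁ : g u₁ ≡ 1
    gu₁ rewrite dec-true (j ∈? τ u₁) j∈u₁ | Muu₁ | Mu₁u = refl
    gs : M u s ℕ.* M s u ≡ 0
    gs = trans (sym (cong (if_then M u s ℕ.* M s u else 0) (dec-true (j ∈? τ s) j∈s)))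
      (∑≡1⇒zero-elsewhere g (bonding-sum m≡3 exclusive i∈u) (∈vs u₁) gu₁ (∈vs s) u₁≢s)
    Mus≡0 : M u s ≡ 0
    Mus≡0 with ℕ.m*n≡0⇒m≡0∨n≡0 (M u s) gs
    ... | inj₁ z = z
    ... | inj₂ z = trans Mus≡Msu z

  ∑-unit : ∀ a c → ∑ vs (λ s → unit a s ℤ.* c) ≡ c
  ∑-unit a c = trans
    (∑-single vs! (∈vs a) λ {s} s≢a → cong (ℤ._* c) (unit-≢ (s≢a ∘ sym)))
    (trans (cong (ℤ._* c) (unit-≡ a)) (ℤ.*-identityˡ c))

  module _ {i j k u u₁ v v₁}
    (ij : bond i j ≡ 2) (ik : bond i k ≡ 2) (jk : bond j k ≡ 3)
    (exclusive : Exclusive j k)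
    (j∈u : j ∈ τ u) (k∈u₁ : k ∈ τ u₁) (Muu₁ : M u u₁ ≡ 1) (Mu₁u : M u₁ u ≡ 1)
    (j∈v : j ∈ τ v) (k∈v₁ : k ∈ τ v₁) (Mvv₁ : M v v₁ ≡ 1) (Mv₁v : M v₁ v ≡ 1)
    (i∈u : i ∈ τ u) (i∈u₁ : i ∈ τ u₁) (i∉v : i ∉ τ v) (i∉v₁ : i ∉ τ v₁) where

    private
      exclusive′ : Exclusive k j
      exclusive′ k∈ j∈ = exclusive j∈ k∈

      j∉v₁ : j ∉ τ v₁
      j∉v₁ = exclusive′ k∈v₁

      only-v : ∀ {s} → j ∈ τ s → v ≢ s → M s v₁ ≡ 0
      only-v j∈s v≢s = proj₂ (bonded-unique (trans (CoxeterMatrix.symmetric C k j) jk) exclusive′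
        k∈v₁ j∈v Mv₁v Mvv₁ j∈s v≢s)

      only-u₁ : ∀ {s} → k ∈ τ s → u₁ ≢ s → M u s ≡ 0
      only-u₁ k∈s u₁≢s = proj₁ (bonded-unique jk exclusive j∈u k∈u₁ Muu₁ Mu₁u k∈s u₁≢s)

      μ μ₁ : ℤ
      μ  = + M u v
      μ₁ = + M u v₁

      -- The term -μ₁ at s = u comes from the eigenvalue -1 and cancels the direct weight from u to
      -- v₁.
      two-terms : ∀ f a c → (∀ s → f s ≡ unit u s ℤ.* (ℤ.- μ₁) ℤ.+ unit a s ℤ.* c) → μ₁ ℤ.+ ∑ vs f ≡ c
      two-terms f a c eq = trans
        (cong (λ z → μ₁ ℤ.+ z) (trans (∑-cong eq vs)
          (trans (∑-+ (λ s → unit u s ℤ.* (ℤ.- μ₁)) (λ s → unit a s ℤ.* c) vs)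
            (cong₂ ℤ._+_ (∑-unit u (ℤ.- μ₁)) (∑-unit a c)))))
        (cancel μ₁ c)
        where
        cancel : ∀ x y → x ℤ.+ (ℤ.- x ℤ.+ y) ≡ y
        cancel = solve-∀

      nothing : ∀ {a s c} → u ≢ s → a ≢ s → ℤ.0ℤ ≡ unit u s ℤ.* (ℤ.- μ₁) ℤ.+ unit a s ℤ.* c
      nothing u≢s a≢s rewrite unit-≢ u≢s | unit-≢ a≢s = refl

      right : ∀ {a} c → u ≢ a → c ≡ unit u a ℤ.* (ℤ.- μ₁) ℤ.+ unit a a ℤ.* c
      right {a} c u≢a rewrite unit-≢ u≢a | unit-≡ a = sym (trans (ℤ.+-identityˡ _) (ℤ.*-identityˡ c))

      left : ∀ {a s} c → a ≢ s → (ℤ.- unit u s) ℤ.* + M s v₁ ≡ unit u s ℤ.* (ℤ.- μ₁) ℤ.+ unit a s ℤ.* c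
      left {a} {s} c a≢s rewrite unit-≢ a≢s with u ≟ s
      ... | yes refl = solve μ₁
        where
        solve : ∀ x → (ℤ.- ℤ.1ℤ) ℤ.* x ≡ ℤ.1ℤ ℤ.* (ℤ.- x) ℤ.+ ℤ.0ℤ
        solve = solve-∀
      ... | no  _    = refl

      u≢v : u ≢ v
      u≢v refl = i∉v i∈u

      u≢u₁ : u ≢ u₁
      u≢u₁ refl = exclusive j∈u k∈u₁

      left-term : ∀ s → (if does (j ∈? τ s) then 𝒯 i (unit u) s ℤ.* + M s v₁ else ℤ.0ℤ) ≡
        unit u s ℤ.* (ℤ.- μ₁) ℤ.+ unit v s ℤ.* μ
      left-term s with j ∈? τ s
      ... | no j∉s = nothing (λ { refl → j∉s j∈u }) (λ { refl → j∉s j∈v })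
      ... | yes j∈s with i ∈? τ s
      ...   | yes i∈s = left μ (λ { refl → i∉v i∈s })
      ...   | no  i∉s = trans
        (cong (ℤ._* + M s v₁) (trans (sym (𝒯-∉ (unit u) i∉s)) (𝒯-unit-∈ i∈u i∉s)))
        (at-s (v ≟ s))
        where
        at-s : Dec (v ≡ s) → + M u s ℤ.* + M s v₁ ≡ unit u s ℤ.* (ℤ.- μ₁) ℤ.+ unit v s ℤ.* μ
        at-s (yes refl) rewrite Mvv₁ = trans (ℤ.*-identityʳ μ) (right μ u≢v)
        at-s (no v≢s) rewrite only-v j∈s v≢s =
          trans (ℤ.*-zeroʳ (+ M u s)) (nothing (λ { refl → i∉s i∈u }) v≢s)

      right-term : ∀ s → (if does (i ∈? τ s) then 𝒯 j (unit u) s ℤ.* + M s v₁ else ℤ.0ℤ) ≡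
        unit u s ℤ.* (ℤ.- μ₁) ℤ.+ unit u₁ s ℤ.* + M u₁ v₁
      right-term s with i ∈? τ s
      ... | no i∉s = nothing (λ { refl → i∉s i∈u }) (λ { refl → i∉s i∈u₁ })
      ... | yes i∈s with j ∈? τ s
      ...   | yes j∈s = left (+ M u₁ v₁) (λ { refl → exclusive j∈s k∈u₁ })
      ...   | no  j∉s = trans
        (cong (ℤ._* + M s v₁) (trans (sym (𝒯-∉ (unit u) j∉s)) (𝒯-unit-∈ j∈u j∉s)))
        (at-s (u₁ ≟ s) (k ∈? τ s))
        where
        at-s : Dec (u₁ ≡ s) → Dec (k ∈ τ s) →
          + M u s ℤ.* + M s v₁ ≡ unit u s ℤ.* (ℤ.- μ₁) ℤ.+ unit u₁ s ℤ.* + M u₁ v₁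
        at-s (yes refl) _ rewrite Muu₁ = trans (ℤ.*-identityˡ _) (right _ u≢u₁)
        at-s (no u₁≢s) (yes k∈s) rewrite only-u₁ k∈s u₁≢s = nothing (λ { refl → j∉s j∈u }) u₁≢s
        -- Without the descent k, uniqueness at u says nothing about s; but k then separates s from
        -- v₁, so the second step of the path vanishes instead.
        at-s (no u₁≢s) (no k∉s) rewrite compatible ik i∈s i∉v₁ k∉s k∈v₁ =
          trans (ℤ.*-zeroʳ (+ M u s)) (nothing (λ { refl → j∉s j∈u }) u₁≢s)

    -- Compare the coefficients at v₁ in 𝒯 j (𝒯 i u) = 𝒯 i (𝒯 j u). On both sides the weight from u
    -- to v₁ cancels. Among the paths from u through s to v₁, only s = v survives on the left and
    -- only s = u₁ on the right.
    transfer : M u v ≡ M u₁ v₁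
    transfer = ℤ.+-injective (begin
      μ                                               ≡⟨ two-terms _ v μ left-term ⟨
      μ₁ ℤ.+ inflow j (𝒯 i (unit u)) v₁               ≡⟨ cong (ℤ._+ inflow j (𝒯 i (unit u)) v₁) (𝒯-unit-∈ i∈u i∉v₁) ⟨
      𝒯 i (unit u) v₁ ℤ.+ inflow j (𝒯 i (unit u)) v₁  ≡⟨ 𝒯-∉ (𝒯 i (unit u)) j∉v₁ ⟨
      𝒯 j (𝒯 i (unit u)) v₁                           ≡⟨ 𝒯-commute ij u v₁ ⟨
      𝒯 i (𝒯 j (unit u)) v₁                           ≡⟨ 𝒯-∉ (𝒯 j (unit u)) i∉v₁ ⟩
      𝒯 j (unit u) v₁ ℤ.+ inflow i (𝒯 j (unit u)) v₁  ≡⟨ cong (ℤ._+ inflow i (𝒯 j (unit u)) v₁) (𝒯-unit-∈ j∈u j∉v₁) ⟩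
      μ₁ ℤ.+ inflow i (𝒯 j (unit u)) v₁               ≡⟨ two-terms _ u₁ (+ M u₁ v₁) right-term ⟩
      + M u₁ v₁                                       ∎)
      where open ≡-Reasoning

-- Cyclic words

-- ↑ marks an entry of the top row and ↓ one of the bottom row; as parentheses they open and close.
Letter Word : Set
Letter = Bool
Word   = List Letter

pattern ↑ = false
pattern ↓ = true

#↓ : Word → ℕ
#↓ []      = 0
#↓ (↑ ∷ w) = #↓ w
#↓ (↓ ∷ w) = suc (#↓ w)

#↓-∷ : ∀ x w → #↓ (x ∷ w) ≡ #↓ [ x ] ℕ.+ #↓ w
#↓-∷ ↑ w = refl
#↓-∷ ↓ w = refl

#↓-++ : ∀ w w′ → #↓ (w ++ w′) ≡ #↓ w ℕ.+ #↓ w′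
#↓-++ []      w′ = refl
#↓-++ (↑ ∷ w) w′ = #↓-++ w w′
#↓-++ (↓ ∷ w) w′ = cong suc (#↓-++ w w′)

applyUpTo-cong : ∀ {f g : ℕ → A} m → (∀ {k} → k < m → f k ≡ g k) → applyUpTo f m ≡ applyUpTo g m
applyUpTo-cong zero    f≗g = refl
applyUpTo-cong (suc m) f≗g = cong₂ _∷_ (f≗g (s≤s z≤n)) (applyUpTo-cong m λ k<m → f≗g (s≤s k<m))

applyUpTo-injective : ∀ {f g : ℕ → A} m → applyUpTo f m ≡ applyUpTo g m → ∀ {k} → k < m → f k ≡ g k
applyUpTo-injective (suc m) eq {zero}  _         = List.∷-injectiveˡ eq
applyUpTo-injective (suc m) eq {suc k} (s≤s k<m) = applyUpTo-injective m (List.∷-injectiveʳ eq) k<m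

applyUpTo-+ : ∀ (f : ℕ → A) m l → applyUpTo f (m ℕ.+ l) ≡ applyUpTo f m ++ applyUpTo (λ k → f (m ℕ.+ k)) l
applyUpTo-+ f zero    l = refl
applyUpTo-+ f (suc m) l = cong (f 0 ∷_) (applyUpTo-+ (f ∘ suc) m l)

applyUpTo-at : ∀ {f : ℕ → A} m α {x β} → applyUpTo f m ≡ α ++ x ∷ β → f (length α) ≡ x
applyUpTo-at (suc m) []      eq = List.∷-injectiveˡ eq
applyUpTo-at zero    (_ ∷ α) ()
applyUpTo-at (suc m) (_ ∷ α) eq = applyUpTo-at m α (List.∷-injectiveʳ eq)

applyUpTo-replace : ∀ {f g : ℕ → A} m α {x β} → applyUpTo f m ≡ α ++ x ∷ β →
  (∀ {k} → k < m → k ≢ length α → g k ≡ f k) → applyUpTo g m ≡ α ++ g (length α) ∷ β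
applyUpTo-replace (suc m) []      eq g≗f = cong (_ ∷_)
  (trans (applyUpTo-cong m λ k<m → g≗f (s≤s k<m) λ ()) (List.∷-injectiveʳ eq))
applyUpTo-replace zero    (_ ∷ α) ()
applyUpTo-replace (suc m) (_ ∷ α) eq g≗f = cong₂ _∷_ (trans (g≗f (s≤s z≤n) λ ()) (List.∷-injectiveˡ eq))
  (applyUpTo-replace m α (List.∷-injectiveʳ eq) λ k<m k≢ → g≗f (s≤s k<m) (k≢ ∘ ℕ.suc-injective))

applyUpTo-agree : ∀ {f g : ℕ → A} m α {x y β} → applyUpTo f m ≡ α ++ x ∷ β → applyUpTo g m ≡ α ++ y ∷ β →
  ∀ {k} → k < m → k ≢ length α → f k ≡ g k
applyUpTo-agree (suc m) []      eq eq′ {zero}  _         k≢ = contradiction refl k≢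
applyUpTo-agree (suc m) []      eq eq′ {suc k} (s≤s k<m) k≢ =
  applyUpTo-injective m (trans (List.∷-injectiveʳ eq) (sym (List.∷-injectiveʳ eq′))) k<m
applyUpTo-agree (suc m) (_ ∷ α) eq eq′ {zero}  _         k≢ =
  trans (List.∷-injectiveˡ eq) (sym (List.∷-injectiveˡ eq′))
applyUpTo-agree (suc m) (_ ∷ α) eq eq′ {suc k} (s≤s k<m) k≢ =
  applyUpTo-agree m α (List.∷-injectiveʳ eq) (List.∷-injectiveʳ eq′) k<m (k≢ ∘ cong suc)

letterAt : Word → ℕ → Letter
letterAt []      _       = ↑
letterAt (x ∷ w) zero    = x
letterAt (x ∷ w) (suc k) = letterAt w k

applyUpTo-letterAt : ∀ w → applyUpTo (letterAt w) (length w) ≡ w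
applyUpTo-letterAt []      = refl
applyUpTo-letterAt (x ∷ w) = cong (x ∷_) (applyUpTo-letterAt w)

#↓-applyUpTo-∧ : ∀ (f : ℕ → Letter) m l → #↓ (applyUpTo (λ k → f k ∧ does (k ℕ.<? m)) (m ℕ.+ l)) ≡ #↓ (applyUpTo f m)
#↓-applyUpTo-∧ f zero    l = none l f
  where
  none : ∀ l (f : ℕ → Letter) → #↓ (applyUpTo (λ k → f k ∧ ↑) l) ≡ 0
  none zero    f = refl
  none (suc l) f rewrite Bool.∧-zeroʳ (f 0) = none l (f ∘ suc)
#↓-applyUpTo-∧ f (suc m) l rewrite Bool.∧-identityʳ (f 0) = trans (#↓-∷ (f 0) _)
  (trans (cong (#↓ [ f 0 ] ℕ.+_) (#↓-applyUpTo-∧ (f ∘ suc) m l))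
         (sym (#↓-∷ (f 0) _)))

-- Residues modulo n and steps around the cycle

module _ {n : ℕ} .{{_ : NonZero n}} where

  -- Two remainders of the same integer differ by a multiple of n that is smaller than n.
  %ℕ-unique : ∀ z q r → r < n → z ≡ + r ℤ.+ q ℤ.* + n → z ℤ.%ℕ n ≡ r
  %ℕ-unique z q r r<n z≡ =
    remainders (z ℤ.%ℕ n) r (z ℤ./ℕ n) q (ℤ.n%ℕd<d z n) r<n (trans (sym (ℤ.a≡a%ℕn+[a/ℕn]*n z n)) z≡)
    where
    ordered : ∀ r r′ q q′ → r ≤ r′ → r′ < n → + r ℤ.+ q ℤ.* + n ≡ + r′ ℤ.+ q′ ℤ.* + n → r ≡ r′
    ordered r r′ q q′ r≤r′ r′<n eq = ℕ.≤-antisym r≤r′ (ℕ.m∸n≡0⇒m≤n (small (r′ ℕ.∸ r) (q ℤ.- q′) (ℕ.≤-<-trans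
        (ℕ.m∸n≤m r′ r) r′<n) difference))
      where
      small : ∀ d q → d < n → + d ≡ q ℤ.* + n → d ≡ 0
      small zero    q _   _  = refl
      small (suc d) q d<n eq = contradiction
        (ℕ.divides ℤ.∣ q ∣ (trans (cong ℤ.∣_∣ eq) (ℤ.abs-* q (+ n)))) (ℕ.>⇒∤ d<n)
      rearrange : ∀ a b c d → a ℤ.- b ≡ (a ℤ.+ c) ℤ.- (b ℤ.+ d) ℤ.+ (d ℤ.- c)
      rearrange = solve-∀
      cancel : ∀ a q q′ n → a ℤ.- a ℤ.+ (q ℤ.* n ℤ.- q′ ℤ.* n) ≡ (q ℤ.- q′) ℤ.* n
      cancel = solve-∀
      difference : + (r′ ℕ.∸ r) ≡ (q ℤ.- q′) ℤ.* + n
      difference = begin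
        + (r′ ℕ.∸ r)    ≡⟨ ℤ.⊖-≥ r≤r′ ⟨
        r′ ℤ.⊖ r        ≡⟨ ℤ.m-n≡m⊖n r′ r ⟨
        + r′ ℤ.- + r    ≡⟨ rearrange (+ r′) (+ r) (q′ ℤ.* + n) (q ℤ.* + n) ⟩
        (+ r′ ℤ.+ q′ ℤ.* + n) ℤ.- (+ r ℤ.+ q ℤ.* + n) ℤ.+ (q ℤ.* + n ℤ.- q′ ℤ.* + n)
                        ≡⟨ cong (λ x → x ℤ.- (+ r ℤ.+ q ℤ.* + n) ℤ.+ (q ℤ.* + n ℤ.- q′ ℤ.* + n)) eq ⟨
        (+ r ℤ.+ q ℤ.* + n) ℤ.- (+ r ℤ.+ q ℤ.* + n) ℤ.+ (q ℤ.* + n ℤ.- q′ ℤ.* + n)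
                        ≡⟨ cancel (+ r ℤ.+ q ℤ.* + n) q q′ (+ n) ⟩
        (q ℤ.- q′) ℤ.* + n ∎
        where open ≡-Reasoning
    remainders : ∀ r r′ q q′ → r < n → r′ < n → + r ℤ.+ q ℤ.* + n ≡ + r′ ℤ.+ q′ ℤ.* + n → r ≡ r′
    remainders r r′ q q′ r<n r′<n eq with ℕ.≤-total r r′
    ... | inj₁ r≤r′ = ordered r r′ q q′ r≤r′ r′<n eq
    ... | inj₂ r′≤r = sym (ordered r′ r q′ q r′≤r r<n (sym eq))

  suc-%ℕ : ∀ z → suc (z ℤ.%ℕ n) ℕ.% n ≡ (z ℤ.+ ℤ.1ℤ) ℤ.%ℕ n
  suc-%ℕ z with ℕ.m≤n⇒m<n∨m≡n (ℤ.n%ℕd<d z n)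
  ... | inj₁ r<n = trans (ℕ.m<n⇒m%n≡m r<n)
    (sym (%ℕ-unique (z ℤ.+ ℤ.1ℤ) (z ℤ./ℕ n) (suc (z ℤ.%ℕ n)) r<n
      (trans (cong (ℤ._+ ℤ.1ℤ) (ℤ.a≡a%ℕn+[a/ℕn]*n z n)) (move (+ (z ℤ.%ℕ n)) ((z ℤ./ℕ n) ℤ.* + n)))))
    where
    move : ∀ a b → a ℤ.+ b ℤ.+ ℤ.1ℤ ≡ (ℤ.1ℤ ℤ.+ a) ℤ.+ b
    move = solve-∀
  ... | inj₂ r≡n = trans (trans (cong (ℕ._% n) r≡n) (ℕ.n%n≡0 n))
    (sym (%ℕ-unique (z ℤ.+ ℤ.1ℤ) (z ℤ./ℕ n ℤ.+ ℤ.1ℤ) 0 (ℕ.>-nonZero⁻¹ n)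
      (trans (cong (ℤ._+ ℤ.1ℤ) (ℤ.a≡a%ℕn+[a/ℕn]*n z n))
        (trans (move (+ (z ℤ.%ℕ n)) (z ℤ./ℕ n) (+ n)) (trans (cong (λ x → + x ℤ.+ (z ℤ./ℕ n) ℤ.* + n) r≡n)
            (tidy (z ℤ./ℕ n) (+ n)))))))
    where
    move : ∀ a b c → a ℤ.+ b ℤ.* c ℤ.+ ℤ.1ℤ ≡ (ℤ.1ℤ ℤ.+ a) ℤ.+ b ℤ.* c
    move = solve-∀
    tidy : ∀ q n → n ℤ.+ q ℤ.* n ≡ ℤ.0ℤ ℤ.+ (q ℤ.+ ℤ.1ℤ) ℤ.* n
    tidy = solve-∀

  toℕ-bar : ∀ k → toℕ (bar {n} k) ≡ (k ℤ.- ℤ.1ℤ) ℤ.%ℕ n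
  toℕ-bar k = Fin.toℕ-fromℕ< _

  bar-⟦⟧ : ∀ x → bar {n} ⟦ x ⟧ ≡ x
  bar-⟦⟧ x = Fin.toℕ-injective (trans (toℕ-bar ⟦ x ⟧) (ℕ.m<n⇒m%n≡m (Fin.toℕ<n x)))

  toℕ-next : ∀ x → toℕ (next {n} x) ≡ suc (toℕ x) ℕ.% n
  toℕ-next x = trans (toℕ-bar (⟦ x ⟧ ℤ.+ ℤ.1ℤ)) (cong (ℕ._% n) (ℕ.+-comm (toℕ x) 1))

  next-bar : ∀ k → next {n} (bar k) ≡ bar (k ℤ.+ ℤ.1ℤ)
  next-bar k = Fin.toℕ-injective (begin
    toℕ (next (bar k))                       ≡⟨ toℕ-next (bar k) ⟩
    suc (toℕ (bar {n} k)) ℕ.% n              ≡⟨ cong (λ r → suc r ℕ.% n) (toℕ-bar k) ⟩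
    suc ((k ℤ.- ℤ.1ℤ) ℤ.%ℕ n) ℕ.% n          ≡⟨ suc-%ℕ (k ℤ.- ℤ.1ℤ) ⟩
    (k ℤ.- ℤ.1ℤ ℤ.+ ℤ.1ℤ) ℤ.%ℕ n             ≡⟨ cong (ℤ._%ℕ n) (swap k) ⟩
    (k ℤ.+ ℤ.1ℤ ℤ.- ℤ.1ℤ) ℤ.%ℕ n             ≡⟨ toℕ-bar (k ℤ.+ ℤ.1ℤ) ⟨
    toℕ (bar {n} (k ℤ.+ ℤ.1ℤ))               ∎)
    where
    open ≡-Reasoning
    swap : ∀ k → k ℤ.- ℤ.1ℤ ℤ.+ ℤ.1ℤ ≡ k ℤ.+ ℤ.1ℤ ℤ.- ℤ.1ℤ
    swap = solve-∀

  infixl 6 _⊹_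
  -- The recursion advances the starting point, so the letters of `cut i p` after the first are
  -- definitionally the initial letters of `cut (next i) p`. The rotation `cut-next` rests on this.
  _⊹_ : Fin n → ℕ → Fin n
  x ⊹ zero  = x
  x ⊹ suc k = next x ⊹ k

  next-⊹ : ∀ x k → next x ⊹ k ≡ next (x ⊹ k)
  next-⊹ x zero    = refl
  next-⊹ x (suc k) = next-⊹ (next x) k

  ⊹-+ : ∀ x k l → x ⊹ (k ℕ.+ l) ≡ x ⊹ k ⊹ l
  ⊹-+ x zero    l = refl
  ⊹-+ x (suc k) l = ⊹-+ (next x) k l

  bar-⊹ : ∀ z k → bar z ⊹ k ≡ bar (z ℤ.+ + k)
  bar-⊹ z zero    = cong bar (sym (ℤ.+-identityʳ z))
  bar-⊹ z (suc k) = trans (cong (_⊹ k) (next-bar z))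
    (trans (bar-⊹ (z ℤ.+ ℤ.1ℤ) k) (cong bar (ℤ.+-assoc z ℤ.1ℤ (+ k))))

  ⊹-bar : ∀ x k → x ⊹ k ≡ bar (⟦ x ⟧ ℤ.+ + k)
  ⊹-bar x k = trans (cong (_⊹ k) (sym (bar-⟦⟧ x))) (bar-⊹ ⟦ x ⟧ k)

  toℕ-⊹ : ∀ x k → toℕ (x ⊹ k) ≡ (toℕ x ℕ.+ k) ℕ.% n
  toℕ-⊹ x k = trans (cong toℕ (⊹-bar x k)) (toℕ-bar (⟦ x ⟧ ℤ.+ + k))

  ⊹-n : ∀ x → x ⊹ n ≡ x
  ⊹-n x = Fin.toℕ-injective (trans (toℕ-⊹ x n)
    (trans (ℕ.[m+n]%n≡m%n (toℕ x) n) (ℕ.m<n⇒m%n≡m (Fin.toℕ<n x))))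

  next-injective : ∀ {x y} → next {n} x ≡ next y → x ≡ y
  next-injective {x} {y} eq = trans (round x) (trans (cong (_⊹ ℕ.pred n) eq) (sym (round y)))
    where
    round : ∀ x → x ≡ next x ⊹ ℕ.pred n
    round x = trans (sym (⊹-n x)) (cong (x ⊹_) (sym (ℕ.suc-pred n)))

  ⊹-injectiveˡ : ∀ k {x y} → x ⊹ k ≡ y ⊹ k → x ≡ y
  ⊹-injectiveˡ zero    eq = eq
  ⊹-injectiveˡ (suc k) eq = next-injective (⊹-injectiveˡ k eq)

  ⊹≢ : ∀ x {m} → 0 < m → m < n → x ⊹ m ≢ x
  ⊹≢ x {m} 0<m m<n eq with toℕ x ℕ.+ m ℕ.<? n | trans (sym (toℕ-⊹ x m)) (cong toℕ eq)
  ... | yes x+m<n | wrapped = ℕ.<⇒≢ 0<m (sym (ℕ.+-cancelˡ-≡ (toℕ x) m 0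
    (trans (sym (ℕ.m<n⇒m%n≡m x+m<n)) (trans wrapped (sym (ℕ.+-identityʳ (toℕ x)))))))
  ... | no  x+m≮n | wrapped = ℕ.<⇒≢ m<n (ℕ.+-cancelˡ-≡ (toℕ x) m n
    (trans (sym (ℕ.m∸n+n≡m n≤x+m)) (cong (ℕ._+ n) (trans (sym (ℕ.m<n⇒m%n≡m small))
      (trans (ℕ.m≤n⇒[n∸m]%m≡n%m n≤x+m) wrapped)))))
    where
    n≤x+m : n ≤ toℕ x ℕ.+ m
    n≤x+m = ℕ.≮⇒≥ x+m≮n
    small : toℕ x ℕ.+ m ℕ.∸ n < n
    small = ℕ.+-cancelʳ-< n _ _ (subst (_< n ℕ.+ n) (sym (ℕ.m∸n+n≡m n≤x+m)) (ℕ.+-mono-< (Fin.toℕ<n x) m<n))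

  ⊹-distinct : ∀ x {k l} → k < l → l < n → x ⊹ l ≢ x ⊹ k
  ⊹-distinct x {k} {l} k<l l<n eq = ⊹≢ (x ⊹ k) (ℕ.m<n⇒0<n∸m k<l) (ℕ.≤-<-trans (ℕ.m∸n≤m l k) l<n)
    (trans (sym (⊹-+ x k (l ℕ.∸ k))) (trans (cong (x ⊹_) (ℕ.m+[n∸m]≡n (ℕ.<⇒≤ k<l))) eq))

  ⊹-injectiveʳ : ∀ x {k l} → k < n → l < n → x ⊹ k ≡ x ⊹ l → k ≡ l
  ⊹-injectiveʳ x {k} {l} k<n l<n eq with ℕ.<-cmp k l
  ... | tri< k<l _ _ = contradiction (sym eq) (⊹-distinct x k<l l<n)
  ... | tri≈ _ k≡l _ = k≡l
  ... | tri> _ _ l<k = contradiction eq (⊹-distinct x l<k k<n)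

  reach : ∀ x y → ∃[ k ] k < n × x ⊹ k ≡ y
  reach x y = z ℕ.% n , ℕ.m%n<n z n , Fin.toℕ-injective (begin
    toℕ (x ⊹ (z ℕ.% n))            ≡⟨ toℕ-⊹ x (z ℕ.% n) ⟩
    (toℕ x ℕ.+ z ℕ.% n) ℕ.% n      ≡⟨ ℕ.[m+kn]%n≡m%n (toℕ x ℕ.+ z ℕ.% n) (z ℕ./ n) n ⟨
    (toℕ x ℕ.+ z ℕ.% n ℕ.+ z ℕ./ n ℕ.* n) ℕ.% n
      ≡⟨ cong (ℕ._% n) (trans (ℕ.+-assoc (toℕ x) _ _) (cong (toℕ x ℕ.+_) (sym (ℕ.m≡m%n+[m/n]*n z n)))) ⟩
    (toℕ x ℕ.+ z) ℕ.% n            ≡⟨ cong (ℕ._% n) whole ⟩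
    (toℕ y ℕ.+ n) ℕ.% n            ≡⟨ ℕ.[m+n]%n≡m%n (toℕ y) n ⟩
    toℕ y ℕ.% n                    ≡⟨ ℕ.m<n⇒m%n≡m (Fin.toℕ<n y) ⟩
    toℕ y                          ∎)
    where
    open ≡-Reasoning
    -- The difference of y and x, increased by n to remain natural.
    z : ℕ
    z = toℕ y ℕ.+ (n ℕ.∸ toℕ x)
    whole : toℕ x ℕ.+ z ≡ toℕ y ℕ.+ n
    whole = begin
      toℕ x ℕ.+ (toℕ y ℕ.+ (n ℕ.∸ toℕ x)) ≡⟨ ℕ.+-assoc (toℕ x) (toℕ y) _ ⟨
      toℕ x ℕ.+ toℕ y ℕ.+ (n ℕ.∸ toℕ x)   ≡⟨ cong (ℕ._+ (n ℕ.∸ toℕ x)) (ℕ.+-comm (toℕ x) (toℕ y)) ⟩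
      toℕ y ℕ.+ toℕ x ℕ.+ (n ℕ.∸ toℕ x)   ≡⟨ ℕ.+-assoc (toℕ y) (toℕ x) _ ⟩
      toℕ y ℕ.+ (toℕ x ℕ.+ (n ℕ.∸ toℕ x)) ≡⟨ cong (toℕ y ℕ.+_) (ℕ.m+[n∸m]≡n (ℕ.<⇒≤ (Fin.toℕ<n x))) ⟩
      toℕ y ℕ.+ n                         ∎

  next-prev : ∀ x → next {n} (prev x) ≡ x
  next-prev x = trans (next-bar (⟦ x ⟧ ℤ.- ℤ.1ℤ)) (trans (cong bar (cancel ⟦ x ⟧)) (bar-⟦⟧ x))
    where
    cancel : ∀ a → a ℤ.- ℤ.1ℤ ℤ.+ ℤ.1ℤ ≡ a
    cancel = solve-∀

  prev-next : ∀ x → prev {n} (next x) ≡ x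
  prev-next x = next-injective (next-prev (next x))

  -- Both sides are reached by value x steps from bar z.
  ⊹-value-bar : ∀ x z → x ⊹ value (bar {n} z) ≡ bar (⟦ x ⟧ ℤ.+ z)
  ⊹-value-bar x z = begin
    x ⊹ value (bar z)                 ≡⟨ ⊹-bar x (value (bar z)) ⟩
    bar (⟦ x ⟧ ℤ.+ ⟦ bar {n} z ⟧)     ≡⟨ cong bar (ℤ.+-comm ⟦ x ⟧ ⟦ bar {n} z ⟧) ⟩
    bar (⟦ bar {n} z ⟧ ℤ.+ ⟦ x ⟧)     ≡⟨ bar-⊹ ⟦ bar {n} z ⟧ (value x) ⟨
    bar ⟦ bar {n} z ⟧ ⊹ value x       ≡⟨ cong (_⊹ value x) (bar-⟦⟧ (bar z)) ⟩
    bar z ⊹ value x                   ≡⟨ bar-⊹ z (value x) ⟩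
    bar (z ℤ.+ ⟦ x ⟧)                 ≡⟨ cong bar (ℤ.+-comm z ⟦ x ⟧) ⟩
    bar (⟦ x ⟧ ℤ.+ z)                 ∎
    where open ≡-Reasoning

  ⊹-distance : ∀ x y → x ⊹ value (bar {n} (⟦ y ⟧ ℤ.- ⟦ x ⟧)) ≡ y
  ⊹-distance x y = trans (⊹-value-bar x (⟦ y ⟧ ℤ.- ⟦ x ⟧)) (trans (cong bar (cancel ⟦ x ⟧ ⟦ y ⟧)) (bar-⟦⟧ y))
    where
    cancel : ∀ a b → a ℤ.+ (b ℤ.- a) ≡ b
    cancel = solve-∀

  -- Two step counts below n agree once they lead from x to the same place. The additional `next`
  -- absorbs the shift by 1 in `toℕ-bar`.
  offset : ∀ x {k} → k < n → (⟦ x ⊹ k ⟧ ℤ.- ⟦ x ⟧) ℤ.%ℕ n ≡ k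
  offset x {k} k<n = ⊹-injectiveʳ x (ℤ.n%ℕd<d (⟦ x ⊹ k ⟧ ℤ.- ⟦ x ⟧) n) k<n (next-injective (begin
    next (x ⊹ z ℤ.%ℕ n)                ≡⟨ next-⊹ x (z ℤ.%ℕ n) ⟨
    next x ⊹ (z ℤ.%ℕ n)                ≡⟨ cong (λ r → next x ⊹ r ℤ.%ℕ n) (cancel z) ⟩
    next x ⊹ ((z ℤ.+ ℤ.1ℤ ℤ.- ℤ.1ℤ) ℤ.%ℕ n) ≡⟨ cong (next x ⊹_) (toℕ-bar (z ℤ.+ ℤ.1ℤ)) ⟨
    x ⊹ value (bar {n} (z ℤ.+ ℤ.1ℤ))   ≡⟨ ⊹-value-bar x (z ℤ.+ ℤ.1ℤ) ⟩
    bar (⟦ x ⟧ ℤ.+ (z ℤ.+ ℤ.1ℤ))       ≡⟨ cong bar (cancel′ ⟦ x ⟧ ⟦ x ⊹ k ⟧) ⟩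
    next (x ⊹ k)                       ∎))
    where
    open ≡-Reasoning
    z : ℤ
    z = ⟦ x ⊹ k ⟧ ℤ.- ⟦ x ⟧
    cancel : ∀ z → z ≡ z ℤ.+ ℤ.1ℤ ℤ.- ℤ.1ℤ
    cancel = solve-∀
    cancel′ : ∀ x y → x ℤ.+ (y ℤ.- x ℤ.+ ℤ.1ℤ) ≡ y ℤ.+ ℤ.1ℤ
    cancel′ = solve-∀


  -- Cutting the cycle open into a word

  cut : Fin n → Subset n → Word
  cut i p = applyUpTo (λ k → lookup p (i ⊹ k)) n

  length-cut : ∀ i p → length (cut i p) ≡ n
  length-cut i p = List.length-applyUpTo _ n

  cut-injective : ∀ i {p p′} → cut i p ≡ cut i p′ → p ≡ p′
  cut-injective i {p} {p′} eq =
    trans (sym (Vec.tabulate∘lookup p)) (trans (Vec.tabulate-cong pointwise) (Vec.tabulate∘lookup p′))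
    where
    pointwise : ∀ x → lookup p x ≡ lookup p′ x
    pointwise x with k , k<n , refl ← reach i x = applyUpTo-injective n eq k<n

  cut-surjective : ∀ i w → length w ≡ n → ∃[ p ] cut i p ≡ w
  cut-surjective i w ∣w∣≡n = p , trans (applyUpTo-cong n letters)
    (subst (λ m → applyUpTo (letterAt w) m ≡ w) ∣w∣≡n (applyUpTo-letterAt w))
    where
    p : Subset n
    p = Vec.tabulate λ x → letterAt w (proj₁ (reach i x))
    letters : ∀ {k} → k < n → lookup p (i ⊹ k) ≡ letterAt w k
    letters {k} k<n = trans (Vec.lookup∘tabulate _ (i ⊹ k))
      (let l , l<n , eq = reach i (i ⊹ k) in cong (letterAt w) (⊹-injectiveʳ i l<n k<n eq))

  cut-next : ∀ i p {x w} → cut i p ≡ x ∷ w → cut (next i) p ≡ w List.∷ʳ x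
  cut-next i p {x} {w} eq = rotate n refl (⊹-n i) eq
    where
    rotate : ∀ m → m ≡ n → i ⊹ m ≡ i → applyUpTo (λ k → lookup p (i ⊹ k)) m ≡ x ∷ w →
      applyUpTo (λ k → lookup p (next i ⊹ k)) n ≡ w List.∷ʳ x
    rotate (suc m) refl wraps eq = trans (sym (List.applyUpTo-∷ʳ (λ k → lookup p (next i ⊹ k)) m))
      (cong₂ List._∷ʳ_ (List.∷-injectiveʳ eq) (trans (cong (lookup p) wraps) (List.∷-injectiveˡ eq)))

  #↓-cut-next : ∀ i p → #↓ (cut (next i) p) ≡ #↓ (cut i p)
  #↓-cut-next i p = go (cut i p) refl
    where
    go : ∀ w → cut i p ≡ w → #↓ (cut (next i) p) ≡ #↓ (cut i p)
    go []      eq = contradiction (trans (sym (length-cut i p)) (cong length eq)) (ℕ.≢-nonZero⁻¹ n)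
    go (x ∷ w) eq rewrite cut-next i p eq | eq = trans (#↓-++ w [ x ])
      (trans (ℕ.+-comm (#↓ w) _) (sym (#↓-∷ x w)))

  #↓-cut-⊹ : ∀ i k p → #↓ (cut (i ⊹ k) p) ≡ #↓ (cut i p)
  #↓-cut-⊹ i zero    p = refl
  #↓-cut-⊹ i (suc k) p = trans (#↓-cut-⊹ (next i) k p) (#↓-cut-next i p)

∣p∣≡#↓ : ∀ {n} (p : Subset n) (f : ℕ → Letter) → (∀ x → f (toℕ x) ≡ lookup p x) →
  ∣ p ∣ ≡ #↓ (applyUpTo f n)
∣p∣≡#↓ []      f f≗p = refl
∣p∣≡#↓ (x ∷ p) f f≗p rewrite f≗p Fin.zero with x
... | ↑ = ∣p∣≡#↓ p (f ∘ suc) (f≗p ∘ Fin.suc)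
... | ↓ = cong suc (∣p∣≡#↓ p (f ∘ suc) (f≗p ∘ Fin.suc))

module _ {n : ℕ} .{{_ : NonZero n}} where

  #↓-cut : ∀ i (p : Subset n) → #↓ (cut i p) ≡ ∣ p ∣
  #↓-cut i p = sym (trans (∣p∣≡#↓ p (λ k → lookup p (first ⊹ k)) (λ x → cong (lookup p) (from-first x)))
    (let k , _ , eq = reach first i in trans (sym (#↓-cut-⊹ first k p)) (cong (λ j → #↓ (cut j p)) eq)))
    where
    first : Fin n
    first = bar ℤ.1ℤ
    from-first : ∀ x → first ⊹ toℕ x ≡ x
    from-first x = trans (bar-⊹ ℤ.1ℤ (toℕ x)) (bar-⟦⟧ x)

  -- The bound on e excludes the full circle: there the end is followed by the start, and `⟨_,_⟩`
  -- denotes the empty set.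
  ∣∩⟨⟩∣ : ∀ (p : Subset n) a e → suc e < n →
    ∣ p ∩ ⟨ a , a ⊹ e ⟩ ∣ ≡ #↓ (applyUpTo (λ k → lookup p (a ⊹ k)) (suc e))
  ∣∩⟨⟩∣ p a e e<n = begin
    ∣ p ∩ ⟨ a , a ⊹ e ⟩ ∣           ≡⟨ #↓-cut a (p ∩ ⟨ a , a ⊹ e ⟩) ⟨
    #↓ (cut a (p ∩ ⟨ a , a ⊹ e ⟩))  ≡⟨ cong #↓ (applyUpTo-cong n letters) ⟩
    #↓ (applyUpTo (λ k → lookup p (a ⊹ k) ∧ does (k ℕ.<? suc e)) n)
      ≡⟨ cong (λ m → #↓ (applyUpTo (λ k → lookup p (a ⊹ k) ∧ does (k ℕ.<? suc e)) m))
              (sym (ℕ.m+[n∸m]≡n (ℕ.<⇒≤ e<n))) ⟩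
    #↓ (applyUpTo (λ k → lookup p (a ⊹ k) ∧ does (k ℕ.<? suc e)) (suc e ℕ.+ (n ℕ.∸ suc e)))
      ≡⟨ #↓-applyUpTo-∧ (λ k → lookup p (a ⊹ k)) (suc e) (n ℕ.∸ suc e) ⟩
    #↓ (applyUpTo (λ k → lookup p (a ⊹ k)) (suc e)) ∎
    where
    open ≡-Reasoning
    a≢ : a ≢ next (a ⊹ e)
    a≢ eq = ⊹≢ a (s≤s z≤n) e<n (trans (next-⊹ a e) (sym eq))
    letters : ∀ {k} → k < n →
      lookup (p ∩ ⟨ a , a ⊹ e ⟩) (a ⊹ k) ≡ lookup p (a ⊹ k) ∧ does (k ℕ.<? suc e)
    letters {k} k<n = trans (Vec.lookup-zipWith _∧_ (a ⊹ k) p ⟨ a , a ⊹ e ⟩)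
      (cong (lookup p (a ⊹ k) ∧_) inside)
      where
      inside : lookup ⟨ a , a ⊹ e ⟩ (a ⊹ k) ≡ does (k ℕ.<? suc e)
      inside rewrite dec-false (a Fin.≟ next (a ⊹ e)) a≢ =
        trans (Vec.lookup∘tabulate _ (a ⊹ k))
          (trans (cong₂ (λ x y → does (x ℕ.≤? y)) (offset a k<n) (offset a (ℕ.<-trans (ℕ.n<1+n e) e<n)))
                 below)
        where
        below : does (k ℕ.≤? e) ≡ does (k ℕ.<? suc e)
        below = does-⇔ (mk⇔ s≤s ℕ.s≤s⁻¹) (k ℕ.≤? e) (k ℕ.<? suc e)

  ∣∩⟨⟩∣-empty : ∀ (p : Subset n) b → ∣ p ∩ ⟨ next b , b ⟩ ∣ ≡ 0
  ∣∩⟨⟩∣-empty p b rewrite dec-true (next b Fin.≟ next b) refl =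
    trans (cong ∣_∣ (∩-zeroʳ p)) (∣⊥∣≡0 n)

-- Tableaux as words

module _ {n : ℕ} where

  open DecVecMembership (Fin._≟_ {n}) using () renaming (_∈_ to _∈ᵛ_; _∈?_ to _∈ᵛ?_)

  count-++ : ∀ x {k l} (v : Vec (Fin n) k) (w : Vec (Fin n) l) →
    count (x Fin.≟_) (v Vec.++ w) ≡ count (x Fin.≟_) v ℕ.+ count (x Fin.≟_) w
  count-++ x []      w = refl
  count-++ x (y ∷ v) w with does (x Fin.≟ y)
  ... | true  = cong suc (count-++ x v w)
  ... | false = count-++ x v w

  does-∈? : ∀ x {k} (v : Vec (Fin n) k) → does (x ∈ᵛ? v) ≡ does (1 ℕ.≤? count (x Fin.≟_) v)
  does-∈? x []      = refl
  does-∈? x (y ∷ v) with does (x Fin.≟ y)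
  ... | true  = refl
  ... | false = does-∈? x v

  members : ∀ {k} → Vec (Fin n) k → Subset n
  members v = Vec.tabulate λ x → does (x ∈ᵛ? v)

∣tabulate∣-suc : ∀ {n} (f g : Fin n → Bool) y → f y ≡ true → g y ≡ false →
  (∀ x → x ≢ y → f x ≡ g x) → ∣ Vec.tabulate f ∣ ≡ suc ∣ Vec.tabulate g ∣
∣tabulate∣-suc {suc n} f g Fin.zero fy gy f≗g rewrite fy | gy =
  cong (λ p → suc ∣ p ∣) (Vec.tabulate-cong λ x → f≗g (Fin.suc x) λ ())
∣tabulate∣-suc {suc n} f g (Fin.suc y) fy gy f≗g rewrite f≗g Fin.zero (λ ()) with g Fin.zero
... | true  = cong suc (∣tabulate∣-suc (f ∘ Fin.suc) (g ∘ Fin.suc) y fy gy λ x x≢ → f≗g (Fin.suc x)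
    (x≢ ∘ Fin.suc-injective))
... | false = ∣tabulate∣-suc (f ∘ Fin.suc) (g ∘ Fin.suc) y fy gy λ x x≢ → f≗g (Fin.suc x) (x≢ ∘ Fin.suc-injective)

∣tabulate-false∣ : ∀ n → ∣ Vec.tabulate {n = n} (λ _ → false) ∣ ≡ 0
∣tabulate-false∣ zero    = refl
∣tabulate-false∣ (suc n) = ∣tabulate-false∣ n

∣members∣ : ∀ {n k} (v : Vec (Fin n) k) → (∀ x → count (x Fin.≟_) v ≤ 1) → ∣ members v ∣ ≡ k
∣members∣ {n} []  _ = ∣tabulate-false∣ n
∣members∣ (y ∷ v) once = trans
  (∣tabulate∣-suc _ _ y
    (cong (_∨ does (y ∈ᵛ? v)) (dec-true (y Fin.≟ y) refl))
    (trans (does-∈? y v) (dec-false (1 ℕ.≤? _) (ℕ.<⇒≱ (subst (_≤ 1) count-y (once y)))))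
    λ x x≢y → cong (_∨ does (x ∈ᵛ? v)) (dec-false (x Fin.≟ y) x≢y))
  (cong suc (∣members∣ v λ x → ℕ.≤-trans (grow x) (once x)))
  where
  open DecVecMembership Fin._≟_ using () renaming (_∈?_ to _∈ᵛ?_)
  count-y : count (y Fin.≟_) (y ∷ v) ≡ suc (count (y Fin.≟_) v)
  count-y rewrite dec-true (y Fin.≟ y) refl = refl
  grow : ∀ x → count (x Fin.≟_) v ≤ count (x Fin.≟_) (y ∷ v)
  grow x with does (x Fin.≟ y)
  ... | true  = ℕ.n≤1+n _
  ... | false = ℕ.≤-refl

module _ {n : ℕ} where

  open DecVecMembership (Fin._≟_ {n}) using () renaming (_∈_ to _∈ᵛ_; _∈?_ to _∈ᵛ?_)
  open VecAny using (here; there)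

  head< : ∀ {k x} {v : Vec (Fin n) k} → Linked Fin._<_ (x ∷ v) → ∀ {y} → y ∈ᵛ v → x Fin.< y
  head< (x<head ∷ linked) y∈ = VecAll.lookup (Linked.Linked⇒All Fin.<-trans x<head linked) y∈

  linked-tail : ∀ {k x} {v : Vec (Fin n) k} → Linked Fin._<_ (x ∷ v) → Linked Fin._<_ v
  linked-tail [-]          = []
  linked-tail (_ ∷ linked) = linked

  increasing-unique : ∀ {k} (v w : Vec (Fin n) k) → Linked Fin._<_ v → Linked Fin._<_ w →
    (∀ {x} → x ∈ᵛ v → x ∈ᵛ w) → (∀ {x} → x ∈ᵛ w → x ∈ᵛ v) → v ≡ w
  increasing-unique []      []      _  _  _ _ = refl
  increasing-unique (x ∷ v) (y ∷ w) lv lw v⊆w w⊆v with x≡y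
    where
    x≡y : x ≡ y
    x≡y with v⊆w (here refl) | w⊆v (here refl)
    ... | here eq   | _         = eq
    ... | there x∈w | here eq   = sym eq
    ... | there x∈w | there y∈v = contradiction (head< lw x∈w) (Fin.<-asym (head< lv y∈v))
  ... | refl = cong (x ∷_) (increasing-unique v w (linked-tail lv) (linked-tail lw)
    (λ {z} z∈v → tail-member lv z∈v (v⊆w (there z∈v))) (λ {z} z∈w → tail-member lw z∈w (w⊆v (there z∈w))))
    where
    tail-member : ∀ {v w : Vec (Fin n) _} → Linked Fin._<_ (x ∷ v) → ∀ {z} → z ∈ᵛ v → z ∈ᵛ (x ∷ w) → z ∈ᵛ w
    tail-member l z∈v (here refl) = contradiction (head< l z∈v) (Fin.<-irrefl refl)
    tail-member l z∈v (there z∈w) = z∈w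

  lookup-members : ∀ {k} (v : Vec (Fin n) k) x → lookup (members v) x ≡ does (x ∈ᵛ? v)
  lookup-members v x = Vec.lookup∘tabulate _ x

  members⇒⊆ : ∀ {k l} (v : Vec (Fin n) k) (w : Vec (Fin n) l) → members v ≡ members w → ∀ {x} → x ∈ᵛ v → x ∈ᵛ w
  members⇒⊆ v w eq {x} x∈v with x ∈ᵛ? w | trans (sym (lookup-members v x)) (trans (cong (λ p → lookup p x) eq)
      (lookup-members w x))
  ... | yes x∈w | _  = x∈w
  ... | no  _   | eq′ = contradiction (trans (sym (dec-true (x ∈ᵛ? v) x∈v)) eq′) λ ()

  members-injective : ∀ {k} (v w : Vec (Fin n) k) → Linked Fin._<_ v → Linked Fin._<_ w →
    members v ≡ members w → v ≡ w
  members-injective v w lv lw eq =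
    increasing-unique v w lv lw (members⇒⊆ v w eq) (members⇒⊆ w v (sym eq))

elements : ∀ {n} (p : Subset n) → Vec (Fin n) ∣ p ∣
elements []          = []
elements (true ∷ p)  = Fin.zero ∷ Vec.map Fin.suc (elements p)
elements (false ∷ p) = Vec.map Fin.suc (elements p)

elements-increasing : ∀ {n} (p : Subset n) → Linked Fin._<_ (elements p)
elements-increasing []          = []
elements-increasing (false ∷ p) = Linked.map⁺ (Linked.map s≤s (elements-increasing p))
elements-increasing (true ∷ p)  = from-zero (elements p) (elements-increasing p)
  where
  from-zero : ∀ {n k} (v : Vec (Fin n) k) → Linked Fin._<_ v → Linked Fin._<_ (Fin.zero ∷ Vec.map Fin.suc v)
  from-zero []      _      = [-]
  from-zero (x ∷ v) linked = s≤s z≤n ∷ Linked.map⁺ (Linked.map s≤s linked)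

count-elements : ∀ {n} (p : Subset n) x → count (x Fin.≟_) (elements p) ≡ (if lookup p x then 1 else 0)
count-elements (b ∷ p) x = cases b x
  where
  zero∉ : ∀ {n k} (v : Vec (Fin n) k) → count (Fin.zero Fin.≟_) (Vec.map Fin.suc v) ≡ 0
  zero∉ []      = refl
  zero∉ (x ∷ v) = zero∉ v
  count-suc : ∀ {n k} x (v : Vec (Fin n) k) → count (Fin.suc x Fin.≟_) (Vec.map Fin.suc v) ≡ count (x Fin.≟_) v
  count-suc x []      = refl
  count-suc x (y ∷ v) with does (x Fin.≟ y)
  ... | true  = cong suc (count-suc x v)
  ... | false = count-suc x v
  cases : ∀ b x → count (x Fin.≟_) (elements (b ∷ p)) ≡ (if lookup (b ∷ p) x then 1 else 0)
  cases true  Fin.zero    = cong suc (zero∉ (elements p))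
  cases true  (Fin.suc x) = trans (count-suc x (elements p)) (count-elements p x)
  cases false Fin.zero    = zero∉ (elements p)
  cases false (Fin.suc x) = trans (count-suc x (elements p)) (count-elements p x)

members-elements : ∀ {n} (p : Subset n) → members (elements p) ≡ p
members-elements p = trans (Vec.tabulate-cong letter) (Vec.tabulate∘lookup p)
  where
  open DecVecMembership Fin._≟_ using () renaming (_∈?_ to _∈ᵛ?_)
  letter : ∀ x → does (x ∈ᵛ? elements p) ≡ lookup p x
  letter x rewrite does-∈? x (elements p) | count-elements p x with lookup p x
  ... | true  = refl
  ... | false = refl

module _ {n λ₁ λ₂ : ℕ} where

  once : ∀ (s : RSYT n λ₁ λ₂) x → count (x Fin.≟_) (RSYT.row₁ s) ℕ.+ count (x Fin.≟_) (RSYT.row₂ s) ≡ 1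
  once (rsyt row₁ row₂ _ _ eachOnce) x = trans (sym (count-++ x row₁ row₂))
    (recompute (count (x Fin.≟_) (row₁ Vec.++ row₂) ℕ.≟ 1) (eachOnce x))

  lookup-T¹ : ∀ (s : RSYT n λ₁ λ₂) x → lookup (T¹ s) x ≡ not (lookup (T² s) x)
  lookup-T¹ s x = trans (trans (lookup-members row₁ x) (does-∈? x row₁))
    (trans (exactly-one (count (x Fin.≟_) row₁) _ (once s x))
      (cong not (sym (trans (lookup-members row₂ x) (does-∈? x row₂)))))
    where
    open RSYT s using (row₁; row₂)
    exactly-one : ∀ a b → a ℕ.+ b ≡ 1 → does (1 ℕ.≤? a) ≡ not (does (1 ℕ.≤? b))
    exactly-one 0 .1 refl = refl
    exactly-one 1 0  eq   = refl
    exactly-one (suc (suc a)) b ()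

  T¹-determined : ∀ {s t : RSYT n λ₁ λ₂} → T² s ≡ T² t → T¹ s ≡ T¹ t
  T¹-determined {s} {t} eq = trans (sym (Vec.tabulate∘lookup (T¹ s))) (trans (Vec.tabulate-cong λ x →
    trans (lookup-T¹ s x) (trans (cong (λ p → not (lookup p x)) eq) (sym (lookup-T¹ t x))))
    (Vec.tabulate∘lookup (T¹ t)))

  T²-injective : ∀ {s t : RSYT n λ₁ λ₂} → T² s ≡ T² t → s ≡ t
  T²-injective {s@(rsyt v w lv lw _)} {t@(rsyt v′ w′ lv′ lw′ _)} eq
    with members-injective v v′ (increasing lv) (increasing lv′) (T¹-determined {s} {t} eq)
       | members-injective w w′ (increasing lw) (increasing lw′) eq
    where
    increasing : ∀ {k} {v : Vec (Fin n) k} → .(Linked Fin._<_ v) → Linked Fin._<_ v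
    increasing linked = recompute (Linked.linked? Fin._<?_ _) linked
  ... | refl | refl = refl

  ∣T²∣ : ∀ (s : RSYT n λ₁ λ₂) → ∣ T² s ∣ ≡ λ₂
  ∣T²∣ s = ∣members∣ (RSYT.row₂ s) λ x → ℕ.≤-trans (ℕ.m≤n+m _ _) (ℕ.≤-reflexive (once s x))

tableau : ∀ {n λ₁ λ₂} (p : Subset n) → ∣ ∁ p ∣ ≡ λ₁ → ∣ p ∣ ≡ λ₂ → ∃[ s ] T² {n} {λ₁} {λ₂} s ≡ p
tableau p refl refl =
  rsyt (elements (∁ p)) (elements p) (elements-increasing (∁ p)) (elements-increasing p) each
  , members-elements p
  where
  each : ∀ x → count (x Fin.≟_) (elements (∁ p) Vec.++ elements p) ≡ 1
  each x rewrite count-++ x (elements (∁ p)) (elements p) | count-elements (∁ p) x | count-elements p x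
    | Vec.lookup-map x not p with lookup p x
  ... | true  = refl
  ... | false = refl

module _ {n λ₁ λ₂ : ℕ} .{{_ : NonZero n}} where

  opaque
    -- T², kept from unfolding so that tableaux can be inferred from their words.
    bottom : RSYT n λ₁ λ₂ → Subset n
    bottom = T²

    bottom≡T² : ∀ s → bottom s ≡ T² s
    bottom≡T² s = refl

  letter : RSYT n λ₁ λ₂ → Fin n → Letter
  letter s x = lookup (bottom s) x

  word : Fin n → RSYT n λ₁ λ₂ → Word
  word i s = cut i (bottom s)

  length-word : ∀ i s → length (word i s) ≡ n
  length-word i s = length-cut i (bottom s)

  #↓-word : ∀ i s → #↓ (word i s) ≡ λ₂
  #↓-word i s = trans (#↓-cut i (bottom s)) (trans (cong ∣_∣ (bottom≡T² s)) (∣T²∣ s))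

  word-injective : ∀ i {s t} → word i s ≡ word i t → s ≡ t
  word-injective i {s} {t} eq =
    T²-injective (trans (sym (bottom≡T² s)) (trans (cut-injective i eq) (bottom≡T² t)))

  -- Rows are sorted sets, so a tableau amounts to a bottom row of the right size. Words may thus be
  -- altered freely while their length and number of ↓ are kept.
  realise : λ₁ ℕ.+ λ₂ ≡ n → ∀ i w → length w ≡ n → #↓ w ≡ λ₂ → ∃[ s ] word i s ≡ w
  realise λ₁+λ₂≡n i w ∣w∣≡n #w with cut-surjective i w ∣w∣≡n
  ... | p , refl with tableau {λ₁ = λ₁} {λ₂} p
        (trans (∣∁p∣≡n∸∣p∣ p) (trans (cong (n ℕ.∸_) ∣p∣≡λ₂)
          (trans (cong (ℕ._∸ λ₂) (sym λ₁+λ₂≡n)) (ℕ.m+n∸n≡m λ₁ λ₂)))) ∣p∣≡λ₂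
    where
    ∣p∣≡λ₂ : ∣ p ∣ ≡ λ₂
    ∣p∣≡λ₂ = trans (sym (#↓-cut i p)) #w
  ...   | s , eq = s , cong (cut i) (trans (bottom≡T² s) eq)

  opaque
    unfolding bottom

    ∈T²⇒↓ : ∀ s {x} → x ∈ T² s → letter s x ≡ ↓
    ∈T²⇒↓ s = Vec.[]=⇒lookup

    ↓⇒∈T² : ∀ s {x} → letter s x ≡ ↓ → x ∈ T² s
    ↓⇒∈T² s = Vec.lookup⇒[]= _ (T² s)

    ∈T¹⇒↑ : ∀ s {x} → x ∈ T¹ s → letter s x ≡ ↑
    ∈T¹⇒↑ s {x} x∈ = Bool.not-injective (trans (sym (lookup-T¹ s x)) (Vec.[]=⇒lookup x∈))

    ↑⇒∈T¹ : ∀ s {x} → letter s x ≡ ↑ → x ∈ T¹ s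
    ↑⇒∈T¹ s {x} eq = Vec.lookup⇒[]= x (T¹ s) (trans (lookup-T¹ s x) (cong not eq))

    ∈des⁻ : ∀ s {i} → i ∈ des s → letter s i ≡ ↑ × letter s (next i) ≡ ↓
    ∈des⁻ s {i} i∈ with i ∈? T¹ s | next i ∈? T² s | trans (sym (Vec.lookup∘tabulate _ i)) (Vec.[]=⇒lookup i∈)
    ... | yes p | yes p′ | _  = ∈T¹⇒↑ s p , ∈T²⇒↓ s p′
    ... | yes _ | no  _  | ()
    ... | no  _ | _      | ()

    ∈des⁺ : ∀ s {i} → letter s i ≡ ↑ → letter s (next i) ≡ ↓ → i ∈ des s
    ∈des⁺ s {i} eq eq′ = Vec.lookup⇒[]= i (des s) (trans (Vec.lookup∘tabulate _ i)
      (cong₂ _∧_ (dec-true (i ∈? T¹ s) (↑⇒∈T¹ s eq)) (dec-true (next i ∈? T² s) (↓⇒∈T² s eq′))))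

    lookup-exchange : ∀ (x y : Fin n) p z → lookup (exchange x y p) z ≡ lookup p (transpose x y z)
    lookup-exchange x y p z = Vec.lookup∘tabulate _ z

    interchange⁻ : ∀ {x y} {s t : RSYT n λ₁ λ₂} → Interchange x y s t → ∀ z → letter t z ≡ letter s (transpose x y z)
    interchange⁻ {x} {y} {s} (_ , eq) z = trans (cong (λ p → lookup p z) eq) (lookup-exchange x y (T² s) z)

    interchange⁺ : ∀ {x y} {s t : RSYT n λ₁ λ₂} → (∀ z → letter t z ≡ letter s (transpose x y z)) → Interchange x y s t
    interchange⁺ {x} {y} {s} {t} eq =
      pointwise (T¹ s) (T¹ t) (λ z → trans (lookup-T¹ t z) (trans (cong not (eq z)) (sym (lookup-T¹ s
          (transpose x y z))))) ,
      pointwise (T² s) (T² t) eq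
      where
      pointwise : ∀ (p p′ : Subset n) → (∀ z → lookup p′ z ≡ lookup p (transpose x y z)) → p′ ≡ exchange x y p
      pointwise p p′ eq = trans (sym (Vec.tabulate∘lookup p′)) (Vec.tabulate-cong eq)

transpose-first : ∀ {n} (x y : Fin n) → transpose x y x ≡ y
transpose-first x y rewrite dec-true (x Fin.≟ x) refl = refl

transpose-second : ∀ {n} (x y : Fin n) → transpose x y y ≡ x
transpose-second x y with y Fin.≟ x
... | yes refl = refl
... | no  _ rewrite dec-true (y Fin.≟ y) refl = refl

transpose-other : ∀ {n} {x y z : Fin n} → z ≢ x → z ≢ y → transpose x y z ≡ z
transpose-other {x = x} {y} {z} z≢x z≢y
  rewrite dec-false (z Fin.≟ x) z≢x | dec-false (z Fin.≟ y) z≢y = refl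

-- Parentheses

private variable
  d : ℕ
  x x′ y z z′ : Letter
  w w′ γ γ′ β β′ : Word

-- Balanced d w: the word w closes d parentheses opened before it, and all of its own.
data Balanced : ℕ → Word → Set where
  []   : Balanced 0 []
  up   : Balanced (suc d) w → Balanced d (↑ ∷ w)
  down : Balanced d w → Balanced (suc d) (↓ ∷ w)

-- Opens d w w′: the first ↓ of w closing none of w's own parentheses nor the d opened before
-- it becomes ↑.
data Opens : ℕ → Word → Word → Set where
  stop : Opens 0 (↓ ∷ w) (↑ ∷ w)
  up   : Opens (suc d) w w′ → Opens d (↑ ∷ w) (↑ ∷ w′)
  down : Opens d w w′ → Opens (suc d) (↓ ∷ w) (↓ ∷ w′)

-- What follows the altered ↑ is balanced, so around the cycle this ↑ is the partner of the first
-- letter of `↓ ∷ ↓ ∷ w`.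
data Closes : Word → Word → Set where
  here  : Balanced 0 w → Closes (↑ ∷ w) (↓ ∷ w)
  there : Closes w w′ → Closes (x ∷ w) (x ∷ w′)

-- Caps u v: the word u arises from v by forming a cup at the first two positions
-- and joining their former partners.
data Caps : Word → Word → Set where
  swap  : Caps (↑ ∷ ↓ ∷ w) (↓ ∷ ↑ ∷ w)
  opening : Opens 0 w w′ → Caps (↑ ∷ ↓ ∷ w′) (↑ ∷ ↑ ∷ w)
  closing : Closes w w′ → Caps (↑ ∷ ↓ ∷ w′) (↓ ∷ ↓ ∷ w)

-- A cup moves past a letter, at the same place of two words.
data Slide : Word → Word → Word → Word → Set where
  here  : Slide (↑ ∷ ↓ ∷ z ∷ β) (↑ ∷ ↓ ∷ z′ ∷ β′) (z ∷ ↑ ∷ ↓ ∷ β) (z′ ∷ ↑ ∷ ↓ ∷ β′)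
  there : Slide w w′ γ γ′ → Slide (x ∷ w) (x′ ∷ w′) (x ∷ γ) (x′ ∷ γ′)

-- Behind the letter altered by `Opens` or before which `Closes` acts, the two words may have to be
-- compared as a whole; common tails stay common under a slide.
slide-≡ : Slide w w′ γ γ′ → w ≡ w′ → γ ≡ γ′
slide-≡ here      refl = refl
slide-≡ (there s) refl = cong (_ ∷_) (slide-≡ s refl)

slide-≡⁻ : Slide w w′ γ γ′ → γ ≡ γ′ → w ≡ w′
slide-≡⁻ here      refl = refl
slide-≡⁻ (there s) refl = cong (_ ∷_) (slide-≡⁻ s refl)

-- A cup is matched within itself and is invisible to the matching of all other letters, so moving
-- it past one of them changes no other partner. The same holds for `Balanced` and `Closes`.
opens-slide : Slide w w′ γ γ′ → Opens d w w′ → Opens d γ γ′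
opens-slide here      (up (down stop))     = stop
opens-slide here      (up (down (up o)))   = up (up (down o))
opens-slide here      (up (down (down o))) = down (up (down o))
opens-slide (there s) stop                 = subst (Opens 0 _) (cong (↑ ∷_) (slide-≡ s refl)) stop
opens-slide (there s) (up o)               = up (opens-slide s o)
opens-slide (there s) (down o)             = down (opens-slide s o)

opens-slide⁻ : Slide w w′ γ γ′ → Opens d γ γ′ → Opens d w w′
opens-slide⁻ here      stop               = up (down stop)
opens-slide⁻ here      (up (up (down o))) = up (down (up o))
opens-slide⁻ here      (down (up (down o))) = up (down (down o))
opens-slide⁻ (there s) stop               = subst (Opens 0 _) (cong (↑ ∷_) (slide-≡⁻ s refl)) stop
opens-slide⁻ (there s) (up o)             = up (opens-slide⁻ s o)
opens-slide⁻ (there s) (down o)           = down (opens-slide⁻ s o)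

balanced-slide : Slide w w′ γ γ′ → Balanced d w → Balanced d γ
balanced-slide here      (up (down (up b)))   = up (up (down b))
balanced-slide here      (up (down (down b))) = down (up (down b))
balanced-slide (there s) (up b)               = up (balanced-slide s b)
balanced-slide (there s) (down b)             = down (balanced-slide s b)

balanced-slide⁻ : Slide w w′ γ γ′ → Balanced d γ → Balanced d w
balanced-slide⁻ here      (up (up (down b)))   = up (down (up b))
balanced-slide⁻ here      (down (up (down b))) = up (down (down b))
balanced-slide⁻ (there s) (up b)               = up (balanced-slide⁻ s b)
balanced-slide⁻ (there s) (down b)             = down (balanced-slide⁻ s b)

closes-slide : Slide w w′ γ γ′ → Closes w w′ → Closes γ γ′
closes-slide here      (there (there (here b)))  = here (up (down b))
closes-slide here      (there (there (there c))) = there (there (there c))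
closes-slide (there s) (here b) = subst (Closes _) (cong (↓ ∷_) (slide-≡ s refl)) (here (balanced-slide s b))
closes-slide (there s) (there c)                 = there (closes-slide s c)

closes-slide⁻ : Slide w w′ γ γ′ → Closes γ γ′ → Closes w w′
closes-slide⁻ here      (here (up (down b)))      = there (there (here b))
closes-slide⁻ here      (there (there (there c))) = there (there (there c))
closes-slide⁻ (there s) (here b) = subst (Closes _) (cong (↓ ∷_) (slide-≡⁻ s refl)) (here (balanced-slide⁻ s b))
closes-slide⁻ (there s) (there c)                 = there (closes-slide⁻ s c)

caps-slide : Slide w w′ γ γ′ → Caps (↑ ∷ ↓ ∷ w′) (x ∷ y ∷ w) → Caps (↑ ∷ ↓ ∷ γ′) (x ∷ y ∷ γ)
caps-slide s swap      = subst (Caps _) (cong (λ w → ↓ ∷ ↑ ∷ w) (sym (slide-≡ s refl))) swap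
caps-slide s (opening o) = opening (opens-slide s o)
caps-slide s (closing c) = closing (closes-slide s c)

caps-slide⁻ : Slide w w′ γ γ′ → Caps (↑ ∷ ↓ ∷ γ′) (x ∷ y ∷ γ) → Caps (↑ ∷ ↓ ∷ w′) (x ∷ y ∷ w)
caps-slide⁻ s swap      = subst (Caps _) (cong (λ w → ↓ ∷ ↑ ∷ w) (sym (slide-≡⁻ s refl))) swap
caps-slide⁻ s (opening o) = opening (opens-slide⁻ s o)
caps-slide⁻ s (closing c) = closing (closes-slide⁻ s c)

slide : ∀ α α′ {z z′ β β′} → length α ≡ length α′ →
  Slide (α ++ ↑ ∷ ↓ ∷ z ∷ β) (α′ ++ ↑ ∷ ↓ ∷ z′ ∷ β′) (α ++ z ∷ ↑ ∷ ↓ ∷ β) (α′ ++ z′ ∷ ↑ ∷ ↓ ∷ β′)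
slide []      []       _  = here
slide (_ ∷ α) (_ ∷ α′) eq = there (slide α α′ (ℕ.suc-injective eq))

Cup : Letter → Letter → Set
Cup x y = x ≡ ↑ × y ≡ ↓

cup? : ∀ x y → Dec (Cup x y)
cup? ↑ ↓ = yes (refl , refl)
cup? ↑ ↑ = no λ ()
cup? ↓ _ = no λ ()

-- With w taken from v and w′ from u, the place is a descent of v but not of u: the situation in
-- which `compatible` forces the weight to vanish.
data Missing : Word → Word → Set where
  here  : ¬ Cup x y → Missing (↑ ∷ ↓ ∷ w) (x ∷ y ∷ w′)
  there : Missing w w′ → Missing (x ∷ w) (x′ ∷ w′)

missing-irrefl : w ≡ w′ → ¬ Missing w w′
missing-irrefl refl (here ¬cup) = ¬cup (refl , refl)
missing-irrefl refl (there m)   = missing-irrefl refl m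

missing⇒¬opens : Missing w w′ → ¬ Opens d w w′
missing⇒¬opens (here ¬cup) (up (down _)) = ¬cup (refl , refl)
missing⇒¬opens (there m)   stop          = missing-irrefl refl m
missing⇒¬opens (there m)   (up o)        = missing⇒¬opens m o
missing⇒¬opens (there m)   (down o)      = missing⇒¬opens m o

missing⇒¬closes : Missing w w′ → ¬ Closes w w′
missing⇒¬closes (here ¬cup) (there (there _)) = ¬cup (refl , refl)
missing⇒¬closes (here ¬cup) (here ())
missing⇒¬closes (there m)   (here _)          = missing-irrefl refl m
missing⇒¬closes (there m)   (there c)         = missing⇒¬closes m c

-- The rule alters at most one letter behind the first two, and that letter has no partner within w,
-- so every cup of w survives in w′.
missing⇒¬caps : Missing w w′ → ¬ Caps (↑ ∷ ↓ ∷ w′) (x ∷ y ∷ w)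
missing⇒¬caps m swap      = missing-irrefl refl m
missing⇒¬caps m (opening o) = missing⇒¬opens m o
missing⇒¬caps m (closing c) = missing⇒¬closes m c

missing : ∀ α α′ {x y β β′} → length α ≡ length α′ → ¬ Cup x y →
  Missing (α ++ ↑ ∷ ↓ ∷ β) (α′ ++ x ∷ y ∷ β′)
missing []      []       _  ¬cup = here ¬cup
missing (_ ∷ α) (_ ∷ α′) eq ¬cup = there (missing α α′ (ℕ.suc-injective eq) ¬cup)

-- When v has a cup at i + 1, the only word the rule produces is v with this cup slid one step to
-- the left, that is, a Knuth neighbour.
caps-right : Caps (↑ ∷ ↓ ∷ w′) (z ∷ ↑ ∷ ↓ ∷ w) → w′ ≡ z ∷ w
caps-right swap         = refl
caps-right (opening stop) = refl

caps-right⁺ : ∀ z → Caps (↑ ∷ ↓ ∷ z ∷ w) (z ∷ ↑ ∷ ↓ ∷ w)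
caps-right⁺ ↑ = opening stop
caps-right⁺ ↓ = swap

balanced-∷ʳ↑ : ∀ w → ¬ Balanced d (w ∷ʳ ↑)
balanced-∷ʳ↑ []      (up ())
balanced-∷ʳ↑ (↑ ∷ w) (up b)   = balanced-∷ʳ↑ w b
balanced-∷ʳ↑ (↓ ∷ w) (down b) = balanced-∷ʳ↑ w b

closes-∷ʳ : ∀ w → Closes (w ∷ʳ ↑) w′ → w′ ≡ w ∷ʳ ↓
closes-∷ʳ []      (here b)  = refl
closes-∷ʳ []      (there ())
closes-∷ʳ (x ∷ w) (here b)  = contradiction b (balanced-∷ʳ↑ w)
closes-∷ʳ (x ∷ w) (there c) = cong (x ∷_) (closes-∷ʳ w c)

closes-∷ʳ⁺ : ∀ w → Closes (w ∷ʳ ↑) (w ∷ʳ ↓)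
closes-∷ʳ⁺ []      = here []
closes-∷ʳ⁺ (x ∷ w) = there (closes-∷ʳ⁺ w)

-- The counterpart for the cup straddling the cut: its ↑ is the last letter and its ↓ the first, and
-- it slides one step to the right.
caps-left : ∀ y w → Caps (↑ ∷ ↓ ∷ w′) (↓ ∷ y ∷ (w ∷ʳ ↑)) → w′ ≡ w ∷ʳ y
caps-left ↑ w swap      = refl
caps-left ↓ w (closing c) = closes-∷ʳ w c

caps-left⁺ : ∀ y w → Caps (↑ ∷ ↓ ∷ (w ∷ʳ y)) (↓ ∷ y ∷ (w ∷ʳ ↑))
caps-left⁺ ↑ w = swap
caps-left⁺ ↓ w = closing (closes-∷ʳ⁺ w)

cups : ℕ → Word → Word
cups zero    w = w
cups (suc k) w = ↑ ∷ ↓ ∷ cups k w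

cups-↑↓ : ∀ k w → cups k (↑ ∷ ↓ ∷ w) ≡ ↑ ∷ ↓ ∷ cups k w
cups-↑↓ zero    w = refl
cups-↑↓ (suc k) w = cong (λ w → ↑ ∷ ↓ ∷ w) (cups-↑↓ k w)

-- Each cup uses up one ↓, so w′ cannot have cups at all k places.
few-cups : ∀ k w′ {w} → length w′ ≡ length (cups k w) → #↓ w′ < k →
  ∃[ α ] ∃[ β ] ∃[ α′ ] ∃[ x ] ∃[ y ] ∃[ β′ ]
  cups k w ≡ α ++ ↑ ∷ ↓ ∷ β × w′ ≡ α′ ++ x ∷ y ∷ β′ × length α ≡ length α′ × ¬ Cup x y
few-cups (suc k) (x ∷ y ∷ w′) eq #w′<k with cup? x y
... | no ¬cup = [] , _ , [] , x , y , w′ , refl , refl , refl , ¬cup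
... | yes (refl , refl) with few-cups k w′ (ℕ.suc-injective (ℕ.suc-injective eq)) (ℕ.s≤s⁻¹ #w′<k)
...   | α , β , α′ , x , y , β′ , refl′ , refl , lengths , ¬cup =
  ↑ ∷ ↓ ∷ α , β , ↑ ∷ ↓ ∷ α′ , x , y , β′ , cong (λ w → ↑ ∷ ↓ ∷ w) refl′ , refl , cong (suc ∘ suc) lengths , ¬cup

splitLike : ∀ (α : Word) {β : Word} (w : Word) → length w ≡ length (α ++ β) →
  ∃[ α′ ] ∃[ β′ ] w ≡ α′ ++ β′ × length α ≡ length α′ × length β′ ≡ length β
splitLike []      w       eq = [] , w , refl , refl , eq
splitLike (_ ∷ α) (x ∷ w) eq with splitLike α w (ℕ.suc-injective eq)
... | α′ , β′ , refl , eq₁ , eq₂ = x ∷ α′ , β′ , refl , cong suc eq₁ , eq₂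

-- Interchanges and Knuth moves read on words

module _ {A : Set} where

  applyUpTo-swap : ∀ {f g : ℕ → A} m D {a b R} → applyUpTo f m ≡ a ∷ D ++ b ∷ R →
    g 0 ≡ b → g (suc (length D)) ≡ a → (∀ {k} → k < m → k ≢ 0 → k ≢ suc (length D) → g k ≡ f k) →
    applyUpTo g m ≡ b ∷ D ++ a ∷ R
  applyUpTo-swap (suc m) D eq g0 gD g≗f = cong₂ _∷_ g0
    (trans (applyUpTo-replace m D (List.∷-injectiveʳ eq)
      (λ k<m k≢ → g≗f (s≤s k<m) (λ ()) (k≢ ∘ ℕ.suc-injective))) (cong (λ x → D ++ x ∷ _) gD))

  applyUpTo-swapped : ∀ {f g : ℕ → A} m D {a b R} → applyUpTo f m ≡ a ∷ D ++ b ∷ R →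
    applyUpTo g m ≡ b ∷ D ++ a ∷ R → ∀ {k} → k < m → k ≢ 0 → k ≢ suc (length D) → g k ≡ f k
  applyUpTo-swapped (suc m) D eq eq′ {zero}  _         k≢0 _  = contradiction refl k≢0
  applyUpTo-swapped (suc m) D eq eq′ {suc k} (s≤s k<m) _   k≢ =
    applyUpTo-agree m D (List.∷-injectiveʳ eq′) (List.∷-injectiveʳ eq) k<m (k≢ ∘ cong suc)

length-++-∷ : ∀ (α : Word) x β → length α < length (α ++ x ∷ β)
length-++-∷ []      x β = s≤s z≤n
length-++-∷ (_ ∷ α) x β = s≤s (length-++-∷ α x β)

module _ {n λ₁ λ₂ : ℕ} .{{_ : NonZero n}} where

  private variable
    s t u v : RSYT n λ₁ λ₂

  letter-at : ∀ i (s : RSYT n λ₁ λ₂) α {x β} → word i s ≡ α ++ x ∷ β → letter s (i ⊹ length α) ≡ x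
  letter-at i s α eq = applyUpTo-at n α eq

  position<n : ∀ i (s : RSYT n λ₁ λ₂) (α : Word) {x β} → word i s ≡ α ++ x ∷ β → length α < n
  position<n i s α {x} {β} eq = subst (length α <_) (trans (cong length (sym eq)) (length-word i s)) (length-++-∷ α x β)

  interchange-word⁺ : ∀ i D {a b R} → word i s ≡ a ∷ D ++ b ∷ R → word i t ≡ b ∷ D ++ a ∷ R →
    Interchange i (i ⊹ suc (length D)) s t
  interchange-word⁺ {s = s} {t} i D {a} {b} eq eq′ = interchange⁺ {s = s} {t} letters
    where
    letters : ∀ z → letter t z ≡ letter s (transpose i (i ⊹ suc (length D)) z)
    letters z with k , k<n , refl ← reach i z with k ℕ.≟ 0 | k ℕ.≟ suc (length D)
    ... | yes refl | _ = trans (letter-at i t [] eq′)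
      (trans (sym (letter-at i s (a ∷ D) eq)) (cong (letter s) (sym (transpose-first i (i ⊹ suc (length D))))))
    ... | no _ | yes refl = trans (letter-at i t (b ∷ D) eq′)
      (trans (sym (letter-at i s [] eq)) (cong (letter s) (sym (transpose-second i (i ⊹ suc (length D))))))
    ... | no k≢0 | no k≢ = trans (applyUpTo-swapped n D eq eq′ k<n k≢0 k≢)
      (cong (letter s) (sym (transpose-other
        (λ p → k≢0 (⊹-injectiveʳ i k<n (ℕ.≤-<-trans z≤n k<n) p))
        (λ p → k≢ (⊹-injectiveʳ i k<n (position<n i s (a ∷ D) eq) p)))))

  interchange-word⁻ : ∀ i D {a b R} → Interchange i (i ⊹ suc (length D)) s t →
    word i s ≡ a ∷ D ++ b ∷ R → word i t ≡ b ∷ D ++ a ∷ R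
  interchange-word⁻ {s = s} {t} i D {a} {b} swapped eq = applyUpTo-swap n D eq
    (trans (swaps i) (trans (cong (letter s) (transpose-first i (i ⊹ suc (length D)))) (letter-at i s (a ∷ D) eq)))
    (trans (swaps (i ⊹ suc (length D))) (trans (cong (letter s) (transpose-second i (i ⊹ suc (length D))))
        (letter-at i s [] eq)))
    λ {k} k<n k≢0 k≢ → trans (swaps (i ⊹ k)) (cong (letter s) (transpose-other
        (λ p → k≢0 (⊹-injectiveʳ i k<n (ℕ.≤-<-trans z≤n k<n) p))
        (λ p → k≢ (⊹-injectiveʳ i k<n (position<n i s (a ∷ D) eq) p))))
    where
    swaps : ∀ z → letter t z ≡ letter s (transpose i (i ⊹ suc (length D)) z)
    swaps = interchange⁻ {s = s} {t} swapped

  word-⊹ : ∀ i (s : RSYT n λ₁ λ₂) α {β} → word i s ≡ α ++ β → word (i ⊹ length α) s ≡ β ++ α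
  word-⊹ i s []      {β} eq = trans eq (sym (List.++-identityʳ β))
  word-⊹ i s (x ∷ α) {β} eq = trans (word-⊹ (next i) s α
      (trans (cut-next i (bottom s) eq) (List.++-assoc α β [ x ])))
    (List.++-assoc β [ x ] α)

  des-word⁺ : ∀ i (s : RSYT n λ₁ λ₂) {w} → word i s ≡ ↑ ∷ ↓ ∷ w → i ∈ des s
  des-word⁺ i s eq = ∈des⁺ s (letter-at i s [] eq) (letter-at i s [ ↑ ] eq)

  des-word⁻ : ∀ i (s : RSYT n λ₁ λ₂) {x y w} → word i s ≡ x ∷ y ∷ w → i ∈ des s → Cup x y
  des-word⁻ i s eq i∈ with ∈des⁻ s i∈
  ... | eq₁ , eq₂ = trans (sym (letter-at i s [] eq)) eq₁ , trans (sym (letter-at i s [ _ ] eq)) eq₂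

  des-exclusive : ∀ (s : RSYT n λ₁ λ₂) {i} → i ∈ des s → next i ∉ des s
  des-exclusive s i∈ i′∈ with trans (sym (proj₂ (∈des⁻ s i∈))) (proj₁ (∈des⁻ s i′∈))
  ... | ()

  slide-des : ∀ i {t : RSYT n λ₁ λ₂} {z w} → word i t ≡ z ∷ ↑ ∷ ↓ ∷ w → next i ∈ des t
  slide-des i {t} {z} eq = des-word⁺ (next i) t (cut-next i (bottom t) eq)

  -- Sliding past ↓ interchanges i and i + 1; sliding past ↑ interchanges i + 1 and i + 2. The
  -- descent sets are incomparable since neighbouring descents exclude each other.
  slide-knuth : ∀ i {z w} → word i s ≡ ↑ ∷ ↓ ∷ z ∷ w → word i t ≡ z ∷ ↑ ∷ ↓ ∷ w → KnuthMove s t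
  slide-knuth {s = s} {t} i {z} eq eq′ = (s⊈t , t⊈s) , move z eq eq′
    where
    s⊈t : des s ⊈ des t
    s⊈t s⊆t = des-exclusive t (s⊆t (des-word⁺ i s eq)) (slide-des i {t} eq′)
    t⊈s : des t ⊈ des s
    t⊈s t⊆s = des-exclusive s (des-word⁺ i s eq) (t⊆s (slide-des i {t} eq′))
    move : ∀ z {w : Word} → word i s ≡ ↑ ∷ ↓ ∷ z ∷ w → word i t ≡ z ∷ ↑ ∷ ↓ ∷ w → ∃[ j ] Interchange j (next j) s t
    move ↓ eq eq′ = i , interchange-word⁺ {s = s} {t = t} i [] eq eq′
    move ↑ eq eq′ = next i ,
      interchange-word⁺ {s = s} {t = t} (next i) [] (cut-next i (bottom s) eq) (cut-next i (bottom t) eq′)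

module _ {n : ℕ} .{{_ : NonZero n}} where

  open CoxeterMatrix (affineSymmetric n) using () renaming (M to bond)

  bond≡2 : ∀ {i j} → i ≢ j → j ≢ next i → i ≢ next j → bond i j ≡ 2
  bond≡2 {i} {j} i≢j j≢ i≢
    rewrite dec-false (i Fin.≟ j) i≢j | dec-false (j Fin.≟ next i) j≢ | dec-false (i Fin.≟ next j) i≢ = refl

  bond≡3 : ∀ i → i ≢ next i → bond i (next i) ≡ 3
  bond≡3 i i≢ rewrite dec-false (i Fin.≟ next i) i≢ | dec-true (next i Fin.≟ next i) refl = refl

  bond-far : ∀ i o → 1 < o → suc o < n → bond i (i ⊹ o) ≡ 2
  bond-far i o 1<o o<n = bond≡2
    (⊹≢ i (ℕ.<-trans ℕ.0<1+n 1<o) (ℕ.<-trans (ℕ.n<1+n o) o<n) ∘ sym)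
    (λ eq → ⊹-distinct i 1<o (ℕ.<-trans (ℕ.n<1+n o) o<n) eq)
    (λ eq → ⊹≢ i ℕ.0<1+n o<n (trans (next-⊹ i o) (sym eq)))

-- Both values are recorded, so that slides transport the answer in either case without a decision
-- procedure for A.
Decides : Set → ℕ → Set
Decides A k = (A → k ≡ 1) × (¬ A → k ≡ 0)

decides-⇔ : ∀ {A B : Set} {k l} → (A → B) → (B → A) → k ≡ l → Decides B l → Decides A k
decides-⇔ f g refl (yes′ , no′) = yes′ ∘ f , λ ¬a → no′ (¬a ∘ g)

decides-false : ∀ {A : Set} {k} → ¬ A → k ≡ 0 → Decides A k
decides-false ¬a k≡0 = (λ a → contradiction a ¬a) , λ _ → k≡0

-- Weights from slides

module _ {n λ₁ λ₂ : ℕ} .{{_ : NonZero n}} where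

  open CoxeterMatrix (affineSymmetric n) using () renaming (M to bond)

  -- All that the combinatorics needs to know of Γ, with its vertices already replaced by tableaux
  -- and the Hecke algebra gone.
  record Laws (M : RSYT n λ₁ λ₂ → RSYT n λ₁ λ₂ → ℕ) : Set where
    field
      knuth : ∀ {s t} → KnuthMove s t → M s t ≡ 1 × M t s ≡ 1
      compatible : ∀ u v {i j} → bond i j ≡ 2 →
        i ∈ des u → i ∉ des v → j ∉ des u → j ∈ des v → M u v ≡ 0
      bonded-unique : ∀ u u₁ s {i j} → bond i j ≡ 3 → (∀ (s : RSYT n λ₁ λ₂) → i ∈ des s → j ∉ des s) →
        i ∈ des u → j ∈ des u₁ → M u u₁ ≡ 1 → M u₁ u ≡ 1 → j ∈ des s → u₁ ≢ s → M u s ≡ 0 × M s u ≡ 0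
      transfer : ∀ u u₁ v v₁ {i j k} → bond i j ≡ 2 → bond i k ≡ 2 → bond j k ≡ 3 →
        (∀ (s : RSYT n λ₁ λ₂) → j ∈ des s → k ∉ des s) →
        j ∈ des u → k ∈ des u₁ → M u u₁ ≡ 1 → M u₁ u ≡ 1 →
        j ∈ des v → k ∈ des v₁ → M v v₁ ≡ 1 → M v₁ v ≡ 1 →
        i ∈ des u → i ∈ des u₁ → i ∉ des v → i ∉ des v₁ → M u v ≡ M u₁ v₁

module Determination {n λ₁ λ₂ : ℕ} .{{_ : NonZero n}}
  (3≤n : 3 ≤ n) (λ₁+λ₂≡n : λ₁ ℕ.+ λ₂ ≡ n) (λ₂<λ₁ : λ₂ < λ₁)
  {M : RSYT n λ₁ λ₂ → RSYT n λ₁ λ₂ → ℕ} (laws : Laws M) (i : Fin n) where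

  open CoxeterMatrix (affineSymmetric n) using () renaming (M to bond; symmetric to bond-symmetric)
  open Laws laws

  private variable
    u u₁ v v₁ : RSYT n λ₁ λ₂

  room : ∀ (s : RSYT n λ₁ λ₂) (α : Word) k β → word i s ≡ α ++ β → k < length β → k ℕ.+ length α < n
  room s α k β eq k< = ℕ.≤-trans (ℕ.+-monoˡ-≤ (length α) k<) (ℕ.≤-reflexive (begin
    length β ℕ.+ length α ≡⟨ ℕ.+-comm (length β) (length α) ⟩
    length α ℕ.+ length β ≡⟨ List.length-++ α ⟨
    length (α ++ β)       ≡⟨ cong length eq ⟨
    length (word i s)     ≡⟨ length-word i s ⟩
    n                     ∎))
    where open ≡-Reasoning

  word-at : ∀ (s : RSYT n λ₁ λ₂) (α α′ : Word) {β} → length α ≡ length α′ → word i s ≡ α′ ++ β →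
    word (i ⊹ length α) s ≡ β ++ α′
  word-at s α α′ lengths eq rewrite lengths = word-⊹ i s α′ eq

  1<n : 1 < n
  1<n = ℕ.<-trans (ℕ.n<1+n 1) 3≤n

  next≢ : ∀ (j : Fin n) → j ≢ next j
  next≢ j eq = ⊹≢ j (s≤s z≤n) 1<n (sym eq)

  compatible-word : ∀ (α α′ : Word) {p q x y β β′} → length α ≡ length α′ → ¬ Cup p q → ¬ Cup x y →
    word i u ≡ ↑ ∷ ↓ ∷ α′ ++ p ∷ q ∷ β′ → word i v ≡ x ∷ y ∷ α ++ ↑ ∷ ↓ ∷ β → M u v ≡ 0
  compatible-word {u} {v} α α′ {p} {q} {x} {y} {β} lengths ¬pq ¬xy eqᵤ eqᵥ = compatible u v
    (bond-far i (2 ℕ.+ length α) (s≤s (s≤s z≤n)) (room v (x ∷ y ∷ α) 1 (↑ ∷ ↓ ∷ β) eqᵥ (s≤s (s≤s z≤n))))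
    (des-word⁺ i u eqᵤ)
    (¬xy ∘ des-word⁻ i v eqᵥ)
    (¬pq ∘ des-word⁻ _ u (word-at u (x ∷ y ∷ α) (↑ ∷ ↓ ∷ α′) (cong (suc ∘ suc) lengths) eqᵤ))
    (des-word⁺ _ v (word-⊹ i v (x ∷ y ∷ α) eqᵥ))

  -- The bonded pair is the place j of the cup before the slide and j + 1 after it. Both must
  -- commute with i; for j + 1 it is the letter z behind the cup that keeps it away from i around
  -- the cycle.
  transfer-word : ∀ (α α′ : Word) {x y z z′ β β′} → length α ≡ length α′ → ¬ Cup x y →
    word i u ≡ ↑ ∷ ↓ ∷ α′ ++ ↑ ∷ ↓ ∷ z′ ∷ β′ → word i v ≡ x ∷ y ∷ α ++ ↑ ∷ ↓ ∷ z ∷ β →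
    word i u₁ ≡ ↑ ∷ ↓ ∷ α′ ++ z′ ∷ ↑ ∷ ↓ ∷ β′ → word i v₁ ≡ x ∷ y ∷ α ++ z ∷ ↑ ∷ ↓ ∷ β →
    M u v ≡ M u₁ v₁
  transfer-word {u} {v} {u₁} {v₁} α α′ {x} {y} {z} {z′} {β} {β′} lengths ¬xy eqᵤ eqᵥ eqᵤ₁ eqᵥ₁ = transfer u u₁ v v₁
    (bond-far i o (s≤s (s≤s z≤n)) (ℕ.<-trans (ℕ.n<1+n _) 2+o<n))
    (subst (λ k → bond i k ≡ 2) (next-⊹ i o) (bond-far i (suc o) (s≤s (s≤s z≤n)) 2+o<n))
    (bond≡3 j (next≢ j)) (λ s → des-exclusive s)
    (des-word⁺ j u wᵤ) (slide-des j {u₁} wᵤ₁) (proj₁ (knuth uu₁)) (proj₂ (knuth uu₁))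
    (des-word⁺ j v wᵥ) (slide-des j {v₁} wᵥ₁) (proj₁ (knuth vv₁)) (proj₂ (knuth vv₁))
    (des-word⁺ i u eqᵤ) (des-word⁺ i u₁ eqᵤ₁) (¬xy ∘ des-word⁻ i v eqᵥ) (¬xy ∘ des-word⁻ i v₁ eqᵥ₁)
    where
    o : ℕ
    o = 2 ℕ.+ length α
    j : Fin n
    j = i ⊹ o
    2+o<n : 2 ℕ.+ o < n
    2+o<n = room v (x ∷ y ∷ α) 2 (↑ ∷ ↓ ∷ z ∷ β) eqᵥ (s≤s (s≤s (s≤s z≤n)))
    at-u : ∀ s {β} → word i s ≡ ↑ ∷ ↓ ∷ α′ ++ β → word j s ≡ β ++ ↑ ∷ ↓ ∷ α′
    at-u s eq = word-at s (x ∷ y ∷ α) (↑ ∷ ↓ ∷ α′) (cong (suc ∘ suc) lengths) eq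
    wᵤ : word j u ≡ ↑ ∷ ↓ ∷ z′ ∷ (β′ ++ ↑ ∷ ↓ ∷ α′)
    wᵤ = at-u u eqᵤ
    wᵤ₁ : word j u₁ ≡ z′ ∷ ↑ ∷ ↓ ∷ (β′ ++ ↑ ∷ ↓ ∷ α′)
    wᵤ₁ = at-u u₁ eqᵤ₁
    wᵥ : word j v ≡ ↑ ∷ ↓ ∷ z ∷ (β ++ x ∷ y ∷ α)
    wᵥ = word-⊹ i v (x ∷ y ∷ α) eqᵥ
    wᵥ₁ : word j v₁ ≡ z ∷ ↑ ∷ ↓ ∷ (β ++ x ∷ y ∷ α)
    wᵥ₁ = word-⊹ i v₁ (x ∷ y ∷ α) eqᵥ₁
    uu₁ : KnuthMove u u₁
    uu₁ = slide-knuth j wᵤ wᵤ₁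
    vv₁ : KnuthMove v v₁
    vv₁ = slide-knuth j wᵥ wᵥ₁

  -- Only the word of v is fixed: a slide in v changes u as well, so u has to be quantified inside.
  Determined : Letter → Letter → Word → Set
  Determined x y w = ∀ u v {w′} → word i u ≡ ↑ ∷ ↓ ∷ w′ → word i v ≡ x ∷ y ∷ w →
    Decides (Caps (↑ ∷ ↓ ∷ w′) (x ∷ y ∷ w)) (M u v)

  realise′ : ∀ (s : RSYT n λ₁ λ₂) {w} w′ → word i s ≡ w → length w′ ≡ length w → #↓ w′ ≡ #↓ w →
    ∃[ t ] word i t ≡ w′
  realise′ s w′ refl lengths counts = realise λ₁+λ₂≡n i w′ (trans lengths (length-word i s)) (trans counts
      (#↓-word i s))

  same-length : ∀ (u v : RSYT n λ₁ λ₂) {p q x y w w′} → word i u ≡ p ∷ q ∷ w′ → word i v ≡ x ∷ y ∷ w → length w′ ≡ length w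
  same-length u v eqᵤ eqᵥ = ℕ.suc-injective (ℕ.suc-injective (trans (sym (cong length eqᵤ))
    (trans (length-word i u) (trans (sym (length-word i v)) (cong length eqᵥ)))))

  #↓-slide : ∀ α z β → #↓ (α ++ z ∷ ↑ ∷ ↓ ∷ β) ≡ #↓ (α ++ ↑ ∷ ↓ ∷ z ∷ β)
  #↓-slide []      ↑ β = refl
  #↓-slide []      ↓ β = refl
  #↓-slide (↑ ∷ α) z β = #↓-slide α z β
  #↓-slide (↓ ∷ α) z β = cong suc (#↓-slide α z β)

  length-slide : ∀ (α : Word) z β → length (α ++ z ∷ ↑ ∷ ↓ ∷ β) ≡ length (α ++ ↑ ∷ ↓ ∷ z ∷ β)
  length-slide []      z β = refl
  length-slide (_ ∷ α) z β = cong suc (length-slide α z β)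

  #↓-∷∷ : ∀ x y {w w′} → #↓ w ≡ #↓ w′ → #↓ (x ∷ y ∷ w) ≡ #↓ (x ∷ y ∷ w′)
  #↓-∷∷ ↑ ↑ eq = eq
  #↓-∷∷ ↑ ↓ eq = cong suc eq
  #↓-∷∷ ↓ ↑ eq = cong suc eq
  #↓-∷∷ ↓ ↓ eq = cong (suc ∘ suc) eq

  -- If u lacks the cup of v, the rule fails and the weight vanishes. Otherwise both words slide,
  -- and neither the rule nor the weight changes.
  determined-slide : ∀ (α : Word) {x y z β} → ¬ Cup x y →
    Determined x y (α ++ z ∷ ↑ ∷ ↓ ∷ β) → Determined x y (α ++ ↑ ∷ ↓ ∷ z ∷ β)
  determined-slide α {x} {y} {z} {β} ¬xy det u v {w′} eqᵤ eqᵥ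
    with splitLike α w′ (same-length u v eqᵤ eqᵥ)
  ... | α′ , p ∷ q ∷ z′ ∷ β′ , refl , lengths , _ with cup? p q
  ...   | no ¬cup = decides-false (missing⇒¬caps (missing α α′ lengths ¬cup))
    (compatible-word {u} {v} α α′ lengths ¬cup ¬xy eqᵤ eqᵥ)
  ...   | yes (refl , refl)
    with realise′ u (↑ ∷ ↓ ∷ α′ ++ z′ ∷ ↑ ∷ ↓ ∷ β′) eqᵤ (cong (suc ∘ suc) (length-slide α′ z′ β′)) (cong suc
        (#↓-slide α′ z′ β′))
       | realise′ v (x ∷ y ∷ α ++ z ∷ ↑ ∷ ↓ ∷ β) eqᵥ (cong (suc ∘ suc) (length-slide α z β)) (#↓-∷∷ x y
           (#↓-slide α z β))
  ...     | u₁ , eqᵤ₁ | v₁ , eqᵥ₁ = decides-⇔ (caps-slide s) (caps-slide⁻ s)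
    (transfer-word {u} {v} {u₁} {v₁} α α′ lengths ¬xy eqᵤ eqᵥ eqᵤ₁ eqᵥ₁) (det u₁ v₁ eqᵤ₁ eqᵥ₁)
    where
    s : Slide (α ++ ↑ ∷ ↓ ∷ z ∷ β) (α′ ++ ↑ ∷ ↓ ∷ z′ ∷ β′) (α ++ z ∷ ↑ ∷ ↓ ∷ β) (α′ ++ z′ ∷ ↑ ∷ ↓ ∷ β′)
    s = slide α α′ lengths

  determined-slide⁻ : ∀ (α : Word) {x y z β} → ¬ Cup x y →
    Determined x y (α ++ ↑ ∷ ↓ ∷ z ∷ β) → Determined x y (α ++ z ∷ ↑ ∷ ↓ ∷ β)
  determined-slide⁻ α {x} {y} {z} {β} ¬xy det u₁ v₁ {w′} eqᵤ₁ eqᵥ₁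
    with splitLike α w′ (same-length u₁ v₁ eqᵤ₁ eqᵥ₁)
  ... | α′ , z′ ∷ p ∷ q ∷ β′ , refl , lengths , _ with cup? p q
  ...   | no ¬cup = decides-false
    (λ c → missing⇒¬caps (missing (α ∷ʳ z) (α′ ∷ʳ z′) lengths′ ¬cup) (subst (Caps _) (cong (λ w → x ∷ y ∷ w) (snoc α))
      (subst (λ w → Caps w (x ∷ y ∷ α ++ z ∷ ↑ ∷ ↓ ∷ β)) (cong (λ w → ↑ ∷ ↓ ∷ w) (snoc α′)) c)))
    (compatible-word {u₁} {v₁} (α ∷ʳ z) (α′ ∷ʳ z′) lengths′ ¬cup ¬xy
      (trans eqᵤ₁ (cong (λ w → ↑ ∷ ↓ ∷ w) (snoc α′))) (trans eqᵥ₁ (cong (λ w → x ∷ y ∷ w) (snoc α))))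
    where
    snoc : ∀ (α : Word) {z β} → α ++ z ∷ β ≡ (α ∷ʳ z) ++ β
    snoc α {z} {β} = sym (List.++-assoc α [ z ] β)
    lengths′ : length (α ∷ʳ z) ≡ length (α′ ∷ʳ z′)
    lengths′ = trans (List.length-++ α) (trans (cong (ℕ._+ 1) lengths) (sym (List.length-++ α′)))
  ...   | yes (refl , refl)
    with realise′ u₁ (↑ ∷ ↓ ∷ α′ ++ ↑ ∷ ↓ ∷ z′ ∷ β′) eqᵤ₁ (cong (suc ∘ suc) (sym (length-slide α′ z′ β′)))
        (cong suc (sym (#↓-slide α′ z′ β′)))
       | realise′ v₁ (x ∷ y ∷ α ++ ↑ ∷ ↓ ∷ z ∷ β) eqᵥ₁ (cong (suc ∘ suc) (sym (length-slide α z β)))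
           (#↓-∷∷ x y (sym (#↓-slide α z β)))
  ...     | u , eqᵤ | v , eqᵥ = decides-⇔ (caps-slide⁻ s) (caps-slide s)
    (sym (transfer-word {u} {v} {u₁} {v₁} α α′ lengths ¬xy eqᵤ eqᵥ eqᵤ₁ eqᵥ₁)) (det u v eqᵤ eqᵥ)
    where
    s : Slide (α ++ ↑ ∷ ↓ ∷ z ∷ β) (α′ ++ ↑ ∷ ↓ ∷ z′ ∷ β′) (α ++ z ∷ ↑ ∷ ↓ ∷ β) (α′ ++ z′ ∷ ↑ ∷ ↓ ∷ β′)
    s = slide α α′ lengths

  ++-replicate-∷ : ∀ b (z : Letter) w → replicate b z ++ z ∷ w ≡ z ∷ replicate b z ++ w
  ++-replicate-∷ zero    z w = refl
  ++-replicate-∷ (suc b) z w = cong (z ∷_) (++-replicate-∷ b z w)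

  -- Reduction of the word of v to a normal form

  module _ {x y : Letter} (¬xy : ¬ Cup x y) where

    -- The prefix is stored in reverse, so that stepping past a letter is a cons.
    slide-ʳ : ∀ α {z β} → Determined x y (α ʳ++ z ∷ ↑ ∷ ↓ ∷ β) → Determined x y (α ʳ++ ↑ ∷ ↓ ∷ z ∷ β)
    slide-ʳ α {z} {β} rewrite List.ʳ++-defn α {z ∷ ↑ ∷ ↓ ∷ β} | List.ʳ++-defn α {↑ ∷ ↓ ∷ z ∷ β} =
      determined-slide (reverse α) ¬xy

    slide-ʳ⁻ : ∀ α {z β} → Determined x y (α ʳ++ ↑ ∷ ↓ ∷ z ∷ β) → Determined x y (α ʳ++ z ∷ ↑ ∷ ↓ ∷ β)
    slide-ʳ⁻ α {z} {β} rewrite List.ʳ++-defn α {z ∷ ↑ ∷ ↓ ∷ β} | List.ʳ++-defn α {↑ ∷ ↓ ∷ z ∷ β} =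
      determined-slide⁻ (reverse α) ¬xy

    cup-right : ∀ γ α {β} → Determined x y (α ʳ++ ↑ ∷ ↓ ∷ γ ++ β) → Determined x y (α ʳ++ γ ++ ↑ ∷ ↓ ∷ β)
    cup-right []      α det = det
    cup-right (z ∷ γ) α det = cup-right γ (z ∷ α) (slide-ʳ⁻ α det)

    letter-right : ∀ k α {z β} → Determined x y (α ʳ++ z ∷ cups k β) → Determined x y (α ʳ++ cups k (z ∷ β))
    letter-right zero    α det = det
    letter-right (suc k) α det = letter-right k (↓ ∷ ↑ ∷ α) (slide-ʳ α det)

    inside-cups : ∀ k α {β β′} → (∀ α → Determined x y (α ʳ++ β) → Determined x y (α ʳ++ β′)) →
      Determined x y (α ʳ++ cups k β) → Determined x y (α ʳ++ cups k β′)
    inside-cups zero    α f = f α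
    inside-cups (suc k) α f = inside-cups k (↓ ∷ ↑ ∷ α) f

    -- The part already read is kept as a letters ↓, then k cups, then b letters ↑. A new ↑ joins
    -- the last block. A new ↓ passes left over the cups if b = 0; otherwise it forms a cup with the
    -- last ↑, which passes left over the remaining ↑. The implications run backwards, from the
    -- normal form to the given word.
    normalise : (∀ a k b → Determined x y (replicate a ↓ ʳ++ cups k (replicate b ↑))) →
      ∀ w a k b → Determined x y (replicate a ↓ ʳ++ cups k (replicate b ↑ ++ w))
    normalise base []      a k b       rewrite List.++-identityʳ (replicate b ↑) = base a k b
    normalise base (↑ ∷ w) a k b       rewrite ++-replicate-∷ b ↑ w = normalise base w a k (suc b)
    normalise base (↓ ∷ w) a k zero    = letter-right k (replicate a ↓) (normalise base w (suc a) k 0)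
    normalise base (↓ ∷ w) a k (suc b) rewrite sym (++-replicate-∷ b ↑ (↓ ∷ w)) =
      inside-cups k (replicate a ↓) (λ α → cup-right (replicate b ↑) α)
        (subst (λ v → Determined x y (replicate a ↓ ʳ++ v)) (sym (cups-↑↓ k (replicate b ↑ ++ w)))
          (normalise base w a (suc k) b))

  -- As i + 1 is a descent of v, uniqueness leaves a single u with descent i and nonzero weight, the
  -- Knuth neighbour `u₀`.
  partner-right : ∀ z w → Determined z ↑ (↓ ∷ w)
  partner-right z w u v {w′} eqᵤ eqᵥ with realise′ v (↑ ∷ ↓ ∷ z ∷ w) eqᵥ refl (sym (#↓-slide [] z w))
  ... | u₀ , eq₀ = yes-case , no-case
    where
    u₀v : KnuthMove u₀ v
    u₀v = slide-knuth i eq₀ eqᵥ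
    yes-case : Caps (↑ ∷ ↓ ∷ w′) (z ∷ ↑ ∷ ↓ ∷ w) → M u v ≡ 1
    yes-case c rewrite word-injective i {u} {u₀} (trans eqᵤ (trans (cong (λ w → ↑ ∷ ↓ ∷ w) (caps-right c)) (sym eq₀))) =
      proj₁ (knuth u₀v)
    no-case : ¬ Caps (↑ ∷ ↓ ∷ w′) (z ∷ ↑ ∷ ↓ ∷ w) → M u v ≡ 0
    no-case ¬c = proj₂ (bonded-unique v u₀ u (trans (bond-symmetric (next i) i) (bond≡3 i (next≢ i)))
      (λ s i′∈ i∈ → des-exclusive s i∈ i′∈)
      (slide-des i {v} eqᵥ) (des-word⁺ i u₀ eq₀) (proj₂ (knuth u₀v)) (proj₁ (knuth u₀v)) (des-word⁺ i u eqᵤ)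
      λ { refl → ¬c (subst (λ w″ → Caps w″ (z ∷ ↑ ∷ ↓ ∷ w)) (trans (sym eq₀) eqᵤ) (caps-right⁺ z)) })

  -- The last letter stands just before i on the cycle, so here i - 1 is a descent of v and
  -- uniqueness applies from the other side.
  partner-left : ∀ y w → Determined ↓ y (w ∷ʳ ↑)
  partner-left y w u v {w′} eqᵤ eqᵥ = with-previous (prev i) (next-prev i)
    where
    -- With `prev i` abstracted to h, the cut i can be replaced by `next h`, and `cut-next` relates
    -- the words at h and at i.
    with-previous : ∀ h → next h ≡ i → Decides (Caps (↑ ∷ ↓ ∷ w′) (↓ ∷ y ∷ w ∷ʳ ↑)) (M u v)
    with-previous h refl = go (word h v) refl
      where
      go : ∀ wₕ → word h v ≡ wₕ → Decides (Caps (↑ ∷ ↓ ∷ w′) (↓ ∷ y ∷ w ∷ʳ ↑)) (M u v)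
      go []       eqₕ = contradiction (trans (sym (length-word h v)) (cong length eqₕ)) (ℕ.≢-nonZero⁻¹ n)
      go (x ∷ wₕ) eqₕ with List.∷ʳ-injective wₕ (↓ ∷ y ∷ w) (trans (sym (cut-next h (bottom v) eqₕ)) eqᵥ)
      ... | refl , refl with realise λ₁+λ₂≡n h (y ∷ ↑ ∷ ↓ ∷ w)
              (trans (sym (cong length eqₕ)) (length-word h v))
              (trans (#↓-slide [] y w) (trans (sym (cong #↓ eqₕ)) (#↓-word h v)))
      ...   | u₀ , eq₀ = yes-case , no-case
        where
        vu₀ : KnuthMove v u₀
        vu₀ = slide-knuth h eqₕ eq₀
        eq₀′ : word i u₀ ≡ ↑ ∷ ↓ ∷ w ∷ʳ y
        eq₀′ = cut-next h (bottom u₀) eq₀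
        yes-case : Caps (↑ ∷ ↓ ∷ w′) (↓ ∷ y ∷ w ∷ʳ ↑) → M u v ≡ 1
        yes-case c rewrite word-injective i {u} {u₀} (trans eqᵤ (trans (cong (λ w → ↑ ∷ ↓ ∷ w)
            (caps-left y w c)) (sym eq₀′))) =
          proj₂ (knuth vu₀)
        no-case : ¬ Caps (↑ ∷ ↓ ∷ w′) (↓ ∷ y ∷ w ∷ʳ ↑) → M u v ≡ 0
        no-case ¬c = proj₂ (bonded-unique v u₀ u (bond≡3 h (next≢ h)) (λ s → des-exclusive s)
          (des-word⁺ h v eqₕ) (slide-des h {u₀} eq₀) (proj₁ (knuth vu₀)) (proj₂ (knuth vu₀)) (des-word⁺ i u eqᵤ)
          λ { refl → ¬c (subst (λ w″ → Caps w″ (↓ ∷ y ∷ w ∷ʳ ↑)) (trans (sym eq₀′) eqᵤ) (caps-left⁺ y w)) })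

  -- In v every ↓ belongs to one of the k cups, whereas u spends one ↓ at i + 1 and has too few left
  -- to match them all.
  all-cups : ∀ k w → #↓ (cups k w) ≡ k → Determined ↑ ↑ (cups k w)
  all-cups k w count u v {w′} eqᵤ eqᵥ
    with few-cups k w′ {w} (same-length u v eqᵤ eqᵥ) (ℕ.≤-reflexive (trans (trans (sym (cong #↓ eqᵤ))
           (trans (#↓-word i u) (trans (sym (#↓-word i v)) (cong #↓ eqᵥ)))) count))
  ... | α , β , α′ , p , q , β′ , eq , refl , lengths , ¬cup = decides-false
    (λ c → missing⇒¬caps (missing α α′ lengths ¬cup) (subst (λ w → Caps _ (↑ ∷ ↑ ∷ w)) eq c))
    (compatible-word {u} {v} α α′ lengths ¬cup (λ ()) eqᵤ (trans eqᵥ (cong (λ w → ↑ ∷ ↑ ∷ w) eq)))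

  mostly-↑ : ∀ (s : RSYT n λ₁ λ₂) w → word i s ≡ w → ¬ (length w ≤ #↓ w ℕ.+ #↓ w)
  mostly-↑ s w eq ≤2# = ℕ.<⇒≱ λ₂<λ₁ (ℕ.+-cancelʳ-≤ λ₂ λ₁ λ₂ (begin
    λ₁ ℕ.+ λ₂       ≡⟨ λ₁+λ₂≡n ⟩
    n               ≡⟨ length-word i s ⟨
    length (word i s) ≡⟨ cong length eq ⟩
    length w        ≤⟨ ≤2# ⟩
    #↓ w ℕ.+ #↓ w   ≡⟨ cong (λ k → k ℕ.+ k) (trans (sym (cong #↓ eq)) (#↓-word i s)) ⟩
    λ₂ ℕ.+ λ₂       ∎))
    where open ℕ.≤-Reasoning

  replicate-ʳ++ : ∀ a (z : Letter) w → replicate a z ʳ++ w ≡ replicate a z ++ w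
  replicate-ʳ++ zero    z w = refl
  replicate-ʳ++ (suc a) z w = trans (replicate-ʳ++ a z (z ∷ w)) (++-replicate-∷ a z w)

  ʳ++-∷ʳ : ∀ (α w : Word) z → α ʳ++ (w ∷ʳ z) ≡ (α ʳ++ w) ∷ʳ z
  ʳ++-∷ʳ []      w z = refl
  ʳ++-∷ʳ (x ∷ α) w z = ʳ++-∷ʳ α (x ∷ w) z

  cups-∷ʳ : ∀ k w z → cups k (w ∷ʳ z) ≡ cups k w ∷ʳ z
  cups-∷ʳ zero    w z = refl
  cups-∷ʳ (suc k) w z = cong (λ w → ↑ ∷ ↓ ∷ w) (cups-∷ʳ k w z)

  replicate-∷ʳ : ∀ b (z : Letter) → replicate (suc b) z ≡ replicate b z ∷ʳ z
  replicate-∷ʳ zero    z = refl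
  replicate-∷ʳ (suc b) z = cong (z ∷_) (replicate-∷ʳ b z)

  #↓-cups-↑ : ∀ k b → #↓ (cups k (replicate b ↑)) ≡ k
  #↓-cups-↑ zero    zero    = refl
  #↓-cups-↑ zero    (suc b) = #↓-cups-↑ zero b
  #↓-cups-↑ (suc k) b       = cong suc (#↓-cups-↑ k b)

  AtLeastHalf↓ : Word → Set
  AtLeastHalf↓ w = length w ≤ #↓ w ℕ.+ #↓ w

  half-pair : ∀ {l k} → l ≤ k ℕ.+ k → 2 ℕ.+ l ≤ suc k ℕ.+ suc k
  half-pair {l} {k} l≤ rewrite ℕ.+-suc k k = s≤s (s≤s l≤)

  half-cups : ∀ k → AtLeastHalf↓ (cups k [])
  half-cups zero    = z≤n
  half-cups (suc k) = half-pair (half-cups k)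

  half-↓ : ∀ a {w} → AtLeastHalf↓ w → AtLeastHalf↓ (replicate a ↓ ++ w)
  half-↓ zero    h = h
  half-↓ (suc a) h = ℕ.<⇒≤ (half-pair (half-↓ a h))

  -- Every ↑ among the cups has its own ↓, and the ↓ at i makes up for y, so ↓ would fill at least
  -- half of the word, against λ₂ < λ₁.
  without-↑ : ∀ {y} a k → AtLeastHalf↓ (↓ ∷ y ∷ replicate a ↓ ++ cups k []) →
    Determined ↓ y (replicate a ↓ ʳ++ cups k [])
  without-↑ {y} a k h u v eqᵤ eqᵥ =
    contradiction h (mostly-↑ v _ (trans eqᵥ (cong (λ w → ↓ ∷ y ∷ w) (replicate-ʳ++ a ↓ (cups k [])))))

  -- A descent of v next to i settles the weight: at i + 1 if y = ↑ and a > 0, at i - 1 if x = ↓ and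
  -- b > 0. What remains is `all-cups` and words with too many ↓.
  normal-form : ∀ x y → ¬ Cup x y → ∀ a k b → Determined x y (replicate a ↓ ʳ++ cups k (replicate b ↑))
  normal-form ↑ ↓ ¬xy a k b = contradiction (refl , refl) ¬xy
  normal-form x ↑ _ (suc a) k b rewrite replicate-ʳ++ a ↓ (↓ ∷ cups k (replicate b ↑))
    | ++-replicate-∷ a ↓ (cups k (replicate b ↑)) = partner-right x _
  normal-form ↑ ↑ _ zero k b = all-cups k (replicate b ↑) (#↓-cups-↑ k b)
  normal-form ↓ y _ a k (suc b) rewrite replicate-∷ʳ b ↑ | cups-∷ʳ k (replicate b ↑) ↑
    | ʳ++-∷ʳ (replicate a ↓) (cups k (replicate b ↑)) ↑ = partner-left y _
  normal-form ↓ ↑ _ zero k zero = without-↑ 0 k (half-pair (half-cups k))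
  normal-form ↓ ↓ _ a k zero =
    without-↑ a k (ℕ.≤-trans (half-pair {k = m} (half-↓ a (half-cups k)))
      (ℕ.+-mono-≤ (ℕ.n≤1+n (suc m)) (ℕ.n≤1+n (suc m))))
    where
    m : ℕ
    m = #↓ (replicate a ↓ ++ cups k [])

  determined : ∀ x y → ¬ Cup x y → ∀ w → Determined x y w
  determined x y ¬xy w = normalise ¬xy (normal-form x y ¬xy) w 0 0 0

  caps-determines : i ∈ des u → i ∉ des v → Decides (Caps (word i u) (word i v)) (M u v)
  caps-determines {u} {v} i∈u i∉v = go (word i u) (word i v) refl refl
    where
    short : ∀ (s : RSYT n λ₁ λ₂) {w} {A : Set} → word i s ≡ w → length w ≤ 1 → A
    short s refl ≤1 = contradiction (subst (_≤ 1) (length-word i s) ≤1) (ℕ.<⇒≱ 1<n)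
    go : ∀ w w′ → word i u ≡ w → word i v ≡ w′ → Decides (Caps w w′) (M u v)
    go (p ∷ q ∷ w) (x ∷ y ∷ w′) eqᵤ eqᵥ with des-word⁻ i u eqᵤ i∈u
    ... | refl , refl = determined x y (λ { (refl , refl) → i∉v (des-word⁺ i v eqᵥ) }) w′ u v eqᵤ eqᵥ
    go []      _ eqᵤ _ = short u eqᵤ z≤n
    go (_ ∷ []) _ eqᵤ _ = short u eqᵤ (s≤s z≤n)
    go (_ ∷ _ ∷ _) [] _ eqᵥ = short v eqᵥ z≤n
    go (_ ∷ _ ∷ _) (_ ∷ []) _ eqᵥ = short v eqᵥ (s≤s z≤n)

-- Moves of the second kind

double : ℕ → ℕ
double zero    = zero
double (suc h) = suc (suc (double h))

double≡*2 : ∀ h → double h ≡ h ℕ.* 2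
double≡*2 zero    = refl
double≡*2 (suc h) = cong (suc ∘ suc) (double≡*2 h)

double-+ : ∀ h k → double (h ℕ.+ k) ≡ double h ℕ.+ double k
double-+ zero    k = refl
double-+ (suc h) k = cong (suc ∘ suc) (double-+ h k)

suc-double-odd : ∀ h → suc (double h) ℕ.% 2 ≡ 1
suc-double-odd zero    = refl
suc-double-odd (suc h) = suc-double-odd h

odd⇒suc-double : ∀ m → suc m ℕ.% 2 ≡ 1 → ∃[ h ] m ≡ double h
odd⇒suc-double zero          _   = 0 , refl
odd⇒suc-double (suc (suc m)) odd with odd⇒suc-double m odd
... | h , refl = suc h , refl

double-injective : ∀ {h k} → double h ≡ double k → h ≡ k
double-injective {zero}  {zero}  _  = refl
double-injective {suc h} {suc k} eq = cong suc (double-injective (ℕ.suc-injective (ℕ.suc-injective eq)))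

double-≢-suc : ∀ h k → double h ≢ suc (double k)
double-≢-suc (suc h) (suc k) eq = double-≢-suc h k (ℕ.suc-injective (ℕ.suc-injective eq))

balanced-even : ∀ {d w} → Balanced d w → ∃[ h ] d ℕ.+ length w ≡ double h
balanced-even [] = 0 , refl
balanced-even {d} {_ ∷ w} (up b) with balanced-even b
... | h , eq = h , trans (ℕ.+-suc d (length w)) eq
balanced-even {suc d} {_ ∷ w} (down b) with balanced-even b
... | h , eq = suc h , cong suc (trans (ℕ.+-suc d (length w)) (cong suc eq))

-- Starting at height 2c + 1, the height after 2l letters is 1 plus twice the difference of l + c
-- and the number of ↓. The conditions say that it stays positive and ends at 1.
Ballot : ℕ → (ℕ → Letter) → ℕ → Set
Ballot c g h = (∀ l → l ≤ h → #↓ (applyUpTo g (double l)) ≤ l ℕ.+ c) × #↓ (applyUpTo g (double h)) ≡ h ℕ.+ c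

-- Heights change parity at each letter, so it suffices to test them after every other letter.
ballot⇒balanced : ∀ c g h → Ballot c g h → Balanced (suc (double c)) (applyUpTo g (double h) ∷ʳ ↓)
ballot⇒balanced c g zero (_ , 0≡c) rewrite sym 0≡c = down []
ballot⇒balanced c g (suc h) (below , total) =
  cases c (g 0) (g 1) (λ l l≤h → below (suc l) (s≤s l≤h)) total
  where
  g″ : ℕ → Letter
  g″ = g ∘ suc ∘ suc
  cases : ∀ c x y → (∀ l → l ≤ h → #↓ (x ∷ y ∷ applyUpTo g″ (double l)) ≤ suc l ℕ.+ c) →
    #↓ (x ∷ y ∷ applyUpTo g″ (double h)) ≡ suc h ℕ.+ c →
    Balanced (suc (double c)) (x ∷ y ∷ applyUpTo g″ (double h) ∷ʳ ↓)
  cases c ↑ ↑ below total = up (up (ballot⇒balanced (suc c) g″ h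
    ((λ l l≤h → subst (#↓ (applyUpTo g″ (double l)) ≤_) (sym (ℕ.+-suc l c)) (below l l≤h)) ,
     trans total (sym (ℕ.+-suc h c)))))
  cases c ↑ ↓ below total = up (down (ballot⇒balanced c g″ h
    ((λ l l≤h → ℕ.s≤s⁻¹ (below l l≤h)) , ℕ.suc-injective total)))
  cases c ↓ ↑ below total = down (up (ballot⇒balanced c g″ h
    ((λ l l≤h → ℕ.s≤s⁻¹ (below l l≤h)) , ℕ.suc-injective total)))
  cases zero ↓ ↓ below total with ℕ.s≤s⁻¹ (below 0 z≤n)
  ... | ()
  cases (suc c) ↓ ↓ below total = down (down (ballot⇒balanced c g″ h
    ((λ l l≤h → ℕ.s≤s⁻¹ (ℕ.s≤s⁻¹ (subst (suc (suc (#↓ (applyUpTo g″ (double l)))) ≤_) (cong suc (ℕ.+-suc l c))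
        (below l l≤h)))) ,
     ℕ.suc-injective (ℕ.suc-injective (trans total (cong suc (ℕ.+-suc h c)))))))

balanced⇒ballot : ∀ c g h → Balanced (suc (double c)) (applyUpTo g (double h) ∷ʳ ↓) → Ballot c g h
balanced⇒ballot c g zero (down b) = (λ { zero _ → z≤n }) , empty c b
  where
  empty : ∀ c → Balanced (double c) [] → 0 ≡ c
  empty zero [] = refl
balanced⇒ballot c g (suc h) b = let below , total = cases c (g 0) (g 1) b in
  (λ { zero _ → z≤n ; (suc l) (s≤s l≤h) → below l l≤h }) , total
  where
  g″ : ℕ → Letter
  g″ = g ∘ suc ∘ suc
  Ballot′ : ℕ → Letter → Letter → Set
  Ballot′ c x y = (∀ l → l ≤ h → #↓ (x ∷ y ∷ applyUpTo g″ (double l)) ≤ suc l ℕ.+ c) ×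
    #↓ (x ∷ y ∷ applyUpTo g″ (double h)) ≡ suc h ℕ.+ c
  cases : ∀ c x y → Balanced (suc (double c)) (x ∷ y ∷ applyUpTo g″ (double h) ∷ʳ ↓) → Ballot′ c x y
  cases c ↑ ↑ (up (up b)) = let below , total = balanced⇒ballot (suc c) g″ h b in
    (λ l l≤h → subst (#↓ (applyUpTo g″ (double l)) ≤_) (ℕ.+-suc l c) (below l l≤h)) , trans total (ℕ.+-suc h c)
  cases c ↑ ↓ (up (down b)) = let below , total = balanced⇒ballot c g″ h b in
    (λ l l≤h → s≤s (below l l≤h)) , cong suc total
  cases c ↓ ↑ (down b) = let below , total = balanced⇒ballot c g″ h (reopen b) in
    (λ l l≤h → s≤s (below l l≤h)) , cong suc total
    where
    reopen : ∀ {d w} → Balanced d (↑ ∷ w) → Balanced (suc d) w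
    reopen (up b) = b
  cases zero ↓ ↓ (down ())
  cases (suc c) ↓ ↓ (down (down b)) = let below , total = balanced⇒ballot c g″ h b in
    (λ l l≤h → s≤s (subst (suc (#↓ (applyUpTo g″ (double l))) ≤_) (sym (ℕ.+-suc l c)) (s≤s (below l l≤h)))) ,
    cong suc (trans (cong suc total) (sym (ℕ.+-suc h c)))

module _ {n : ℕ} .{{_ : NonZero n}} where

  -- `value` ranges over 1 to n, so n, a full turn, has to be excluded separately.
  distance-⊹ : ∀ (p : Fin n) {k} → 0 < k → k < n → value (bar {n} (⟦ p ⊹ k ⟧ ℤ.- ⟦ p ⟧)) ≡ k
  distance-⊹ p {k} 0<k k<n with ℕ.m≤n⇒m<n∨m≡n (Fin.toℕ<n (bar {n} (⟦ p ⊹ k ⟧ ℤ.- ⟦ p ⟧)))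
  ... | inj₁ d<n = ⊹-injectiveʳ p d<n k<n (⊹-distance p (p ⊹ k))
  ... | inj₂ d≡n = contradiction
    (trans (sym (⊹-distance p (p ⊹ k))) (trans (cong (p ⊹_) d≡n) (⊹-n p))) (⊹≢ p 0<k k<n)

  bar-∸2 : ∀ (x : Fin n) → next (bar {n} (⟦ x ⟧ ℤ.- + 2)) ≡ prev x
  bar-∸2 x = trans (next-bar (⟦ x ⟧ ℤ.- + 2)) (cong bar (shift ⟦ x ⟧))
    where
    shift : ∀ a → a ℤ.- + 2 ℤ.+ ℤ.1ℤ ≡ a ℤ.- ℤ.1ℤ
    shift = solve-∀

  prev-⊹ : ∀ (p : Fin n) m → prev (p ⊹ suc m) ≡ p ⊹ m
  prev-⊹ p m = trans (cong prev (next-⊹ p m)) (prev-next (p ⊹ m))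

module _ {n λ₁ λ₂ : ℕ} .{{_ : NonZero n}} where

  -- For l = 0 the start follows the end, and the convention for the empty interval applies.
  interval : ∀ (s : RSYT n λ₁ λ₂) a b l → l < n → a ⊹ l ≡ next b →
    ∣ T² s ∩ ⟨ a , b ⟩ ∣ ≡ #↓ (applyUpTo (λ k → letter s (a ⊹ k)) l)
  interval s a b zero    l<n a≡ rewrite a≡ = ∣∩⟨⟩∣-empty (T² s) b
  interval s a b (suc e) l<n a⊹≡ with next-injective (trans (sym (next-⊹ a e)) a⊹≡)
  ... | refl rewrite sym (bottom≡T² s) = ∣∩⟨⟩∣ (bottom s) a e l<n

  module _ (s : RSYT n λ₁ λ₂) (p : Fin n) (h : ℕ) (room : 3 ℕ.+ double h < n) where

    private
      m : ℕ
      m = double h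
      j : Fin n
      j = p ⊹ (3 ℕ.+ m)
      -- The letters strictly between i + 1 and j - 1, which conditions (d) and (e) count.
      g : ℕ → Letter
      g k = letter s (p ⊹ (2 ℕ.+ k))
      prev-j : prev j ≡ p ⊹ (2 ℕ.+ m)
      prev-j = prev-⊹ p (2 ℕ.+ m)
      m<n : m < n
      m<n = ℕ.≤-trans (s≤s (ℕ.m≤n+m m 3)) room

    count-E : ∣ T² s ∩ upTo-j-2 s p j (bar (⟦ p ⟧ ℤ.+ + 2)) ∣ ≡ #↓ (applyUpTo g m)
    count-E = trans (interval s _ (bar (⟦ j ⟧ ℤ.- + 2)) m m<n (trans (cong (_⊹ m) (sym (⊹-bar p 2)))
        (trans (sym prev-j) (sym (bar-∸2 j)))))
      (cong #↓ (applyUpTo-cong m λ {k} _ → cong (λ x → letter s (x ⊹ k)) (sym (⊹-bar p 2))))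

    count-D : ∀ k → k ≤ h → ∣ T² s ∩ upTo-j-2 s p j (bar (⟦ j ⟧ ℤ.- ℤ.1ℤ ℤ.- + (2 ℕ.* k))) ∣ ≡
      #↓ (applyUpTo (λ l → g (double (h ℕ.∸ k) ℕ.+ l)) (double k))
    count-D k k≤h = trans (interval s a (bar (⟦ j ⟧ ℤ.- + 2)) (double k) 2k<n
        (trans ends (sym (bar-∸2 j))))
      (cong #↓ (applyUpTo-cong (double k) λ {l} _ → cong (letter s) (trans (cong (_⊹ l) start)
        (sym (⊹-+ p (2 ℕ.+ double (h ℕ.∸ k)) l)))))
      where
      a : Fin n
      a = bar (⟦ j ⟧ ℤ.- ℤ.1ℤ ℤ.- + (2 ℕ.* k))
      total : double (h ℕ.∸ k) ℕ.+ double k ≡ m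
      total = trans (sym (double-+ (h ℕ.∸ k) k)) (cong double (ℕ.m∸n+n≡m k≤h))
      2k<n : double k < n
      2k<n = ℕ.≤-<-trans (ℕ.≤-trans (ℕ.m≤n+m (double k) (double (h ℕ.∸ k))) (ℕ.≤-reflexive total)) m<n
      2*k : 2 ℕ.* k ≡ double k
      2*k = trans (ℕ.*-comm 2 k) (sym (double≡*2 k))
      ends : a ⊹ double k ≡ prev j
      ends = trans (bar-⊹ (⟦ j ⟧ ℤ.- ℤ.1ℤ ℤ.- + (2 ℕ.* k)) (double k))
        (cong bar (trans (cong (λ z → ⟦ j ⟧ ℤ.- ℤ.1ℤ ℤ.- + z ℤ.+ + double k) 2*k) (cancel ⟦ j ⟧ (+ double k))))
        where
        cancel : ∀ a b → a ℤ.- ℤ.1ℤ ℤ.- b ℤ.+ b ≡ a ℤ.- ℤ.1ℤ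
        cancel = solve-∀
      start : a ≡ p ⊹ (2 ℕ.+ double (h ℕ.∸ k))
      start = ⊹-injectiveˡ (double k) (trans ends (trans prev-j
        (trans (cong (λ z → p ⊹ (2 ℕ.+ z)) (sym total)) (⊹-+ p (2 ℕ.+ double (h ℕ.∸ k)) (double k)))))

applyUpTo-split : ∀ {A : Set} (f : ℕ → A) {m n} → m < n → ∃[ R ] applyUpTo f n ≡ applyUpTo f m ++ f m ∷ R
applyUpTo-split f {zero}  {suc n} _         = _ , refl
applyUpTo-split f {suc m} {suc n} (s≤s m<n) with applyUpTo-split (f ∘ suc) m<n
... | R , eq = R , cong (f 0 ∷_) eq

applyUpTo-prefix : ∀ {A : Set} {f : ℕ → A} n α {β} → applyUpTo f n ≡ α ++ β → α ≡ applyUpTo f (length α)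
applyUpTo-prefix n       []      eq = refl
applyUpTo-prefix (suc n) (x ∷ α) eq =
  cong₂ _∷_ (sym (List.∷-injectiveˡ eq)) (applyUpTo-prefix n α (List.∷-injectiveʳ eq))

balanced-ends : ∀ {x y} w → Balanced 0 (x ∷ w ∷ʳ y) → x ≡ ↑ × y ≡ ↓ × Balanced 1 (w ∷ʳ ↓)
balanced-ends {y = ↑} w (up b) = contradiction b (balanced-∷ʳ↑ w)
balanced-ends {y = ↓} w (up b) = refl , refl , b

module _ {n λ₁ λ₂ : ℕ} .{{_ : NonZero n}} where

  private
    interior : ∀ (f : ℕ → Letter) h → applyUpTo (f ∘ suc) (2 ℕ.+ double h) ≡
      f 1 ∷ applyUpTo (λ k → f (2 ℕ.+ k)) (double h) ∷ʳ f (2 ℕ.+ double h)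
    interior f h = cong (f 1 ∷_) (sym (List.applyUpTo-∷ʳ (λ k → f (2 ℕ.+ k)) (double h)))

  module Conditions (s : RSYT n λ₁ λ₂) (p : Fin n) (h : ℕ) (room : 3 ℕ.+ double h < n) where

    q : Fin n
    q = p ⊹ (3 ℕ.+ double h)

    g : ℕ → Letter
    g k = letter s (p ⊹ (2 ℕ.+ k))

    distance≡ : distance s p q ≡ 3 ℕ.+ double h
    distance≡ = distance-⊹ p (s≤s z≤n) room

    half≡ : half s p q ≡ h
    half≡ = trans (cong (λ d → (d ℕ.∸ 3) ℕ./ 2) distance≡)
      (trans (cong (ℕ._/ 2) (double≡*2 h)) (ℕ.m*n/n≡m h 2))

    suffix : ℕ → ℕ
    suffix k = #↓ (applyUpTo (λ l → g (double (h ℕ.∸ k) ℕ.+ l)) (double k))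

    prefix+suffix : ∀ k → k ≤ h → #↓ (applyUpTo g (double (h ℕ.∸ k))) ℕ.+ suffix k ≡ #↓ (applyUpTo g (double h))
    prefix+suffix k k≤h = trans (sym (#↓-++ (applyUpTo g (double (h ℕ.∸ k))) _))
      (trans (cong #↓ (sym (applyUpTo-+ g (double (h ℕ.∸ k)) (double k))))
        (cong (λ m → #↓ (applyUpTo g m)) (trans (sym (double-+ (h ℕ.∸ k) k)) (cong double (ℕ.m∸n+n≡m k≤h)))))

    -- Condition (d) bounds suffixes from below and `Ballot` bounds prefixes from above. The total
    -- in (e) converts one into the other, with k = h - l.
    conditions⇒ballot : ConditionD s p q → ∣ T² s ∩ upTo-j-2 s p q (bar (⟦ p ⟧ ℤ.+ + 2)) ∣ ≡ half s p q → Ballot 0 g h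
    conditions⇒ballot D E = below , trans total (sym (ℕ.+-identityʳ h))
      where
      total : #↓ (applyUpTo g (double h)) ≡ h
      total = trans (sym (count-E s p h room)) (trans E half≡)
      suffix≥ : ∀ k → k ≤ h → k ≤ suffix k
      suffix≥ zero    _   = z≤n
      suffix≥ (suc k) k<h = subst (suc k ≤_) (count-D s p h room (suc k) k<h)
        (D (suc k) (s≤s z≤n) (subst (suc k ≤_) (sym half≡) k<h))
      below : ∀ l → l ≤ h → #↓ (applyUpTo g (double l)) ≤ l ℕ.+ 0
      below l l≤h rewrite ℕ.+-identityʳ l = ℕ.+-cancelʳ-≤ k _ l (begin
        #↓ (applyUpTo g (double l)) ℕ.+ k
          ≡⟨ cong (λ x → #↓ (applyUpTo g (double x)) ℕ.+ k) (ℕ.m∸[m∸n]≡n l≤h) ⟨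
        #↓ (applyUpTo g (double (h ℕ.∸ k))) ℕ.+ k
          ≤⟨ ℕ.+-monoʳ-≤ _ (suffix≥ k (ℕ.m∸n≤m h l)) ⟩
        #↓ (applyUpTo g (double (h ℕ.∸ k))) ℕ.+ suffix k
          ≡⟨ trans (prefix+suffix k (ℕ.m∸n≤m h l)) total ⟩
        h ≡⟨ ℕ.m+[n∸m]≡n l≤h ⟨
        l ℕ.+ k ∎)
        where
        open ℕ.≤-Reasoning
        k : ℕ
        k = h ℕ.∸ l

    ballot⇒E : Ballot 0 g h → ∣ T² s ∩ upTo-j-2 s p q (bar (⟦ p ⟧ ℤ.+ + 2)) ∣ ≡ half s p q
    ballot⇒E (_ , total) = trans (count-E s p h room) (trans total (trans (ℕ.+-identityʳ h) (sym half≡)))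

    ballot⇒D : Ballot 0 g h → ConditionD s p q
    ballot⇒D (below , total) k 1≤k k≤half = subst (k ≤_) (sym (count-D s p h room k k≤h))
      (ℕ.+-cancelˡ-≤ (h ℕ.∸ k) k (suffix k) (begin
        (h ℕ.∸ k) ℕ.+ k ≡⟨ ℕ.m∸n+n≡m k≤h ⟩
        h               ≡⟨ trans (prefix+suffix k k≤h) (trans total (ℕ.+-identityʳ h)) ⟨
        #↓ (applyUpTo g (double (h ℕ.∸ k))) ℕ.+ suffix k
          ≤⟨ ℕ.+-monoˡ-≤ (suffix k) (subst (#↓ (applyUpTo g (double (h ℕ.∸ k))) ≤_) (ℕ.+-identityʳ (h ℕ.∸ k))
              (below (h ℕ.∸ k) (ℕ.m∸n≤m h k))) ⟩
        (h ℕ.∸ k) ℕ.+ suffix k ∎))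
      where
      open ℕ.≤-Reasoning
      k≤h : k ≤ h
      k≤h = subst (k ≤_) half≡ k≤half

  -- Condition (a) makes the length of D even, (b) makes a nonempty D begin with ↑ and end with ↓,
  -- and (d) and (e) balance what lies between. At distance 1 the word D is empty.
  second⇒word : ∀ (s : RSYT n λ₁ λ₂) p q → SecondKindConditions s p q →
    ∃[ D ] ∃[ R ] word p s ≡ ↓ ∷ D ++ ↑ ∷ R × q ≡ p ⊹ suc (length D) × Balanced 0 D
  second⇒word s p q conditions with reach p q
  ... | zero , _ , refl = contradiction {A = ↓ ≡ ↑}
    (trans (sym (∈T²⇒↓ s (proj₁ (proj₁ conditions)))) (∈T¹⇒↑ s (proj₁ (proj₂ (proj₁ conditions))))) λ ()
  ... | suc m , m<n , refl = go (odd⇒suc-double m (trans (cong (ℕ._% 2) (sym (distance-⊹ p (s≤s z≤n) m<n))) odd))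
    where
    p↓ = ∈T²⇒↓ s (proj₁ (proj₁ conditions))
    q↑ = ∈T¹⇒↑ s (proj₁ (proj₂ (proj₁ conditions)))
    odd = proj₁ (proj₂ conditions)
    condB = proj₁ (proj₂ (proj₂ conditions))
    condD = proj₁ (proj₂ (proj₂ (proj₂ (proj₂ conditions))))
    condE = proj₂ (proj₂ (proj₂ (proj₂ (proj₂ conditions))))
    f : ℕ → Letter
    f k = letter s (p ⊹ k)
    D : Word
    D = applyUpTo (f ∘ suc) m
    split : ∃[ R ] word p s ≡ applyUpTo f (suc m) ++ f (suc m) ∷ R
    split = applyUpTo-split f m<n
    balanced : ∃[ h ] m ≡ double h → Balanced 0 D
    balanced (zero , refl)  = []
    balanced (suc h , refl) = subst (Balanced 0) (sym (trans (interior f h)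
        (cong₂ (λ x y → x ∷ applyUpTo g (double h) ∷ʳ y)
          (∈T¹⇒↑ s (proj₁ condB)) (trans (cong (letter s) (sym (prev-⊹ p (2 ℕ.+ double h)))) (∈T²⇒↓ s (proj₂ condB))))))
      (up (ballot⇒balanced 0 g h (conditions⇒ballot condD (condE λ q≡ →
        contradiction (⊹-injectiveʳ p m<n (ℕ.≤-trans (s≤s (s≤s z≤n)) m<n) q≡) (λ ())))))
      where open Conditions s p h m<n
    go : ∃[ h ] m ≡ double h →
      ∃[ D ] ∃[ R ] word p s ≡ ↓ ∷ D ++ ↑ ∷ R × p ⊹ suc m ≡ p ⊹ suc (length D) × Balanced 0 D
    go even = D , proj₁ split ,
      trans (proj₂ split) (cong₂ (λ x y → x ∷ D ++ y ∷ proj₁ split) p↓ q↑) ,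
      cong (λ k → p ⊹ suc k) (sym (List.length-applyUpTo (f ∘ suc) m)) ,
      balanced even

  word⇒second : ∀ (s : RSYT n λ₁ λ₂) p D {R} → word p s ≡ ↓ ∷ D ++ ↑ ∷ R → Balanced 0 D →
    p ≢ next (p ⊹ suc (length D)) → ConditionC s p (p ⊹ suc (length D)) →
    SecondKindConditions s p (p ⊹ suc (length D))
  word⇒second s p D {R} eq balanced p≢ condC = go (length D) (balanced-even balanced)
      (List.∷-injectiveʳ (applyUpTo-prefix n (↓ ∷ D) eq)) (position<n p s (↓ ∷ D) eq)
      (letter-at p s (↓ ∷ D) eq) p≢ condC
    where
    f : ℕ → Letter
    f k = letter s (p ⊹ k)
    p∈ : p ∈ T² s
    p∈ = ↓⇒∈T² s (letter-at p s [] eq)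
    go : ∀ m → ∃[ h ] m ≡ double h → D ≡ applyUpTo (f ∘ suc) m → suc m < n → letter s (p ⊹ suc m) ≡ ↑ →
      p ≢ next (p ⊹ suc m) → ConditionC s p (p ⊹ suc m) → SecondKindConditions s p (p ⊹ suc m)
    go _ (zero , refl) D≡ m<n q↑ p≢ condC =
      (p∈ , ↑⇒∈T¹ s q↑ , p≢) , cong (ℕ._% 2) distance≡1 , (↑⇒∈T¹ s q↑ , ↓⇒∈T² s (trans (cong (letter s)
          (prev-⊹ p 0)) (∈T²⇒↓ s p∈))) , condC ,
      (λ k 1≤k k≤half → contradiction (ℕ.≤-trans 1≤k (subst (k ≤_) (cong (λ d →
          (d ℕ.∸ 3) ℕ./ 2) distance≡1) k≤half)) λ ()) ,
      (λ q≢ → contradiction refl q≢)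
      where
      distance≡1 : distance s p (next p) ≡ 1
      distance≡1 = distance-⊹ p {1} (s≤s z≤n) m<n
    go _ (suc h , refl) D≡ m<n q↑ p≢ condC
      with balanced-ends (applyUpTo g (double h)) (subst (Balanced 0) (trans D≡ (interior f h)) balanced)
      where open Conditions s p h m<n
    ... | first≡↑ , last≡↓ , inner =
      (p∈ , ↑⇒∈T¹ s q↑ , p≢) , trans (cong (ℕ._% 2) distance≡) (suc-double-odd h) ,
      (↑⇒∈T¹ s first≡↑ , ↓⇒∈T² s (trans (cong (letter s) (prev-⊹ p (2 ℕ.+ double h))) last≡↓)) , condC ,
      ballot⇒D (balanced⇒ballot 0 g h inner) , λ _ → ballot⇒E (balanced⇒ballot 0 g h inner)
      where open Conditions s p h m<n

balanced⇒opens : ∀ {d D} R → Balanced d D → Opens d (D ++ ↓ ∷ R) (D ++ ↑ ∷ R)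
balanced⇒opens R []       = stop
balanced⇒opens R (up b)   = up (balanced⇒opens R b)
balanced⇒opens R (down b) = down (balanced⇒opens R b)

opens⇒balanced : ∀ {d w w′} → Opens d w w′ →
  ∃[ D ] ∃[ R ] w ≡ D ++ ↓ ∷ R × w′ ≡ D ++ ↑ ∷ R × Balanced d D
opens⇒balanced (stop {w}) = [] , w , refl , refl , []
opens⇒balanced (up o) with opens⇒balanced o
... | D , R , refl , refl , b = ↑ ∷ D , R , refl , refl , up b
opens⇒balanced (down o) with opens⇒balanced o
... | D , R , refl , refl , b = ↓ ∷ D , R , refl , refl , down b

balanced⇒closes : ∀ L {D} → Balanced 0 D → Closes (L ++ ↑ ∷ D) (L ++ ↓ ∷ D)
balanced⇒closes []      b = here b
balanced⇒closes (x ∷ L) b = there (balanced⇒closes L b)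

closes⇒balanced : ∀ {w w′} → Closes w w′ → ∃[ L ] ∃[ D ] w ≡ L ++ ↑ ∷ D × w′ ≡ L ++ ↓ ∷ D × Balanced 0 D
closes⇒balanced (here {w} b) = [] , w , refl , refl , b
closes⇒balanced (there {x = x} c) with closes⇒balanced c
... | L , D , refl , refl , b = x ∷ L , D , refl , refl , b

-- The cap rule and the moves of Γ̄

module _ {n λ₁ λ₂ : ℕ} .{{_ : NonZero n}} where

  Edge : RSYT n λ₁ λ₂ → RSYT n λ₁ λ₂ → Set
  Edge u v = FirstKind u v ⊎ SecondKind u v

  interchange-first : ∀ u v {x y} → Interchange {n} {λ₁} {λ₂} x y u v → letter v x ≡ letter u y
  interchange-first u v {x} {y} swapped = trans (interchange⁻ {s = u} {v} swapped x) (cong (letter u)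
      (transpose-first x y))

  interchange-second : ∀ u v {x y} → Interchange {n} {λ₁} {λ₂} x y u v → letter v y ≡ letter u x
  interchange-second u v {x} {y} swapped = trans (interchange⁻ {s = u} {v} swapped y) (cong (letter u)
      (transpose-second x y))

  -- A descent depends on two letters only, so it can be lost only if the interchange touches one of
  -- them.
  new-descent : ∀ u v {x y i} → Interchange {n} {λ₁} {λ₂} x y u v → i ∈ des u → i ∉ des v →
    (i ≡ x ⊎ i ≡ y) ⊎ (next i ≡ x ⊎ next i ≡ y)
  new-descent u v {x} {y} {i} swapped i∈u i∉v
    with i Fin.≟ x | i Fin.≟ y | next i Fin.≟ x | next i Fin.≟ y
  ... | yes i≡x | _       | _       | _       = inj₁ (inj₁ i≡x)
  ... | no _    | yes i≡y | _       | _       = inj₁ (inj₂ i≡y)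
  ... | no _    | no _    | yes i′≡x | _       = inj₂ (inj₁ i′≡x)
  ... | no _    | no _    | no _    | yes i′≡y = inj₂ (inj₂ i′≡y)
  ... | no i≢x  | no i≢y  | no i′≢x | no i′≢y = contradiction
    (∈des⁺ v (trans (unchanged i≢x i≢y) (proj₁ (∈des⁻ u i∈u))) (trans (unchanged i′≢x i′≢y) (proj₂ (∈des⁻ u i∈u)))) i∉v
    where
    unchanged : ∀ {z} → z ≢ x → z ≢ y → letter v z ≡ letter u z
    unchanged {z} z≢x z≢y = trans (interchange⁻ {s = u} {v} swapped z) (cong (letter u) (transpose-other z≢x z≢y))

  -- For a move of the second kind it is condition (c) that supplies the descent: just before p in
  -- one case, at q in the other.
  edge⇒new-descent : ∀ u v → Edge u v → ∃[ i ] i ∈ des u × i ∉ des v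
  edge⇒new-descent u v (inj₁ (i , (i∈ , i′∈) , swapped)) =
    i , ∈des⁺ u (∈T¹⇒↑ u i∈) (∈T²⇒↓ u i′∈) , λ i∈v → contradiction {A = ↓ ≡ ↑}
      (trans (sym (trans (interchange-first u v swapped) (∈T²⇒↓ u i′∈))) (proj₁ (∈des⁻ v i∈v))) λ ()
  edge⇒new-descent u v (inj₂ (p , q , ((p∈ , q∈ , _) , _ , _ , condC , _) , swapped)) = from condC
    where
    from : ConditionC u p q → ∃[ i ] i ∈ des u × i ∉ des v
    from (inj₁ p′∈) = prev p , ∈des⁺ u (∈T¹⇒↑ u p′∈) (trans (cong (letter u) (next-prev p)) (∈T²⇒↓ u p∈)) ,
      λ p′∈v → contradiction {A = ↑ ≡ ↓} (trans (sym (trans (interchange-first u v swapped) (∈T¹⇒↑ u q∈)))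
        (trans (cong (letter v) (sym (next-prev p))) (proj₂ (∈des⁻ v p′∈v)))) λ ()
    from (inj₂ q′∈) = q , ∈des⁺ u (∈T¹⇒↑ u q∈) (∈T²⇒↓ u q′∈) ,
      λ q∈v → contradiction {A = ↓ ≡ ↑} (trans (sym (trans (interchange-second u v swapped) (∈T²⇒↓ u p∈)))
        (proj₁ (∈des⁻ v q∈v))) λ ()

  -- An empty R would close the circle, making p the successor of the last position.
  next-end : ∀ p (s : RSYT n λ₁ λ₂) {x D y} R → word p s ≡ x ∷ D ++ y ∷ R →
    p ≢ next (p ⊹ suc (length D)) → ∃[ z ] ∃[ R′ ] R ≡ z ∷ R′
  next-end p s {x} {D} {y} []      eq p≢ = contradiction
    (sym (trans (sym (next-⊹ p (suc (length D)))) (trans (cong (p ⊹_) 2+D≡n) (⊹-n p)))) p≢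
    where
    2+D≡n : suc (suc (length D)) ≡ n
    2+D≡n = trans (cong suc (trans (ℕ.+-comm 1 (length D)) (sym (List.length-++ D)))) (trans (sym
        (cong length eq)) (length-word p s))
  next-end p s (z ∷ R′) eq p≢ = z , R′ , refl

  end≢start : ∀ p (s : RSYT n λ₁ λ₂) {x} D {y} R → R ≢ [] → word p s ≡ x ∷ D ++ y ∷ R →
    p ≢ next (p ⊹ suc (length D))
  end≢start p s     D     []      R≢[] eq p≡ = R≢[] refl
  end≢start p s {x} D {y} (z ∷ R) _    eq p≡ = ⊹≢ p (s≤s z≤n) room (trans (next-⊹ p (suc (length D))) (sym p≡))
    where
    room : suc (suc (length D)) < n
    room = subst (_< n) (trans (List.length-++ (x ∷ D)) (ℕ.+-comm (suc (length D)) 1))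
      (position<n p s ((x ∷ D) ++ [ y ]) (trans eq (sym (List.++-assoc (x ∷ D) [ y ] (z ∷ R)))))

  -- Cutting one step before p brings the last letter of R to the front; it is ↑ because i is a
  -- descent of u.
  opening⇒caps : ∀ p i (u v : RSYT n λ₁ λ₂) {D R} → next i ≡ p → i ∈ des u →
    word p u ≡ ↓ ∷ D ++ ↑ ∷ R → word p v ≡ ↑ ∷ D ++ ↓ ∷ R → Balanced 0 D →
    p ≢ next (p ⊹ suc (length D)) → Caps (word i u) (word i v)
  opening⇒caps p i u v {D} {R} refl i∈u eqᵤ eqᵥ balanced p≢ with initLast R | next-end p u R eqᵤ p≢
  ... | []      | _ , _ , ()
  ... | R′ ∷ʳ′ r | _ = go (word i u) (word i v) refl refl
    where
    nonempty : ∀ (s : RSYT n λ₁ λ₂) → word i s ≢ []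
    nonempty s eq = contradiction (trans (sym (length-word i s)) (cong length eq)) (ℕ.≢-nonZero⁻¹ n)
    move : ∀ (x y : Letter) → x ∷ D ++ y ∷ (R′ ∷ʳ r) ≡ (x ∷ D ++ y ∷ R′) ∷ʳ r
    move x y = sym (List.++-assoc (x ∷ D) (y ∷ R′) [ r ])
    go : ∀ w w′ → word i u ≡ w → word i v ≡ w′ → Caps w w′
    go [] _ eq _ = contradiction eq (nonempty u)
    go (_ ∷ _) [] _ eq = contradiction eq (nonempty v)
    go (x ∷ w) (y ∷ w′) eq eq′
      with List.∷ʳ-injective w (↓ ∷ D ++ ↑ ∷ R′) (trans (sym (cut-next i (bottom u) eq)) (trans eqᵤ (move ↓ ↑)))
         | List.∷ʳ-injective w′ (↑ ∷ D ++ ↓ ∷ R′) (trans (sym (cut-next i (bottom v) eq′)) (trans eqᵥ (move ↑ ↓)))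
    ... | refl , refl | refl , refl with des-word⁻ i u eq i∈u
    ...   | refl , _ = opening (balanced⇒opens R′ balanced)

  -- Now i is the upper end of the interchange. The cut there puts R in front of D, and R begins
  -- with ↓ because i is a descent of u.
  closing⇒caps : ∀ p i (u v : RSYT n λ₁ λ₂) {D R} → i ≡ p ⊹ suc (length D) → i ∈ des u →
    word p u ≡ ↓ ∷ D ++ ↑ ∷ R → word p v ≡ ↑ ∷ D ++ ↓ ∷ R → Balanced 0 D →
    p ≢ next (p ⊹ suc (length D)) → Caps (word i u) (word i v)
  closing⇒caps p i u v {D} {R} refl i∈u eqᵤ eqᵥ balanced p≢ with next-end p u R eqᵤ p≢
  ... | r , R′ , refl with des-word⁻ i u (word-⊹ p u (↓ ∷ D) eqᵤ) i∈u
  ...   | _ , refl = subst (λ w → Caps w (word i v)) (sym (word-⊹ p u (↓ ∷ D) eqᵤ))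
    (subst (Caps _) (sym (word-⊹ p v (↑ ∷ D) eqᵥ)) (closing (balanced⇒closes R′ balanced)))

  -- A move of the first kind gives `swap`. For the second kind, ↓ at p and ↑ at q leave two of the
  -- places offered by `new-descent`: just before p, giving `opening`, and q itself, giving
  -- `closing`.
  edge⇒caps : ∀ u v {i} → i ∈ des u → i ∉ des v → Edge u v → Caps (word i u) (word i v)
  edge⇒caps u v {i} i∈u i∉v (inj₁ (p , (p∈ , p′∈) , swapped)) = go (new-descent u v swapped i∈u i∉v)
    where
    at-p : i ≡ p → Caps (word i u) (word i v)
    at-p refl = go′ (word i u) refl
      where
      wrap : ∀ {m} → length (word i u) ≡ m → m ≤ 1 → next i ≡ i
      wrap {m} len m≤1 = trans (cong (i ⊹_) (sym (ℕ.≤-antisym (subst (_≤ 1) (trans (sym len)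
          (length-word i u)) m≤1) (ℕ.>-nonZero⁻¹ n)))) (⊹-n i)
      loop : next i ≢ i
      loop i′≡i = contradiction {A = ↓ ≡ ↑} (trans (sym (∈T²⇒↓ u p′∈)) (trans (cong (letter u) i′≡i) (∈T¹⇒↑ u p∈))) λ ()
      go′ : ∀ w → word i u ≡ w → Caps (word i u) (word i v)
      go′ []           eq = contradiction (wrap (cong length eq) z≤n) loop
      go′ (_ ∷ [])     eq = contradiction (wrap (cong length eq) (s≤s z≤n)) loop
      go′ (x ∷ y ∷ w)  eq with des-word⁻ i u eq i∈u
      ... | refl , refl = subst (λ w → Caps w (word i v)) (sym eq)
        (subst (Caps _) (sym (interchange-word⁻ {s = u} {t = v} i [] swapped eq)) swap)
    go : (i ≡ p ⊎ i ≡ next p) ⊎ (next i ≡ p ⊎ next i ≡ next p) → Caps (word i u) (word i v)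
    go (inj₁ (inj₁ i≡p))  = at-p i≡p
    go (inj₁ (inj₂ refl)) = contradiction {A = ↑ ≡ ↓} (trans (sym (proj₁ (∈des⁻ u i∈u))) (∈T²⇒↓ u p′∈)) λ ()
    go (inj₂ (inj₁ refl)) = contradiction {A = ↓ ≡ ↑} (trans (sym (proj₂ (∈des⁻ u i∈u))) (∈T¹⇒↑ u p∈)) λ ()
    go (inj₂ (inj₂ eq))   = at-p (next-injective eq)
  edge⇒caps u v {i} i∈u i∉v (inj₂ (p , q , conditions@((p∈ , q∈ , p≢) , _) , swapped))
    with second⇒word u p q conditions
  ... | D , R , eqᵤ , refl , balanced = go (new-descent u v swapped i∈u i∉v)
    where
    eqᵥ : word p v ≡ ↑ ∷ D ++ ↓ ∷ R
    eqᵥ = interchange-word⁻ {s = u} {t = v} p D swapped eqᵤ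
    go : (i ≡ p ⊎ i ≡ q) ⊎ (next i ≡ p ⊎ next i ≡ q) → Caps (word i u) (word i v)
    go (inj₁ (inj₁ refl)) = contradiction {A = ↑ ≡ ↓} (trans (sym (proj₁ (∈des⁻ u i∈u))) (∈T²⇒↓ u p∈)) λ ()
    go (inj₁ (inj₂ i≡q))  = closing⇒caps p i u v i≡q i∈u eqᵤ eqᵥ balanced p≢
    go (inj₂ (inj₁ i′≡p)) = opening⇒caps p i u v i′≡p i∈u eqᵤ eqᵥ balanced p≢
    go (inj₂ (inj₂ i′≡q)) = contradiction {A = ↓ ≡ ↑} (trans (sym (proj₂ (∈des⁻ u i∈u)))
      (trans (cong (letter u) i′≡q) (∈T¹⇒↑ u q∈))) λ ()

  words⇒second : ∀ u v p D {R} → R ≢ [] → word p u ≡ ↓ ∷ D ++ ↑ ∷ R → word p v ≡ ↑ ∷ D ++ ↓ ∷ R →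
    Balanced 0 D → ConditionC u p (p ⊹ suc (length D)) → SecondKind u v
  words⇒second u v p D {R} R≢[] eqᵤ eqᵥ balanced condC = p , p ⊹ suc (length D) ,
    word⇒second u p D eqᵤ balanced (end≢start p u D R R≢[] eqᵤ) condC ,
    interchange-word⁺ {s = u} {t = v} p D eqᵤ eqᵥ

  -- The new cup provides condition (c): its ↑ precedes p in `opening`, and its ↓ follows q in
  -- `closing`.
  caps⇒edge : ∀ u v {i} → Caps (word i u) (word i v) → Edge u v
  caps⇒edge u v {i} caps = go caps refl refl
    where
    go : ∀ {w w′} → Caps w w′ → word i u ≡ w → word i v ≡ w′ → Edge u v
    go swap eqᵤ eqᵥ = inj₁ (i , (↑⇒∈T¹ u (letter-at i u [] eqᵤ) , ↓⇒∈T² u (letter-at i u [ ↑ ] eqᵤ)) ,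
      interchange-word⁺ {s = u} {t = v} i [] eqᵤ eqᵥ)
    go (opening o) eqᵤ eqᵥ with opens⇒balanced o
    ... | D , R , refl , refl , balanced = inj₂ (words⇒second u v (next i) D (∷ʳ≢[] R)
      (trans (cut-next i (bottom u) eqᵤ) (move ↓ ↑)) (trans (cut-next i (bottom v) eqᵥ) (move ↑ ↓)) balanced
      (inj₁ (↑⇒∈T¹ u (trans (cong (letter u) (prev-next i)) (letter-at i u [] eqᵤ)))))
      where
      move : ∀ (x y : Letter) → (x ∷ D ++ y ∷ R) ∷ʳ ↑ ≡ x ∷ D ++ y ∷ (R ∷ʳ ↑)
      move x y = List.++-assoc (x ∷ D) (y ∷ R) [ ↑ ]
      ∷ʳ≢[] : ∀ (w : Word) {z} → w ∷ʳ z ≢ []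
      ∷ʳ≢[] []      ()
      ∷ʳ≢[] (_ ∷ _) ()
    go (closing c) eqᵤ eqᵥ with closes⇒balanced c
    ... | L , D , refl , refl , balanced = inj₂ (words⇒second u v p D (λ ())
      (word-⊹ i u (↑ ∷ ↓ ∷ L) eqᵤ) (word-⊹ i v (↓ ∷ ↓ ∷ L) eqᵥ) balanced
      (inj₂ (↓⇒∈T² u (trans (cong (letter u ∘ next) around) (letter-at i u [ ↑ ] eqᵤ)))))
      where
      p : Fin n
      p = i ⊹ (2 ℕ.+ length L)
      -- The steps add up to the length n of the word, a full turn.
      around : p ⊹ suc (length D) ≡ i
      around = trans (sym (⊹-+ i (2 ℕ.+ length L) (suc (length D))))
        (trans (cong (i ⊹_) (trans (sym (List.length-++ (↑ ∷ ↓ ∷ L))) (trans (sym (cong length eqᵤ))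
            (length-word i u))))
          (⊹-n i))

-- Identification of Γ with Γ̄

open Laurent using (Laurent; 0#; 1#; fromℕ; mk≈)
open CommutativeRing Laurent.commutativeRing using (_≈_)
private module L = CommutativeRing Laurent.commutativeRing

≅-sym : ∀ {r} {Γ Γ′ : LabeledGraph r} → Γ ≅ Γ′ → Γ′ ≅ Γ
≅-sym {Γ = Γ} {Γ′} iso = record
  { bijection   = ↔-sym bijection
  ; m-preserved = λ u v → L.trans (L.reflexive (cong₂ Γ′.m (sym (to∘from u)) (sym (to∘from v))))
      (L.sym (m-preserved (from u) (from v)))
  ; τ-preserved = λ u → trans (cong Γ′.τ (sym (to∘from u))) (sym (τ-preserved (from u)))
  }
  where
  open _≅_ iso
  open Inverse bijection using (to; from) renaming (strictlyInverseˡ to to∘from)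
  module Γ′ = LabeledGraph Γ′

≅-trans : ∀ {r} {Γ Γ′ Γ″ : LabeledGraph r} → Γ ≅ Γ′ → Γ′ ≅ Γ″ → Γ ≅ Γ″
≅-trans iso iso′ = record
  { bijection   = iso′.bijection ↔-∘ iso.bijection
  ; m-preserved = λ u v → L.trans (iso.m-preserved u v) (iso′.m-preserved (to u) (to v))
  ; τ-preserved = λ u → trans (iso.τ-preserved u) (iso′.τ-preserved (to u))
  }
  where
  module iso  = _≅_ iso
  module iso′ = _≅_ iso′
  open Inverse iso.bijection using (to)

indicator⁻ : ∀ {A : Set} (A? : Dec A) → indicator A? ≈ 1# → A
indicator⁻ (yes a) _   = a
indicator⁻ (no _)  0≈1 = contradiction 0≈1 Laurent.0≉1

fromℕ-0 : fromℕ 0 ≈ 0#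
fromℕ-0 = mk≈ λ k → vanish (does (ℤ.0ℤ ℤ.≟ k))
  where
  vanish : ∀ b → (if b then ℤ.0ℤ else ℤ.0ℤ) ℤ.+ ℤ.0ℤ ≡ ℤ.0ℤ
  vanish true  = refl
  vanish false = refl

decides⇒indicator : ∀ {A : Set} {k} (A? : Dec A) → Decides A k → fromℕ k ≈ indicator A?
decides⇒indicator (yes a) (k≡1 , _) = L.reflexive (cong fromℕ (k≡1 a))
decides⇒indicator (no ¬a) (_ , k≡0) = L.trans (L.reflexive (cong fromℕ (k≡0 ¬a))) fromℕ-0

module Classification {n λ₁ λ₂ : ℕ} .{{_ : NonZero n}}
  (3≤n : 3 ≤ n) (λ₁+λ₂≡n : λ₁ + λ₂ ≡ n) (λ₂<λ₁ : λ₂ < λ₁)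
  (Γ : LabeledGraph n) (reduced : IsReduced Γ) (admissible : IsNbAdmissible Γ)
  (isWGraph : IsWGraph (affineSymmetric n) Γ) (iso : U Γ ≅ D̄ n λ₁ λ₂) where

  open LabeledGraph Γ
  open _≅_ iso
  open Inverse bijection using (to; from) renaming (strictlyInverseˡ to to∘from; strictlyInverseʳ to from∘to)

  -- `V` is finite only through its bijection with tableaux; deduplication yields the
  -- repetition-free list over which the sums run.
  vertices : List V
  vertices = List.deduplicate _≟_ (List.map from (tableaux n λ₁ λ₂))

  ∈vertices : ∀ v → v ∈ᴸ vertices
  ∈vertices v = subst (_∈ᴸ vertices) (from∘to v) (∈-deduplicate⁺ _≟_ (∈-map⁺ from (∈-tableaux (to v))))

  open Specialised admissible isWGraph vertices (deduplicate-! _≟_ _) ∈vertices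
  open IsNbAdmissible admissible using (natural)

  τ-from : ∀ s → τ (from s) ≡ des s
  τ-from s = trans (τ-preserved (from s)) (cong des (to∘from s))

  ∈τ : ∀ s {i} → i ∈ des s → i ∈ τ (from s)
  ∈τ s = subst (_ ∈_) (sym (τ-from s))

  ∉τ : ∀ s {i} → i ∉ des s → i ∉ τ (from s)
  ∉τ s = subst (_ ∉_) (sym (τ-from s))

  exclusive : ∀ {i j} → (∀ s → i ∈ des s → j ∉ des s) → Exclusive i j
  exclusive excl {v} i∈ j∈ = excl (to v) (subst (_ ∈_) (τ-preserved v) i∈) (subst (_ ∈_) (τ-preserved v) j∈)

  M≡1 : ∀ {u v} → m u v ≈ 1# → M u v ≡ 1
  M≡1 {u} {v} m≈1 = fromℕ-injective (L.trans (L.sym (proj₂ (natural u v))) m≈1)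

  Mᵀ : RSYT n λ₁ λ₂ → RSYT n λ₁ λ₂ → ℕ
  Mᵀ s t = M (from s) (from t)

  knuth : ∀ {s t} → KnuthMove s t → Mᵀ s t ≡ 1 × Mᵀ t s ≡ 1
  knuth {s} {t} move = M≡1 (proj₁ edge) , M≡1 (proj₂ edge)
    where
    edge : m (from s) (from t) ≈ 1# × m (from t) (from s) ≈ 1#
    edge = indicator⁻ ((m (from s) (from t) Laurent.≟ 1#) ×-dec (m (from t) (from s) Laurent.≟ 1#))
      (L.trans (m-preserved (from s) (from t)) (L.reflexive
        (trans (cong₂ (λ s t → indicator (knuthMove? s t)) (to∘from s) (to∘from t))
          (cong (if_then 1# else 0#) (dec-true (knuthMove? s t) move)))))

  from-injective : ∀ {s t} → from s ≡ from t → s ≡ t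
  from-injective {s} {t} eq = trans (sym (to∘from s)) (trans (cong to eq) (to∘from t))

  laws : Laws Mᵀ
  laws = record
    { knuth         = knuth
    ; compatible    = λ u v ij i∈u i∉v j∉u j∈v → compatible ij (∈τ u i∈u) (∉τ v i∉v) (∉τ u j∉u) (∈τ v j∈v)
    ; bonded-unique = λ u u₁ s ij excl i∈u j∈u₁ Muu₁ Mu₁u j∈s u₁≢s →
        bonded-unique ij (exclusive excl) (∈τ u i∈u) (∈τ u₁ j∈u₁) Muu₁ Mu₁u (∈τ s j∈s) (u₁≢s ∘ from-injective)
    ; transfer      = λ u u₁ v v₁ ij ik jk excl j∈u k∈u₁ Muu₁ Mu₁u j∈v k∈v₁ Mvv₁ Mv₁v i∈u i∈u₁ i∉v i∉v₁ →
        transfer ij ik jk (exclusive excl) (∈τ u j∈u) (∈τ u₁ k∈u₁) Muu₁ Mu₁u (∈τ v j∈v) (∈τ v₁ k∈v₁) Mvv₁ Mv₁v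
          (∈τ u i∈u) (∈τ u₁ i∈u₁) (∉τ v i∉v) (∉τ v₁ i∉v₁)
    }

  -- Any descent of s missing from t can serve as the cut. Without one, reducedness gives weight 0
  -- and `edge⇒new-descent` rules out a move.
  edge-determines : ∀ s t → Decides (Edge s t) (Mᵀ s t)
  edge-determines s t with Fin.any? (λ i → (i ∈? des s) ×-dec ¬? (i ∈? des t))
  ... | yes (i , i∈s , i∉t) = decides-⇔ (edge⇒caps s t i∈s i∉t) (caps⇒edge s t) refl
    (Determination.caps-determines 3≤n λ₁+λ₂≡n λ₂<λ₁ laws i {s} {t} i∈s i∉t)
  ... | no none = decides-false (none ∘ edge⇒new-descent s t) Mᵀ≡0
    where
    s⊆t : des s ⊆ des t
    s⊆t {i} i∈s = decidable-stable (i ∈? des t) λ i∉t → none (i , i∈s , i∉t)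
    Mᵀ≡0 : Mᵀ s t ≡ 0
    Mᵀ≡0 = fromℕ-injective (L.trans (L.sym (proj₂ (natural (from s) (from t))))
      (L.trans (reduced (from s) (from t) λ {i} i∈ →
          ∈τ t (s⊆t (subst (i ∈_) (τ-from s) i∈))) (L.sym fromℕ-0)))

  m≈Γ̄ : ∀ u v → m u v ≈ indicator (firstKind? (to u) (to v) ⊎-dec secondKind? (to u) (to v))
  m≈Γ̄ u v = L.trans (proj₂ (natural u v)) (decides⇒indicator (firstKind? (to u) (to v) ⊎-dec secondKind? (to u) (to v))
    (subst₂ (λ u′ v′ → Decides (Edge (to u) (to v)) (M u′ v′)) (from∘to u) (from∘to v) (edge-determines (to u) (to v))))

  -- The bijection given for the underlying simple graph already preserves all weights, since these
  -- were computed from the tableaux alone.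
  Γ≅Γ̄ : Γ ≅ Γ̄ n λ₁ λ₂
  Γ≅Γ̄ = record { bijection = bijection ; m-preserved = m≈Γ̄ ; τ-preserved = τ-preserved }

theorem8p6 : (n λ₁ λ₂ : ℕ) .{{_ : NonZero n}} →
    3 ≤ n → λ₁ + λ₂ ≡ n → λ₂ < λ₁ → 1 ≤ λ₂ →
    (Γ Γ′ : LabeledGraph n) →
    IsReduced Γ → IsNbAdmissible Γ → IsWGraph (affineSymmetric n) Γ →
    IsReduced Γ′ → IsNbAdmissible Γ′ → IsWGraph (affineSymmetric n) Γ′ →
    U Γ ≅ U Γ′ → U Γ′ ≅ D̄ n λ₁ λ₂ →
    Γ ≅ Γ′ × Γ ≅ Γ̄ n λ₁ λ₂ × Γ′ ≅ Γ̄ n λ₁ λ₂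
theorem8p6 n λ₁ λ₂ 3≤n λ₁+λ₂≡n λ₂<λ₁ _ Γ Γ′ red adm W red′ adm′ W′ UΓ≅UΓ′ UΓ′≅D̄ =
  ≅-trans Γ≅Γ̄ (≅-sym Γ′≅Γ̄) , Γ≅Γ̄ , Γ′≅Γ̄
  where
  Γ≅Γ̄ : Γ ≅ Γ̄ n λ₁ λ₂
  Γ≅Γ̄ = Classification.Γ≅Γ̄ 3≤n λ₁+λ₂≡n λ₂<λ₁ Γ red adm W (≅-trans UΓ≅UΓ′ UΓ′≅D̄)
  Γ′≅Γ̄ : Γ′ ≅ Γ̄ n λ₁ λ₂
  Γ′≅Γ̄ = Classification.Γ≅Γ̄ 3≤n λ₁+λ₂≡n λ₂<λ₁ Γ′ red′ adm′ W′ UΓ′≅D̄
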